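{- The systems $\mathsf{RTC}_{G}+\mathsf{A}$ and $\mathsf{CRTC}^{\omega}_{G}+\mathsf{A}$ are equivalent: a sequent is provable in $\mathsf{RTC}_{G}+\mathsf{A}$ if and only if it is provable in $\mathsf{CRTC}^{\omega}_{G}+\mathsf{A}$.
   Context: Formulas of $\mathcal{L}_{\mathsf{RTC}}$: first-order formulas with equality extended by $(RTC_{x,y}\,\varphi)(s,t)$ for distinct variables $x,y$ bound in $\varphi$ and terms $s,t$. Here the signature is $\{0,\mathsf{s},+\}$. $\mathcal{LK}_=$: classical sequent calculus with axiom $\varphi\Rightarrow\varphi$, weakening, usual connective/quantifier rules (eigenvariable conditions), $(=L_1)$: from $\Gamma\Rightarrow\varphi[s/x],\Delta$ infer $\Gamma,s=t\Rightarrow\varphi[t/x],\Delta$, $(=L_2)$: from $\Gamma\Rightarrow\varphi[t/x],\Delta$ infer $\Gamma,s=t\Rightarrow\varphi[s/x],\Delta$, $(=R)$: $\Rightarrow t=t$, Cut, and (Subst): from $\Gamma\Rightarrow\Delta$ infer $\Gamma\theta\Rightarrow\Delta\theta$. Rules: (Refl) $\Gamma\Rightarrow\Delta,(RTC_{x,y}\varphi)(s,s)$; (Trans) from $\Gamma\Rightarrow\Delta,(RTC_{x,y}\varphi)(s,r)$ and $\Gamma\Rightarrow\Delta,\varphi[r/x,t/y]$ infer $\Gamma\Rightarrow\Delta,(RTC_{x,y}\varphi)(s,t)$; (Ind) from $\Gamma,\psi(x),\varphi(x,y)\Rightarrow\Delta,\psi[y/x]$ infer $\Gamma,\psi[s/x],(RTC_{x,y}\varphi)(s,t)\Rightarrow\Delta,\psi[t/x]$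 with $x\notin fv(\Gamma,\Delta)$, $y\notin fv(\Gamma,\Delta,\psi)$; (Case) from $\Gamma,s=t\Rightarrow\Delta$ and $\Gamma,(RTC_{x,y}\varphi)(s,z),\varphi[z/x,t/y]\Rightarrow\Delta$ infer $\Gamma,(RTC_{x,y}\varphi)(s,t)\Rightarrow\Delta$, $z$ fresh, $(RTC_{x,y}\varphi)(s,z)$ being the immediate ancestor of the principal formula. $\mathsf{RTC}_G$ = $\mathcal{LK}_=$ + (Refl), (Trans), (Ind), with finite derivation trees as proofs. $\mathsf{RTC}^{\omega}_G$ = $\mathcal{LK}_=$ + (Refl), (Trans), (Case); its proofs are possibly infinite derivation trees without open leaves in which every infinite path is followed by a trace (sequence of $RTC$-formulas in antecedents, consecutive ones being equal, or related by $\tau=\tau'\theta$ across a (Subst) with substitution $\theta$, or being a (Case) principal formula followed by its immediate ancestor, which counts as progress) that progresses infinitely often. $\mathsf{CRTC}^{\omega}_G$ consists of the finite and regular (finitely many distinct subtrees) $\mathsf{RTC}^{\omega}_G$ proofs. $\mathsf{RTC}_{G}+\mathsf{A}$ and $\mathsf{CRTC}^{\omega}_{G}+\mathsf{A}$ are obtained by adding to $\mathsf{RTC}_{G}$ and $\mathsf{CRTC}^{\omega}_{G}$ respectively the axiom sequents $\mathsf{s}x=0\Rightarrow$; $\mathsf{s}x=\mathsf{s}y\Rightarrow x=y$; $\Rightarrow x+0=x$; $\Rightarrow x+\mathsf{s}y=\mathsf{s}(x+y)$; $\Rightarrow(RTC_{w,u}\,\mathsf{s}w=u)(0,x)$. 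-}

module Defs where

open import Data.Nat using (ℕ; zero; suc; _+_; _≤_; _≡ᵇ_)
open import Data.Fin using (Fin; zero; suc; toℕ)
open import Data.Bool using (Bool; true; false; _∨_; if_then_else_)
open import Data.List using (List; []; _∷_; map; length; lookup)
open import Data.List.Relation.Unary.All using (All)
open import Data.List.Membership.Propositional using (_∈_)
open import Data.List.Relation.Binary.Subset.Propositional using (_⊆_)
open import Data.Product using (Σ; _×_; _,_)
open import Data.Sum using (_⊎_)
open import Data.Empty using (⊥)
open import Relation.Binary.PropositionalEquality using (_≡_; _≢_)

-- Syntax of L_RTC over the signature {0, s, +}  (locally nameless:
-- free variables are names ℕ, bound variables are well-scoped indices)

data Term (n : ℕ) : Set where
  bv   : Fin n → Term n
  fv   : ℕ → Term n
  `0   : Term n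
  `s   : Term n → Term n
  _`+_ : Term n → Term n → Term n

data Formula (n : ℕ) : Set where
  _`=_ : Term n → Term n → Formula n
  `¬_  : Formula n → Formula n
  _`∧_ : Formula n → Formula n → Formula n
  _`∨_ : Formula n → Formula n → Formula n
  _`→_ : Formula n → Formula n → Formula n
  `∀   : Formula (suc n) → Formula n
  `∃   : Formula (suc n) → Formula n
  -- (RTC_{x,y} φ)(s,t): in φ, bv zero is x and bv (suc zero) is y
  RTC  : Formula (suc (suc n)) → Term n → Term n → Formula n

renT : ∀ {n m} → (Fin n → Fin m) → Term n → Term m
renT ρ (bv i)   = bv (ρ i)
renT ρ (fv x)   = fv x
renT ρ `0       = `0
renT ρ (`s t)   = `s (renT ρ t)
renT ρ (t `+ u) = renT ρ t `+ renT ρ u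

substT : ∀ {n m} → (Fin n → Term m) → Term n → Term m
substT σ (bv i)   = σ i
substT σ (fv x)   = fv x
substT σ `0       = `0
substT σ (`s t)   = `s (substT σ t)
substT σ (t `+ u) = substT σ t `+ substT σ u

liftS : ∀ {n m} → (Fin n → Term m) → Fin (suc n) → Term (suc m)
liftS σ zero    = bv zero
liftS σ (suc i) = renT suc (σ i)

substF : ∀ {n m} → (Fin n → Term m) → Formula n → Formula m
substF σ (t `= u) = substT σ t `= substT σ u
substF σ (`¬ φ)   = `¬ substF σ φ
substF σ (φ `∧ ψ) = substF σ φ `∧ substF σ ψ
substF σ (φ `∨ ψ) = substF σ φ `∨ substF σ ψ
substF σ (φ `→ ψ) = substF σ φ `→ substF σ ψ
substF σ (`∀ φ)   = `∀ (substF (liftS σ) φ)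
substF σ (`∃ φ)   = `∃ (substF (liftS σ) φ)
substF σ (RTC φ s t) = RTC (substF (liftS (liftS σ)) φ) (substT σ s) (substT σ t)

σ1 : Term 0 → Fin 1 → Term 0
σ1 t zero = t

σ2 : Term 0 → Term 0 → Fin 2 → Term 0
σ2 r t zero       = r
σ2 r t (suc zero) = t

inst1 : Formula 1 → Term 0 → Formula 0
inst1 φ t = substF (σ1 t) φ

inst2 : Formula 2 → Term 0 → Term 0 → Formula 0
inst2 φ r t = substF (σ2 r t) φ

wk0 : ∀ {n} → Term 0 → Term n
wk0 = renT (λ ())

fsubT : ∀ {n} → (ℕ → Term 0) → Term n → Term n
fsubT θ (bv i)   = bv i
fsubT θ (fv x)   = wk0 (θ x)
fsubT θ `0       = `0
fsubT θ (`s t)   = `s (fsubT θ t)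
fsubT θ (t `+ u) = fsubT θ t `+ fsubT θ u

fsubF : ∀ {n} → (ℕ → Term 0) → Formula n → Formula n
fsubF θ (t `= u) = fsubT θ t `= fsubT θ u
fsubF θ (`¬ φ)   = `¬ fsubF θ φ
fsubF θ (φ `∧ ψ) = fsubF θ φ `∧ fsubF θ ψ
fsubF θ (φ `∨ ψ) = fsubF θ φ `∨ fsubF θ ψ
fsubF θ (φ `→ ψ) = fsubF θ φ `→ fsubF θ ψ
fsubF θ (`∀ φ)   = `∀ (fsubF θ φ)
fsubF θ (`∃ φ)   = `∃ (fsubF θ φ)
fsubF θ (RTC φ s t) = RTC (fsubF θ φ) (fsubT θ s) (fsubT θ t)

single : ℕ → Term 0 → ℕ → Term 0
single x s y = if y ≡ᵇ x then s else fv y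

_[_/_] : Formula 0 → Term 0 → ℕ → Formula 0
φ [ s / x ] = fsubF (single x s) φ

occT : ∀ {n} → ℕ → Term n → Bool
occT a (bv i)   = false
occT a (fv x)   = x ≡ᵇ a
occT a `0       = false
occT a (`s t)   = occT a t
occT a (t `+ u) = occT a t ∨ occT a u

occF : ∀ {n} → ℕ → Formula n → Bool
occF a (t `= u) = occT a t ∨ occT a u
occF a (`¬ φ)   = occF a φ
occF a (φ `∧ ψ) = occF a φ ∨ occF a ψ
occF a (φ `∨ ψ) = occF a φ ∨ occF a ψ
occF a (φ `→ ψ) = occF a φ ∨ occF a ψ
occF a (`∀ φ)   = occF a φ
occF a (`∃ φ)   = occF a φ
occF a (RTC φ s t) = occF a φ ∨ occT a s ∨ occT a t

FreshT : ∀ {n} → ℕ → Term n → Set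
FreshT a t = occT a t ≡ false

FreshF : ∀ {n} → ℕ → Formula n → Set
FreshF a φ = occF a φ ≡ false

FreshL : ℕ → List (Formula 0) → Set
FreshL a Γ = All (FreshF a) Γ

-- Sequents (antecedent and succedent read as sets)

record Seq : Set where
  constructor _⇒_
  field
    ante : List (Formula 0)
    succ : List (Formula 0)
open Seq public

infix 4 _⇒_

-- the rules of LK_= together with (Refl), (Trans) and the axioms A.
-- A rule instance is written  Rule conclusion premises.
data BaseRule : Seq → List Seq → Set where
  ax    : ∀ {φ} → BaseRule ((φ ∷ []) ⇒ (φ ∷ [])) []
  -- weakening (sequents are sets, so this also covers exchange/contraction)
  wk    : ∀ {Γ Δ Γ' Δ'} → Γ ⊆ Γ' → Δ ⊆ Δ' → BaseRule (Γ' ⇒ Δ') ((Γ ⇒ Δ) ∷ [])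
  ¬L    : ∀ {Γ Δ φ} → BaseRule ((`¬ φ ∷ Γ) ⇒ Δ) ((Γ ⇒ φ ∷ Δ) ∷ [])
  ¬R    : ∀ {Γ Δ φ} → BaseRule (Γ ⇒ `¬ φ ∷ Δ) ((φ ∷ Γ ⇒ Δ) ∷ [])
  ∧L    : ∀ {Γ Δ φ ψ} → BaseRule ((φ `∧ ψ) ∷ Γ ⇒ Δ) ((φ ∷ ψ ∷ Γ ⇒ Δ) ∷ [])
  ∧R    : ∀ {Γ Δ φ ψ} → BaseRule (Γ ⇒ (φ `∧ ψ) ∷ Δ) ((Γ ⇒ φ ∷ Δ) ∷ (Γ ⇒ ψ ∷ Δ) ∷ [])
  ∨L    : ∀ {Γ Δ φ ψ} → BaseRule ((φ `∨ ψ) ∷ Γ ⇒ Δ) ((φ ∷ Γ ⇒ Δ) ∷ (ψ ∷ Γ ⇒ Δ) ∷ [])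
  ∨R    : ∀ {Γ Δ φ ψ} → BaseRule (Γ ⇒ (φ `∨ ψ) ∷ Δ) ((Γ ⇒ φ ∷ ψ ∷ Δ) ∷ [])
  →L    : ∀ {Γ Δ φ ψ} → BaseRule ((φ `→ ψ) ∷ Γ ⇒ Δ) ((Γ ⇒ φ ∷ Δ) ∷ (ψ ∷ Γ ⇒ Δ) ∷ [])
  →R    : ∀ {Γ Δ φ ψ} → BaseRule (Γ ⇒ (φ `→ ψ) ∷ Δ) ((φ ∷ Γ ⇒ ψ ∷ Δ) ∷ [])
  ∀L    : ∀ {Γ Δ φ} (t : Term 0) → BaseRule (`∀ φ ∷ Γ ⇒ Δ) ((inst1 φ t ∷ Γ ⇒ Δ) ∷ [])
  ∀R    : ∀ {Γ Δ φ} (a : ℕ) → FreshL a Γ → FreshL a Δ → FreshF a φ →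
          BaseRule (Γ ⇒ `∀ φ ∷ Δ) ((Γ ⇒ inst1 φ (fv a) ∷ Δ) ∷ [])
  ∃L    : ∀ {Γ Δ φ} (a : ℕ) → FreshL a Γ → FreshL a Δ → FreshF a φ →
          BaseRule (`∃ φ ∷ Γ ⇒ Δ) ((inst1 φ (fv a) ∷ Γ ⇒ Δ) ∷ [])
  ∃R    : ∀ {Γ Δ φ} (t : Term 0) → BaseRule (Γ ⇒ `∃ φ ∷ Δ) ((Γ ⇒ inst1 φ t ∷ Δ) ∷ [])
  =L₁   : ∀ {Γ Δ} (φ : Formula 0) (x : ℕ) (s t : Term 0) →
          BaseRule ((s `= t) ∷ Γ ⇒ (φ [ t / x ]) ∷ Δ) ((Γ ⇒ (φ [ s / x ]) ∷ Δ) ∷ [])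
  =L₂   : ∀ {Γ Δ} (φ : Formula 0) (x : ℕ) (s t : Term 0) →
          BaseRule ((s `= t) ∷ Γ ⇒ (φ [ s / x ]) ∷ Δ) ((Γ ⇒ (φ [ t / x ]) ∷ Δ) ∷ [])
  =R    : ∀ (t : Term 0) → BaseRule ([] ⇒ (t `= t) ∷ []) []
  cut   : ∀ {Γ Δ} (φ : Formula 0) → BaseRule (Γ ⇒ Δ) ((Γ ⇒ φ ∷ Δ) ∷ (φ ∷ Γ ⇒ Δ) ∷ [])
  refl  : ∀ {Γ Δ φ s} → BaseRule (Γ ⇒ RTC φ s s ∷ Δ) []
  trans : ∀ {Γ Δ φ s t} (r : Term 0) →
          BaseRule (Γ ⇒ RTC φ s t ∷ Δ) ((Γ ⇒ RTC φ s r ∷ Δ) ∷ (Γ ⇒ inst2 φ r t ∷ Δ) ∷ [])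
  -- the axioms A (x = fv 0, y = fv 1; instances are obtained by (Subst))
  A₁    : BaseRule ((`s (fv 0) `= `0) ∷ [] ⇒ []) []
  A₂    : BaseRule ((`s (fv 0) `= `s (fv 1)) ∷ [] ⇒ (fv 0 `= fv 1) ∷ []) []
  A₃    : BaseRule ([] ⇒ ((fv 0 `+ `0) `= fv 0) ∷ []) []
  A₄    : BaseRule ([] ⇒ ((fv 0 `+ `s (fv 1)) `= `s (fv 0 `+ fv 1)) ∷ []) []
  A₅    : BaseRule ([] ⇒ RTC (`s (bv zero) `= bv (suc zero)) `0 (fv 0) ∷ []) []

data SubstRule : Seq → List Seq → Set where
  subst : ∀ {Γ Δ} (θ : ℕ → Term 0) →
          SubstRule (map (fsubF θ) Γ ⇒ map (fsubF θ) Δ) ((Γ ⇒ Δ) ∷ [])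

-- (Ind): ψ has one bound variable (the x of ψ(x)); a, b play the roles of x, y
data IndRule : Seq → List Seq → Set where
  ind : ∀ {Γ Δ} (ψ : Formula 1) (φ : Formula 2) (s t : Term 0) (a b : ℕ) →
        a ≢ b → FreshL a Γ → FreshL a Δ → FreshF a ψ → FreshF a φ →
        FreshL b Γ → FreshL b Δ → FreshF b ψ → FreshF b φ →
        IndRule (inst1 ψ s ∷ RTC φ s t ∷ Γ ⇒ inst1 ψ t ∷ Δ)
                ((inst1 ψ (fv a) ∷ inst2 φ (fv a) (fv b) ∷ Γ ⇒ inst1 ψ (fv b) ∷ Δ) ∷ [])

data CaseRule : Seq → List Seq → Set where
  case : ∀ {Γ Δ} (φ : Formula 2) (s t : Term 0) (z : ℕ) →
         FreshL z Γ → FreshL z Δ → FreshF z φ → FreshT z s → FreshT z t →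
         CaseRule (RTC φ s t ∷ Γ ⇒ Δ)
                  ((s `= t ∷ Γ ⇒ Δ) ∷ (RTC φ s (fv z) ∷ inst2 φ (fv z) t ∷ Γ ⇒ Δ) ∷ [])

data RTCG+A⊢_ : Seq → Set where
  by : ∀ {S ps} → BaseRule S ps ⊎ SubstRule S ps ⊎ IndRule S ps →
       All RTCG+A⊢_ ps → RTCG+A⊢ S

-- CRTC^ω_G + A : regular (possibly infinite) derivation trees, presented
-- as finite graphs whose unfolding from the root is the derivation tree.

CycRule : Seq → List Seq → Set
CycRule S ps = BaseRule S ps ⊎ SubstRule S ps ⊎ CaseRule S ps

data IsRTC : Formula 0 → Set where
  isRTC : ∀ φ s t → IsRTC (RTC φ s t)

-- progress point: τ is the principal formula of a (Case) and τ' is its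
-- immediate ancestor in the second premise
Prog : ∀ {S ps} → CycRule S ps → Fin (length ps) → Formula 0 → Formula 0 → Set
Prog (Data.Sum.inj₁ r) j τ τ' = ⊥
Prog (Data.Sum.inj₂ (Data.Sum.inj₁ r)) j τ τ' = ⊥
Prog (Data.Sum.inj₂ (Data.Sum.inj₂ (case φ s t z _ _ _ _ _))) j τ τ' =
  (toℕ j ≡ 1) × (τ ≡ RTC φ s t) × (τ' ≡ RTC φ s (fv z))

Plain : ∀ {S ps} → CycRule S ps → Fin (length ps) → Formula 0 → Formula 0 → Set
Plain (Data.Sum.inj₂ (Data.Sum.inj₁ (subst θ))) j τ τ' = τ ≡ fsubF θ τ'
Plain (Data.Sum.inj₁ r) j τ τ' = τ ≡ τ'
Plain (Data.Sum.inj₂ (Data.Sum.inj₂ r)) j τ τ' = τ ≡ τ'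

TStep : ∀ {S ps} → CycRule S ps → Fin (length ps) → Formula 0 → Formula 0 → Set
TStep r j τ τ' = Prog r j τ τ' ⊎ Plain r j τ τ'

record PreProof : Set where
  field
    size  : ℕ
    seq   : Fin size → Seq
    prems : Fin size → List Seq
    rule  : (i : Fin size) → CycRule (seq i) (prems i)
    child : (i : Fin size) → Fin (length (prems i)) → Fin size
    childOK : ∀ i j → seq (child i j) ≡ lookup (prems i) j
    root  : Fin size

  record Path : Set where
    field
      node : ℕ → Fin size
      dir  : (n : ℕ) → Fin (length (prems (node n)))
      start : node 0 ≡ root
      next : ∀ n → node (suc n) ≡ child (node n) (dir n)

  InfProgTrace : Path → Set
  InfProgTrace π = Σ ℕ λ m → Σ (ℕ → Formula 0) λ τ →
      (∀ n → IsRTC (τ n))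
    × (∀ n → τ n ∈ ante (seq (node (m + n))))
    × (∀ n → TStep (rule (node (m + n))) (dir (m + n)) (τ n) (τ (suc n)))
    × (∀ n → Σ ℕ λ k → n ≤ k ×
         Prog (rule (node (m + k))) (dir (m + k)) (τ k) (τ (suc k)))
    where open Path π

  GlobalTrace : Set
  GlobalTrace = (π : Path) → InfProgTrace π

record CRTCω+A⊢_ (S : Seq) : Set where
  field
    graph   : PreProof
    rootSeq : PreProof.seq graph (PreProof.root graph) ≡ S
    sound   : PreProof.GlobalTrace graph

module Submission where

-- Each application of (Ind) is replaced by a cut with the sentence "ψ is closed under φ" and a proof of
-- RTC φ s x, ψ(s), "ψ is closed under φ" ⇒ ψ(x) that consists of a single (Case) loop. Loops are never nested, so an
-- infinite path ends up in one of them, and its trace is read off.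
--
-- Conversely, the cyclic proof is shown sound inside RTC_G + A. A true formula RTC φ s t has ranks: the codes of φ-runs
-- from s to t, with u ↦ "u minus the largest 2^k - 1 below it" as decoding function, so that no pairing
-- function is needed. A failing sequent has a failing premise, with ranks that do not increase along traces
-- and decrease at progress points. Abbreviate a finite path by its end points and the trace entries it carries, its colour.
-- There are finitely many colours; the relations between states described by them are closed under composition, and each is
-- well-founded: a colour that is a loop at a reachable node is iterated by an infinite path, whose trace yields a
-- rank that decreases. By the theorem of Podelski and Rybalchenko the union of these relations is well-founded,
-- provably so by arithmetical induction, which contradicts a falsified conclusion.

open import Defs
open import Data.Bool using (Bool; true; false; _∨_; if_then_else_)
import Data.Bool.Properties as Boolₚ
open import Data.Empty using (⊥; ⊥-elim)
open import Data.Fin using (Fin; zero; suc; toℕ; _↑ˡ_)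
import Data.Fin.Properties as Finₚ
open import Data.List using (List; []; _∷_; _++_; map; length; lookup; filter; concatMap; cartesianProduct; allFin)
open import Data.List.Membership.Propositional using (_∈_; find; lose)
open import Data.List.Membership.Propositional.Properties using (∈-map⁺; ∈-map⁻; ∈-++⁺ˡ; ∈-++⁺ʳ; ∈-++⁻; ∈-filter⁺; ∈-filter⁻; ∈-cartesianProduct⁺; ∈-cartesianProduct⁻; ∈-allFin; ∈-lookup; ∈-concatMap⁺; ∈-concatMap⁻)
import Data.List.Properties as Listₚ
open import Data.List.Relation.Binary.Subset.Propositional using (_⊆_)
open import Data.List.Relation.Unary.All as All using (All; []; _∷_)
import Data.List.Relation.Unary.All.Properties as Allₚ
open import Data.List.Relation.Unary.Any as Any using (Any; here; there)
import Data.List.Relation.Unary.Any.Properties as Anyₚ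
open import Data.Nat as ℕ using (ℕ; zero; suc; _≤_; _<_; _≡ᵇ_; _⊔_; z≤n; s≤s)
import Data.Nat.Properties as ℕₚ
open import Data.Product using (Σ; _×_; _,_; proj₁; proj₂)
import Data.Product.Properties as Productₚ
open import Data.Sum using (_⊎_; inj₁; inj₂)
open import Function using (_∘_; id)
open import Relation.Binary.Definitions using (DecidableEquality)
open import Relation.Binary.PropositionalEquality as ≡ using (_≡_; _≢_; cong; cong₂; sym; refl)
open import Relation.Nullary using (Dec; yes; no)
open import Relation.Nullary.Decidable using (map′; _×-dec_)
open import Relation.Unary using (Decidable)

-- The obstacle is that the trace condition quantifies over infinite paths, of which the object
-- language cannot speak. It is therefore used up outside the calculus: for each of the finitely
-- many loop colours one ultimately periodic path is examined, and its trace is cut down to a finite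
-- chain of entries that leads from a formula back to itself with progress. What remains to be
-- derived in the calculus is the well-foundedness of concrete definable relations, stated as a
-- schema over formulas; the theorem on their union needs only instances of that schema and no
-- sequences of states. `RTC` relates single elements, so a step counter cannot accompany the point
-- that moves. A code does both: it determines the point and can be chosen as large as desired,
-- hence strictly larger at every step. A formula has many ranks, and the calculus has no term for
-- the least one. Comparisons therefore have the form "below every rank of the one formula there is
-- a rank of the other", which composes directly.

private variable
  n m k : ℕ
  b b' : Bool
  p q s t u v x y z : Term 0
  φ ψ A B C X Y Z : Formula 0
  Γ Γ' Δ Δ' : List (Formula 0)
  θ θ' : ℕ → Term 0

-- Substitution

cong₃ : ∀ {a b c d} {A : Set a} {B : Set b} {C : Set c} {D : Set d} (f : A → B → C → D) {x x' y y' z z'} →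
        x ≡ x' → y ≡ y' → z ≡ z' → f x y z ≡ f x' y' z'
cong₃ f refl refl refl = refl

⇑ : (ℕ → Term m) → ℕ → Term (suc m)
⇑ θ x = renT suc (θ x)

-- The common generalization of substF and fsubF, in which both can be composed.
gT : (Fin n → Term m) → (ℕ → Term m) → Term n → Term m
gT σ θ (bv i)   = σ i
gT σ θ (fv x)   = θ x
gT σ θ `0       = `0
gT σ θ (`s t)   = `s (gT σ θ t)
gT σ θ (t `+ u) = gT σ θ t `+ gT σ θ u

gF : (Fin n → Term m) → (ℕ → Term m) → Formula n → Formula m
gF σ θ (t `= u) = gT σ θ t `= gT σ θ u
gF σ θ (`¬ φ)   = `¬ gF σ θ φ
gF σ θ (φ `∧ ψ) = gF σ θ φ `∧ gF σ θ ψ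
gF σ θ (φ `∨ ψ) = gF σ θ φ `∨ gF σ θ ψ
gF σ θ (φ `→ ψ) = gF σ θ φ `→ gF σ θ ψ
gF σ θ (`∀ φ)   = `∀ (gF (liftS σ) (⇑ θ) φ)
gF σ θ (`∃ φ)   = `∃ (gF (liftS σ) (⇑ θ) φ)
gF σ θ (RTC φ s t) = RTC (gF (liftS (liftS σ)) (⇑ (⇑ θ)) φ) (gT σ θ s) (gT σ θ t)

∨-trueˡ : ∀ {a b} → a ≡ true → a ∨ b ≡ true
∨-trueˡ refl = refl

∨-trueʳ : ∀ {a b} → b ≡ true → a ∨ b ≡ true
∨-trueʳ {a} refl = Boolₚ.∨-zeroʳ a

≡ᵇ-refl : ∀ x → (x ≡ᵇ x) ≡ true
≡ᵇ-refl zero    = refl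
≡ᵇ-refl (suc x) = ≡ᵇ-refl x

≡ᵇ-sound : ∀ x y → (x ≡ᵇ y) ≡ true → x ≡ y
≡ᵇ-sound zero    zero    _ = refl
≡ᵇ-sound (suc x) (suc y) e = cong suc (≡ᵇ-sound x y e)

-- Agreement is required on occurring names only; this is what turns freshness into invariance in
-- `upd-fresh`.
gT-cong : ∀ {σ σ' : Fin n → Term m} {θ θ'} (t : Term n) → (∀ i → σ i ≡ σ' i) →
          (∀ x → occT x t ≡ true → θ x ≡ θ' x) → gT σ θ t ≡ gT σ' θ' t
gT-cong (bv i)   p q = p i
gT-cong (fv x)   p q = q x (≡ᵇ-refl x)
gT-cong `0       p q = refl
gT-cong (`s t)   p q = cong `s (gT-cong t p q)
gT-cong (t `+ u) p q = cong₂ _`+_ (gT-cong t p (λ x → q x ∘ ∨-trueˡ))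
                                  (gT-cong u p (λ x → q x ∘ ∨-trueʳ {occT x t}))

liftS-cong : ∀ {σ σ' : Fin n → Term m} → (∀ i → σ i ≡ σ' i) → ∀ i → liftS σ i ≡ liftS σ' i
liftS-cong p zero    = refl
liftS-cong p (suc i) = cong (renT suc) (p i)

gF-cong : ∀ {σ σ' : Fin n → Term m} {θ θ'} (φ : Formula n) → (∀ i → σ i ≡ σ' i) →
          (∀ x → occF x φ ≡ true → θ x ≡ θ' x) → gF σ θ φ ≡ gF σ' θ' φ
gF-cong (t `= u) p q = cong₂ _`=_ (gT-cong t p (λ x → q x ∘ ∨-trueˡ)) (gT-cong u p (λ x → q x ∘ ∨-trueʳ {occT x t}))
gF-cong (`¬ φ)   p q = cong `¬_ (gF-cong φ p q)
gF-cong (φ `∧ ψ) p q = cong₂ _`∧_ (gF-cong φ p (λ x → q x ∘ ∨-trueˡ)) (gF-cong ψ p (λ x → q x ∘ ∨-trueʳ {occF x φ}))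
gF-cong (φ `∨ ψ) p q = cong₂ _`∨_ (gF-cong φ p (λ x → q x ∘ ∨-trueˡ)) (gF-cong ψ p (λ x → q x ∘ ∨-trueʳ {occF x φ}))
gF-cong (φ `→ ψ) p q = cong₂ _`→_ (gF-cong φ p (λ x → q x ∘ ∨-trueˡ)) (gF-cong ψ p (λ x → q x ∘ ∨-trueʳ {occF x φ}))
gF-cong (`∀ φ)   p q = cong `∀ (gF-cong φ (liftS-cong p) (λ x → cong (renT suc) ∘ q x))
gF-cong (`∃ φ)   p q = cong `∃ (gF-cong φ (liftS-cong p) (λ x → cong (renT suc) ∘ q x))
gF-cong (RTC φ s t) p q = cong₃ RTC
  (gF-cong φ (liftS-cong (liftS-cong p)) (λ x → cong (renT suc ∘ renT suc) ∘ q x ∘ ∨-trueˡ))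
  (gT-cong s p (λ x → q x ∘ ∨-trueʳ {occF x φ} ∘ ∨-trueˡ))
  (gT-cong t p (λ x → q x ∘ ∨-trueʳ {occF x φ} ∘ ∨-trueʳ {occT x s}))

gF-≗ : ∀ {σ σ' : Fin n → Term m} {θ θ'} (φ : Formula n) → (∀ i → σ i ≡ σ' i) → (∀ x → θ x ≡ θ' x) →
       gF σ θ φ ≡ gF σ' θ' φ
gF-≗ φ p q = gF-cong φ p (λ x _ → q x)

gT-≗ : ∀ {σ σ' : Fin n → Term m} {θ θ'} (t : Term n) → (∀ i → σ i ≡ σ' i) → (∀ x → θ x ≡ θ' x) →
       gT σ θ t ≡ gT σ' θ' t
gT-≗ t p q = gT-cong t p (λ x _ → q x)

gT-id : (t : Term n) → gT bv fv t ≡ t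
gT-id (bv i)   = refl
gT-id (fv x)   = refl
gT-id `0       = refl
gT-id (`s t)   = cong `s (gT-id t)
gT-id (t `+ u) = cong₂ _`+_ (gT-id t) (gT-id u)

liftS-bv : (i : Fin (suc n)) → liftS bv i ≡ bv i
liftS-bv zero    = refl
liftS-bv (suc i) = refl

liftS²-bv : (i : Fin (suc (suc n))) → liftS (liftS bv) i ≡ bv i
liftS²-bv zero    = refl
liftS²-bv (suc i) = cong (renT suc) (liftS-bv i)

gF-id : (φ : Formula n) → gF bv fv φ ≡ φ
gF-id (t `= u) = cong₂ _`=_ (gT-id t) (gT-id u)
gF-id (`¬ φ)   = cong `¬_ (gF-id φ)
gF-id (φ `∧ ψ) = cong₂ _`∧_ (gF-id φ) (gF-id ψ)
gF-id (φ `∨ ψ) = cong₂ _`∨_ (gF-id φ) (gF-id ψ)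
gF-id (φ `→ ψ) = cong₂ _`→_ (gF-id φ) (gF-id ψ)
gF-id (`∀ φ)   = cong `∀ (≡.trans (gF-≗ φ liftS-bv (λ _ → refl)) (gF-id φ))
gF-id (`∃ φ)   = cong `∃ (≡.trans (gF-≗ φ liftS-bv (λ _ → refl)) (gF-id φ))
gF-id (RTC φ s t) = cong₃ RTC (≡.trans (gF-≗ φ liftS²-bv (λ _ → refl)) (gF-id φ)) (gT-id s) (gT-id t)

renT≡gT : ∀ (ρ : Fin n → Fin m) t → renT ρ t ≡ gT (bv ∘ ρ) fv t
renT≡gT ρ (bv i)   = refl
renT≡gT ρ (fv x)   = refl
renT≡gT ρ `0       = refl
renT≡gT ρ (`s t)   = cong `s (renT≡gT ρ t)
renT≡gT ρ (t `+ u) = cong₂ _`+_ (renT≡gT ρ t) (renT≡gT ρ u)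

substT≡gT : ∀ (σ : Fin n → Term m) t → substT σ t ≡ gT σ fv t
substT≡gT σ (bv i)   = refl
substT≡gT σ (fv x)   = refl
substT≡gT σ `0       = refl
substT≡gT σ (`s t)   = cong `s (substT≡gT σ t)
substT≡gT σ (t `+ u) = cong₂ _`+_ (substT≡gT σ t) (substT≡gT σ u)

fsubT≡gT : ∀ θ (t : Term n) → fsubT θ t ≡ gT bv (wk0 ∘ θ) t
fsubT≡gT θ (bv i)   = refl
fsubT≡gT θ (fv x)   = refl
fsubT≡gT θ `0       = refl
fsubT≡gT θ (`s t)   = cong `s (fsubT≡gT θ t)
fsubT≡gT θ (t `+ u) = cong₂ _`+_ (fsubT≡gT θ t) (fsubT≡gT θ u)

gT-gT : ∀ {σ' : Fin m → Term k} {θ'} {σ : Fin n → Term m} {θ} (t : Term n) →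
        gT σ' θ' (gT σ θ t) ≡ gT (gT σ' θ' ∘ σ) (gT σ' θ' ∘ θ) t
gT-gT (bv i)   = refl
gT-gT (fv x)   = refl
gT-gT `0       = refl
gT-gT (`s t)   = cong `s (gT-gT t)
gT-gT (t `+ u) = cong₂ _`+_ (gT-gT t) (gT-gT u)

gT-ren : ∀ {σ : Fin m → Term k} {θ} (ρ : Fin n → Fin m) t → gT σ θ (renT ρ t) ≡ gT (σ ∘ ρ) θ t
gT-ren ρ t = ≡.trans (cong (gT _ _) (renT≡gT ρ t)) (gT-gT t)

gT-lift : ∀ {σ : Fin n → Term m} {θ} t → gT (liftS σ) (⇑ θ) (renT suc t) ≡ renT suc (gT σ θ t)
gT-lift {σ = σ} {θ} t = ≡.trans (gT-ren suc t) (≡.sym (≡.trans (renT≡gT suc (gT σ θ t))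
  (≡.trans (gT-gT t) (gT-≗ t (λ i → sym (renT≡gT suc (σ i))) (λ x → sym (renT≡gT suc (θ x)))))))

lift-comp : ∀ {σ' : Fin m → Term k} {θ'} {σ : Fin n → Term m} i →
            gT (liftS σ') (⇑ θ') (liftS σ i) ≡ liftS (gT σ' θ' ∘ σ) i
lift-comp zero = refl
lift-comp {σ = σ} (suc i) = gT-lift (σ i)

lift²-comp : ∀ {σ' : Fin m → Term k} {θ'} {σ : Fin n → Term m} i →
             gT (liftS (liftS σ')) (⇑ (⇑ θ')) (liftS (liftS σ) i) ≡ liftS (liftS (gT σ' θ' ∘ σ)) i
lift²-comp i = ≡.trans (lift-comp i) (liftS-cong lift-comp i)

⇑²-comp : ∀ {σ' : Fin m → Term k} {θ'} t →
          gT (liftS (liftS σ')) (⇑ (⇑ θ')) (renT suc (renT suc t)) ≡ renT suc (renT suc (gT σ' θ' t))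
⇑²-comp t = ≡.trans (gT-lift (renT suc t)) (cong (renT suc) (gT-lift t))

-- Both kinds of substitution are instances of `gF`, so every interchange law below reduces to this
-- one.
gF-gF : ∀ {σ' : Fin m → Term k} {θ'} {σ : Fin n → Term m} {θ} (φ : Formula n) →
        gF σ' θ' (gF σ θ φ) ≡ gF (gT σ' θ' ∘ σ) (gT σ' θ' ∘ θ) φ
gF-gF (t `= u) = cong₂ _`=_ (gT-gT t) (gT-gT u)
gF-gF (`¬ φ)   = cong `¬_ (gF-gF φ)
gF-gF (φ `∧ ψ) = cong₂ _`∧_ (gF-gF φ) (gF-gF ψ)
gF-gF (φ `∨ ψ) = cong₂ _`∨_ (gF-gF φ) (gF-gF ψ)
gF-gF (φ `→ ψ) = cong₂ _`→_ (gF-gF φ) (gF-gF ψ)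
gF-gF {θ = θ} (`∀ φ) = cong `∀ (≡.trans (gF-gF φ) (gF-≗ φ lift-comp (λ x → gT-lift (θ x))))
gF-gF {θ = θ} (`∃ φ) = cong `∃ (≡.trans (gF-gF φ) (gF-≗ φ lift-comp (λ x → gT-lift (θ x))))
gF-gF {θ = θ} (RTC φ s t) =
  cong₃ RTC (≡.trans (gF-gF φ) (gF-≗ φ lift²-comp (λ x → ⇑²-comp (θ x)))) (gT-gT s) (gT-gT t)

wk0-ren : ∀ (ρ : Fin n → Fin m) t → renT ρ (wk0 t) ≡ wk0 t
wk0-ren ρ t = ≡.trans (renT≡gT ρ (wk0 t)) (≡.trans (gT-ren (λ ()) t)
  (≡.trans (gT-≗ t (λ ()) (λ _ → refl)) (sym (renT≡gT (λ ()) t))))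

wk0-id : (t : Term 0) → wk0 t ≡ t
wk0-id t = ≡.trans (renT≡gT (λ ()) t) (≡.trans (gT-≗ t (λ ()) (λ _ → refl)) (gT-id t))

substF≡gF : ∀ (σ : Fin n → Term m) φ → substF σ φ ≡ gF σ fv φ
substF≡gF σ (t `= u) = cong₂ _`=_ (substT≡gT σ t) (substT≡gT σ u)
substF≡gF σ (`¬ φ)   = cong `¬_ (substF≡gF σ φ)
substF≡gF σ (φ `∧ ψ) = cong₂ _`∧_ (substF≡gF σ φ) (substF≡gF σ ψ)
substF≡gF σ (φ `∨ ψ) = cong₂ _`∨_ (substF≡gF σ φ) (substF≡gF σ ψ)
substF≡gF σ (φ `→ ψ) = cong₂ _`→_ (substF≡gF σ φ) (substF≡gF σ ψ)
substF≡gF σ (`∀ φ)   = cong `∀ (substF≡gF (liftS σ) φ)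
substF≡gF σ (`∃ φ)   = cong `∃ (substF≡gF (liftS σ) φ)
substF≡gF σ (RTC φ s t) = cong₃ RTC (substF≡gF (liftS (liftS σ)) φ) (substT≡gT σ s) (substT≡gT σ t)

fsubF≡gF : ∀ θ (φ : Formula n) → fsubF θ φ ≡ gF bv (wk0 ∘ θ) φ
fsubF≡gF θ (t `= u) = cong₂ _`=_ (fsubT≡gT θ t) (fsubT≡gT θ u)
fsubF≡gF θ (`¬ φ)   = cong `¬_ (fsubF≡gF θ φ)
fsubF≡gF θ (φ `∧ ψ) = cong₂ _`∧_ (fsubF≡gF θ φ) (fsubF≡gF θ ψ)
fsubF≡gF θ (φ `∨ ψ) = cong₂ _`∨_ (fsubF≡gF θ φ) (fsubF≡gF θ ψ)
fsubF≡gF θ (φ `→ ψ) = cong₂ _`→_ (fsubF≡gF θ φ) (fsubF≡gF θ ψ)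
fsubF≡gF θ (`∀ φ)   = cong `∀ (≡.trans (fsubF≡gF θ φ)
  (gF-≗ φ (sym ∘ liftS-bv) (λ x → sym (wk0-ren suc (θ x)))))
fsubF≡gF θ (`∃ φ)   = cong `∃ (≡.trans (fsubF≡gF θ φ)
  (gF-≗ φ (sym ∘ liftS-bv) (λ x → sym (wk0-ren suc (θ x)))))
fsubF≡gF θ (RTC φ s t) = cong₃ RTC (≡.trans (fsubF≡gF θ φ)
  (gF-≗ φ (sym ∘ liftS²-bv) (λ x → sym (≡.trans (cong (renT suc) (wk0-ren suc (θ x))) (wk0-ren suc (θ x))))))
  (fsubT≡gT θ s) (fsubT≡gT θ t)

substF-gF : ∀ (σ' : Fin m → Term k) {σ : Fin n → Term m} {θ} φ →
            substF σ' (gF σ θ φ) ≡ gF (substT σ' ∘ σ) (substT σ' ∘ θ) φ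
substF-gF σ' {σ} {θ} φ = ≡.trans (substF≡gF σ' _) (≡.trans (gF-gF φ)
  (gF-≗ φ (λ i → sym (substT≡gT σ' (σ i))) (λ x → sym (substT≡gT σ' (θ x)))))

fsubF-gF : ∀ θ' {σ : Fin n → Term m} {θ} φ →
           fsubF θ' (gF σ θ φ) ≡ gF (fsubT θ' ∘ σ) (fsubT θ' ∘ θ) φ
fsubF-gF θ' {σ} {θ} φ = ≡.trans (fsubF≡gF θ' _) (≡.trans (gF-gF φ)
  (gF-≗ φ (λ i → sym (fsubT≡gT θ' (σ i))) (λ x → sym (fsubT≡gT θ' (θ x)))))

substF-substF : ∀ (σ' : Fin m → Term k) (σ : Fin n → Term m) φ →
                substF σ' (substF σ φ) ≡ substF (substT σ' ∘ σ) φ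
substF-substF σ' σ φ = ≡.trans (cong (substF σ') (substF≡gF σ φ))
  (≡.trans (substF-gF σ' φ) (sym (substF≡gF _ φ)))

substF-≗ : ∀ {σ σ' : Fin n → Term m} φ → (∀ i → σ i ≡ σ' i) → substF σ φ ≡ substF σ' φ
substF-≗ φ p = ≡.trans (substF≡gF _ φ) (≡.trans (gF-≗ φ p (λ _ → refl)) (sym (substF≡gF _ φ)))

substT-wk0 : ∀ (σ : Fin n → Term m) t → substT σ (wk0 t) ≡ wk0 t
substT-wk0 σ t = ≡.trans (substT≡gT σ (wk0 t)) (≡.trans (gT-ren (λ ()) t)
  (≡.trans (gT-≗ t (λ ()) (λ _ → refl)) (sym (renT≡gT (λ ()) t))))

substF-fsubF : ∀ (σ : Fin n → Term m) θ φ → substF σ (fsubF θ φ) ≡ gF σ (wk0 ∘ θ) φ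
substF-fsubF σ θ φ = ≡.trans (cong (substF σ) (fsubF≡gF θ φ)) (≡.trans (substF-gF σ φ)
  (gF-≗ φ (λ _ → refl) (λ x → substT-wk0 σ (θ x))))

fsubF-substF : ∀ θ (σ : Fin n → Term m) φ → fsubF θ (substF σ φ) ≡ substF (fsubT θ ∘ σ) (fsubF θ φ)
fsubF-substF θ σ φ = ≡.trans (cong (fsubF θ) (substF≡gF σ φ)) (≡.trans (fsubF-gF θ φ) (sym (substF-fsubF _ θ φ)))

fsubF-fsubF : ∀ θ' θ (φ : Formula 0) → fsubF θ' (fsubF θ φ) ≡ fsubF (fsubT θ' ∘ θ) φ
fsubF-fsubF θ' θ φ = ≡.trans (cong (fsubF θ') (fsubF≡gF θ φ)) (≡.trans (fsubF-gF θ' φ)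
  (≡.trans (gF-≗ φ (λ ()) (λ x → ≡.trans (cong (fsubT θ') (wk0-id (θ x))) (sym (wk0-id _)))) (sym (fsubF≡gF _ φ))))

fsubF-cong : ∀ {θ θ'} (φ : Formula n) → (∀ x → occF x φ ≡ true → θ x ≡ θ' x) → fsubF θ φ ≡ fsubF θ' φ
fsubF-cong φ q = ≡.trans (fsubF≡gF _ φ) (≡.trans (gF-cong φ (λ _ → refl) (λ x → cong wk0 ∘ q x)) (sym (fsubF≡gF _ φ)))

fsubT-cong : ∀ {θ θ'} (t : Term n) → (∀ x → occT x t ≡ true → θ x ≡ θ' x) → fsubT θ t ≡ fsubT θ' t
fsubT-cong t q = ≡.trans (fsubT≡gT _ t) (≡.trans (gT-cong t (λ _ → refl) (λ x → cong wk0 ∘ q x)) (sym (fsubT≡gT _ t)))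

fsubF-id : (φ : Formula n) → fsubF fv φ ≡ φ
fsubF-id φ = ≡.trans (fsubF≡gF fv φ) (gF-id φ)

fsubT-id : (t : Term n) → fsubT fv t ≡ t
fsubT-id t = ≡.trans (fsubT≡gT fv t) (gT-id t)

fsubF-inst1 : ∀ θ φ t → fsubF θ (inst1 φ t) ≡ inst1 (fsubF θ φ) (fsubT θ t)
fsubF-inst1 θ φ t = ≡.trans (fsubF-substF θ (σ1 t) φ) (substF-≗ (fsubF θ φ) λ { zero → refl })

fsubF-inst2 : ∀ θ φ r t → fsubF θ (inst2 φ r t) ≡ inst2 (fsubF θ φ) (fsubT θ r) (fsubT θ t)
fsubF-inst2 θ φ r t = ≡.trans (fsubF-substF θ (σ2 r t) φ) (substF-≗ (fsubF θ φ) λ { zero → refl ; (suc zero) → refl })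

infixr 5 _◂_
_◂_ : {A : Set} → A → (Fin n → A) → Fin (suc n) → A
(u ◂ σ) zero    = u
(u ◂ σ) (suc i) = σ i

-- Parameters of a family are weakened under its binder; instantiation undoes this. Nearly every
-- `Fam` is justified by this equation.
iw : ∀ u (s : Term 0) → substT (σ1 u) (renT suc s) ≡ s
iw u s = ≡.trans (substT≡gT (σ1 u) (renT suc s)) (≡.trans (gT-ren suc s) (≡.trans (gT-≗ s (λ ()) (λ _ → refl)) (gT-id s)))

inst1-lift : ∀ (σ : Fin n → Term 0) φ u → inst1 (substF (liftS σ) φ) u ≡ substF (u ◂ σ) φ
inst1-lift σ φ u = ≡.trans (substF-substF (σ1 u) (liftS σ) φ)
  (substF-≗ φ λ { zero → refl ; (suc i) → iw u (σ i) })

fresh≢ : ∀ {A : Set} {b} → b ≡ true → b ≡ false → A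
fresh≢ refl ()

single-self : ∀ x s → single x s x ≡ s
single-self x s rewrite ≡ᵇ-refl x = refl

_[_↦_] : (ℕ → Term 0) → ℕ → Term 0 → ℕ → Term 0
(θ [ x ↦ s ]) y = if y ≡ᵇ x then s else θ y

upd-self : ∀ θ x s → (θ [ x ↦ s ]) x ≡ s
upd-self θ x s rewrite ≡ᵇ-refl x = refl

upd-fresh : ∀ θ a s {φ : Formula n} → FreshF a φ → fsubF (θ [ a ↦ s ]) φ ≡ fsubF θ φ
upd-fresh θ a s {φ} fr = fsubF-cong φ go
  where
  go : ∀ x → occF x φ ≡ true → (θ [ a ↦ s ]) x ≡ θ x
  go x o with x ≡ᵇ a in e
  ... | false = refl
  ... | true rewrite ≡ᵇ-sound x a e = fresh≢ o fr

upd-freshT : ∀ θ a s {t : Term n} → FreshT a t → fsubT (θ [ a ↦ s ]) t ≡ fsubT θ t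
upd-freshT θ a s {t} fr = fsubT-cong t go
  where
  go : ∀ x → occT x t ≡ true → (θ [ a ↦ s ]) x ≡ θ x
  go x o with x ≡ᵇ a in e
  ... | false = refl
  ... | true rewrite ≡ᵇ-sound x a e = fresh≢ o fr

fsubF-single : ∀ θ φ s x → fsubF θ (φ [ s / x ]) ≡ fsubF (θ [ x ↦ fsubT θ s ]) φ
fsubF-single θ φ s x = ≡.trans (fsubF-fsubF θ (single x s) φ) (fsubF-cong φ λ y _ → go y)
  where
  go : ∀ y → fsubT θ (single x s y) ≡ (θ [ x ↦ fsubT θ s ]) y
  go y with y ≡ᵇ x
  ... | true  = refl
  ... | false = wk0-id (θ y)

inst1-single : ∀ (φ : Formula 1) s c → FreshF c φ → (inst1 φ (fv c)) [ s / c ] ≡ inst1 φ s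
inst1-single φ s c fr = ≡.trans (fsubF-inst1 (single c s) φ (fv c))
  (cong₂ inst1 (≡.trans (upd-fresh fv c s fr) (fsubF-id φ)) (≡.trans (wk0-id _) (single-self c s)))

-- Bounds on the names in a formula, as a supply of fresh names

supT : Term n → ℕ
supT (bv i)   = 0
supT (fv x)   = suc x
supT `0       = 0
supT (`s t)   = supT t
supT (t `+ u) = supT t ⊔ supT u

supF : Formula n → ℕ
supF (t `= u) = supT t ⊔ supT u
supF (`¬ φ)   = supF φ
supF (φ `∧ ψ) = supF φ ⊔ supF ψ
supF (φ `∨ ψ) = supF φ ⊔ supF ψ
supF (φ `→ ψ) = supF φ ⊔ supF ψ
supF (`∀ φ)   = supF φ
supF (`∃ φ)   = supF φ
supF (RTC φ s t) = supF φ ⊔ (supT s ⊔ supT t)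

∨-true⁻ : ∀ {A : Set} {a b} → (a ≡ true → A) → (b ≡ true → A) → a ∨ b ≡ true → A
∨-true⁻ {a = true}  f g e = f refl
∨-true⁻ {a = false} f g e = g e

≤⊔ˡ : ∀ {x a b} → x ≤ a → x ≤ a ⊔ b
≤⊔ˡ {x} {a} {b} p = ℕₚ.≤-trans p (ℕₚ.m≤m⊔n a b)

≤⊔ʳ : ∀ {x} a {b} → x ≤ b → x ≤ a ⊔ b
≤⊔ʳ {x} a {b} p = ℕₚ.≤-trans p (ℕₚ.m≤n⊔m a b)

occT-sup : ∀ x (t : Term n) → occT x t ≡ true → x < supT t
occT-sup x (fv y) e rewrite ≡ᵇ-sound y x e = ℕₚ.≤-refl
occT-sup x (`s t) e = occT-sup x t e
occT-sup x (t `+ u) = ∨-true⁻ (≤⊔ˡ ∘ occT-sup x t) (≤⊔ʳ (supT t) ∘ occT-sup x u)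

occF-sup : ∀ x (φ : Formula n) → occF x φ ≡ true → x < supF φ
occF-sup x (t `= u) = ∨-true⁻ (≤⊔ˡ ∘ occT-sup x t) (≤⊔ʳ (supT t) ∘ occT-sup x u)
occF-sup x (`¬ φ) = occF-sup x φ
occF-sup x (φ `∧ ψ) = ∨-true⁻ (≤⊔ˡ ∘ occF-sup x φ) (≤⊔ʳ (supF φ) ∘ occF-sup x ψ)
occF-sup x (φ `∨ ψ) = ∨-true⁻ (≤⊔ˡ ∘ occF-sup x φ) (≤⊔ʳ (supF φ) ∘ occF-sup x ψ)
occF-sup x (φ `→ ψ) = ∨-true⁻ (≤⊔ˡ ∘ occF-sup x φ) (≤⊔ʳ (supF φ) ∘ occF-sup x ψ)
occF-sup x (`∀ φ) = occF-sup x φ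
occF-sup x (`∃ φ) = occF-sup x φ
occF-sup x (RTC φ s t) = ∨-true⁻ (≤⊔ˡ ∘ occF-sup x φ) (≤⊔ʳ (supF φ) ∘
  ∨-true⁻ (≤⊔ˡ ∘ occT-sup x s) (≤⊔ʳ (supT s) ∘ occT-sup x t))

supL : List (Formula 0) → ℕ
supL []      = 0
supL (φ ∷ Γ) = supF φ ⊔ supL Γ

-- The bounds are strict, so a bound is itself fresh; maxima of bounds serve as eigenvariables
-- throughout.
freshF : ∀ a (φ : Formula n) → supF φ ≤ a → FreshF a φ
freshF a φ p with occF a φ in e
... | true  = ⊥-elim (ℕₚ.<⇒≱ (occF-sup a φ e) p)
... | false = refl

freshT : ∀ a (t : Term n) → supT t ≤ a → FreshT a t
freshT a t p with occT a t in e
... | true  = ⊥-elim (ℕₚ.<⇒≱ (occT-sup a t e) p)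
... | false = refl

freshL : ∀ a Γ → supL Γ ≤ a → FreshL a Γ
freshL a []      p = []
freshL a (φ ∷ Γ) p = freshF a φ (ℕₚ.m⊔n≤o⇒m≤o _ _ p) ∷ freshL a Γ (ℕₚ.m⊔n≤o⇒n≤o (supF φ) _ p)

sup-mem : ∀ {φ Γ} → φ ∈ Γ → supF φ ≤ supL Γ
sup-mem (here refl)             = ≤⊔ˡ ℕₚ.≤-refl
sup-mem {Γ = ψ ∷ _} (there i) = ≤⊔ʳ (supF ψ) (sup-mem i)

-- Natural deduction in RTC_G + A

base : ∀ {S ps} → BaseRule S ps → All RTCG+A⊢_ ps → RTCG+A⊢ S
base r = by (inj₁ r)

infix 3 _⊩_
_⊩_ : List (Formula 0) → Formula 0 → Set
Γ ⊩ φ = RTCG+A⊢ (Γ ⇒ φ ∷ [])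

bot : Formula n
bot = `¬ (`0 `= `0)

weaken : Γ ⊆ Γ' → Δ ⊆ Δ' → RTCG+A⊢ (Γ ⇒ Δ) → RTCG+A⊢ (Γ' ⇒ Δ')
weaken p q d = base (wk p q) (d ∷ [])

hyp : φ ∈ Γ → Γ ⊩ φ
hyp i = weaken (λ { (here refl) → i }) id (base ax [])

mono : Γ ⊆ Γ' → Γ ⊩ φ → Γ' ⊩ φ
mono p = weaken p id

w : Γ ⊩ φ → ψ ∷ Γ ⊩ φ
w = mono there

w² : Γ ⊩ φ → A ∷ B ∷ Γ ⊩ φ
w² = w ∘ w

w³ : Γ ⊩ φ → A ∷ B ∷ C ∷ Γ ⊩ φ
w³ = w ∘ w ∘ w

h0 : A ∷ Γ ⊩ A
h0 = hyp (here refl)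

h1 : A ∷ B ∷ Γ ⊩ B
h1 = w h0

h2 : A ∷ B ∷ C ∷ Γ ⊩ C
h2 = w h1

h3 : A ∷ B ∷ C ∷ φ ∷ Γ ⊩ φ
h3 = w h2

h4 : ∀ {D} → A ∷ B ∷ C ∷ D ∷ φ ∷ Γ ⊩ φ
h4 = w h3

h5 : ∀ {D E} → A ∷ B ∷ C ∷ D ∷ E ∷ φ ∷ Γ ⊩ φ
h5 = w h4

h6 : ∀ {D E F} → A ∷ B ∷ C ∷ D ∷ E ∷ F ∷ φ ∷ Γ ⊩ φ
h6 = w h5

h7 : ∀ {D E F G} → A ∷ B ∷ C ∷ D ∷ E ∷ F ∷ G ∷ φ ∷ Γ ⊩ φ
h7 = w h6

wkR : Γ ⊩ φ → RTCG+A⊢ (Γ ⇒ φ ∷ Δ)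
wkR = weaken id (λ { (here refl) → here refl })

cutI : Γ ⊩ φ → φ ∷ Γ ⊩ ψ → Γ ⊩ ψ
cutI {φ = φ} d e = base (cut φ) (wkR d ∷ e ∷ [])

-- There is no falsity constant and `⊩` has exactly one formula on the right; this is the way back
-- to an empty succedent.
noRHS : Γ ⊩ bot → RTCG+A⊢ (Γ ⇒ [])
noRHS d = base (cut bot) (d ∷ base ¬L (weaken (λ ()) id (base (=R `0) []) ∷ []) ∷ [])

botE : Γ ⊩ bot → Γ ⊩ φ
botE d = weaken id (λ ()) (noRHS d)

→I : A ∷ Γ ⊩ B → Γ ⊩ A `→ B
→I d = base →R (d ∷ [])

→E : Γ ⊩ A `→ B → Γ ⊩ A → Γ ⊩ B
→E f d = cutI f (base →L (wkR d ∷ h0 ∷ []))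

¬I : A ∷ Γ ⊩ bot → Γ ⊩ `¬ A
¬I d = base ¬R (noRHS d ∷ [])

¬E : Γ ⊩ `¬ A → Γ ⊩ A → Γ ⊩ B
¬E f d = cutI f (base ¬L (wkR d ∷ []))

raa : `¬ A ∷ Γ ⊩ bot → Γ ⊩ A
raa {A} d = base (cut (`¬ A)) (base ¬R (h0 ∷ []) ∷ botE d ∷ [])

∧I : Γ ⊩ A → Γ ⊩ B → Γ ⊩ A `∧ B
∧I a b = base ∧R (a ∷ b ∷ [])

∧open : A ∷ B ∷ Γ ⊩ C → (A `∧ B) ∷ Γ ⊩ C
∧open d = base ∧L (d ∷ [])

∧E₁ : Γ ⊩ A `∧ B → Γ ⊩ A
∧E₁ d = cutI d (∧open h0)

∧E₂ : Γ ⊩ A `∧ B → Γ ⊩ B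
∧E₂ d = cutI d (∧open h1)

∨I₁ : Γ ⊩ A → Γ ⊩ A `∨ B
∨I₁ d = base ∨R (weaken id (λ { (here refl) → here refl }) d ∷ [])

∨I₂ : Γ ⊩ B → Γ ⊩ A `∨ B
∨I₂ d = base ∨R (weaken id (λ { (here refl) → there (here refl) }) d ∷ [])

∨E : Γ ⊩ A `∨ B → A ∷ Γ ⊩ C → B ∷ Γ ⊩ C → Γ ⊩ C
∨E d e f = cutI d (base ∨L (e ∷ f ∷ []))

em : A ∷ Γ ⊩ C → `¬ A ∷ Γ ⊩ C → Γ ⊩ C
em {A} d e = base (cut (`¬ A)) (base ¬R (d ∷ []) ∷ e ∷ [])

-- The equation is propositional: substituting into a weakened term, as in inst1 (… renT suc s …) t, does not compute.
Fam : (Term 0 → Formula 0) → Set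
Fam F = Σ (Formula 1) λ β → ∀ t → inst1 β t ≡ F t

coe : A ≡ B → Γ ⊩ A → Γ ⊩ B
coe refl d = d

coeL : A ≡ B → A ∷ Γ ⊩ C → B ∷ Γ ⊩ C
coeL refl d = d

-- The premise is a function of the term. The eigenvariable is chosen here once and for all, so
-- later derivations carry no freshness conditions.
∀I : ∀ {β} → (∀ t → Γ ⊩ inst1 β t) → Γ ⊩ `∀ β
∀I {Γ} {β} d = base (∀R a (freshL a Γ (≤⊔ˡ ℕₚ.≤-refl)) [] (freshF a β (≤⊔ʳ (supL Γ) ℕₚ.≤-refl))) (d (fv a) ∷ [])
  where a = supL Γ ⊔ supF β

∀E : ∀ {β} → Γ ⊩ `∀ β → ∀ t → Γ ⊩ inst1 β t
∀E d t = cutI d (base (∀L t) (h0 ∷ []))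

∃I : ∀ {β} t → Γ ⊩ inst1 β t → Γ ⊩ `∃ β
∃I t d = base (∃R t) (d ∷ [])

∃E : ∀ {β} → Γ ⊩ `∃ β → (∀ t → inst1 β t ∷ Γ ⊩ C) → Γ ⊩ C
∃E {Γ} {C} {β} d e = cutI d (base (∃L a (freshL a Γ (≤⊔ˡ (≤⊔ˡ ℕₚ.≤-refl)))
    (freshF a C (≤⊔ˡ (≤⊔ʳ (supL Γ) ℕₚ.≤-refl)) ∷ []) (freshF a β (≤⊔ʳ (supL Γ ⊔ supF C) ℕₚ.≤-refl))) (e (fv a) ∷ []))
  where a = supL Γ ⊔ supF C ⊔ supF β

exI : ∀ {β} (F : Term 0 → Formula 0) → (∀ t → inst1 β t ≡ F t) → ∀ t → Γ ⊩ F t → Γ ⊩ `∃ β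
exI F eq t d = ∃I t (coe (sym (eq t)) d)

exE : ∀ {β} (F : Term 0 → Formula 0) → (∀ t → inst1 β t ≡ F t) → Γ ⊩ `∃ β → (∀ t → F t ∷ Γ ⊩ C) → Γ ⊩ C
exE F eq d e = ∃E d (λ t → coeL (sym (eq t)) (e t))

eqR : ∀ {t} → Γ ⊩ t `= t
eqR {t = t} = mono (λ ()) (base (=R t) [])

-- The equality rules replace free names, so the hole of the family is filled with a name that is
-- fresh for it.
eqE : ∀ {F s t} → Fam F → Γ ⊩ s `= t → Γ ⊩ F s → Γ ⊩ F t
eqE {Γ} {F} {s} {t} (β , eq) e d = cutI e (coe (≡.trans (inst1-single β t c fr) (eq t))
    (base (=L₁ (inst1 β (fv c)) c s t) (coe (sym (≡.trans (inst1-single β s c fr) (eq s))) d ∷ [])))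
  where
  c = supF β
  fr = freshF c β ℕₚ.≤-refl

eqSym : ∀ {s t} → Γ ⊩ s `= t → Γ ⊩ t `= s
eqSym {s = s} e = eqE {F = λ x → x `= s} (bv zero `= renT suc s , λ t → cong (t `=_) (iw t s)) e eqR

eqTrans : ∀ {s t u} → Γ ⊩ s `= t → Γ ⊩ t `= u → Γ ⊩ s `= u
eqTrans {s = s} d e = eqE {F = λ x → s `= x} (renT suc s `= bv zero , λ t → cong (_`= t) (iw t s)) e d

indE : ∀ {F β s t} → Fam F → Γ ⊩ F s → Γ ⊩ RTC β s t →
       (∀ a b → F a ∷ inst2 β a b ∷ Γ ⊩ F b) → Γ ⊩ F t
indE {Γ} {F} {β} {s} {t} (γ , eq) d r step = coe (eq t) (cutI r (cutI (w (coe (sym (eq s)) d))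
    (weaken (λ { (here refl) → here refl ; (there (here refl)) → there (here refl) ; (there (there i)) → there (there i) }) id
      (by (inj₂ (inj₂ (ind γ β s t a₁ b₁ a₁≢b₁ (freshL a₁ Γ pΓ) [] (freshF a₁ γ pγ) (freshF a₁ β pβ)
          (freshL b₁ Γ (ℕₚ.m≤n⇒m≤1+n pΓ)) [] (freshF b₁ γ (ℕₚ.m≤n⇒m≤1+n pγ)) (freshF b₁ β (ℕₚ.m≤n⇒m≤1+n pβ)))))
        (coe (sym (eq (fv b₁))) (coeL (sym (eq (fv a₁))) (step (fv a₁) (fv b₁))) ∷ [])))))
  where
  a₁ b₁ : ℕ
  a₁ = supL Γ ⊔ supF γ ⊔ supF β
  b₁ = suc a₁
  a₁≢b₁ : a₁ ≢ b₁
  a₁≢b₁ = ℕₚ.<⇒≢ ℕₚ.≤-refl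
  pΓ : supL Γ ≤ a₁
  pΓ = ≤⊔ˡ (≤⊔ˡ ℕₚ.≤-refl)
  pγ : supF γ ≤ a₁
  pγ = ≤⊔ˡ (≤⊔ʳ (supL Γ) ℕₚ.≤-refl)
  pβ : supF β ≤ a₁
  pβ = ≤⊔ʳ (supL Γ ⊔ supF γ) ℕₚ.≤-refl

-- Instances of the axioms, and induction on numbers

substR : ∀ θ → RTCG+A⊢ (Γ ⇒ Δ) → RTCG+A⊢ (map (fsubF θ) Γ ⇒ map (fsubF θ) Δ)
substR θ d = by (inj₂ (inj₁ (subst θ))) (d ∷ [])

two : Term 0 → Term 0 → ℕ → Term 0
two x y zero    = x
two x y (suc _) = y

s≢0 : ∀ {x} → Γ ⊩ `s x `= `0 → Γ ⊩ bot
s≢0 {x = x} d = cutI d (weaken (λ { (here refl) → here (cong (λ z → `s z `= `0) (wk0-id x)) }) (λ ())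
  (substR (λ _ → x) (base A₁ [])))

s-inj : ∀ {x y} → Γ ⊩ `s x `= `s y → Γ ⊩ x `= y
s-inj {x = x} {y} d = cutI d (coe (cong₂ _`=_ (wk0-id x) (wk0-id y))
  (weaken (λ { (here refl) → here (cong₂ (λ a b → `s a `= `s b) (wk0-id x) (wk0-id y)) }) id (substR (two x y) (base A₂ []))))

+0 : ∀ {x} → Γ ⊩ (x `+ `0) `= x
+0 {x = x} = coe (cong (λ z → (z `+ `0) `= z) (wk0-id x)) (mono (λ ()) (substR (λ _ → x) (base A₃ [])))

+s : ∀ {x y} → Γ ⊩ (x `+ `s y) `= `s (x `+ y)
+s {x = x} {y} = coe (cong₂ (λ a b → (a `+ `s b) `= `s (a `+ b)) (wk0-id x) (wk0-id y))
  (mono (λ ()) (substR (two x y) (base A₄ [])))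

Le : Term n → Term n → Formula n
Le = RTC (`s (bv zero) `= bv (suc zero))

zero≤ : ∀ {x} → Γ ⊩ Le `0 x
zero≤ {x = x} = coe (cong (Le `0) (wk0-id x)) (mono (λ ()) (substR (λ _ → x) (base A₅ [])))

sCong : ∀ {x y} → Γ ⊩ x `= y → Γ ⊩ `s x `= `s y
sCong {x = x} e = eqE {F = λ z → `s x `= `s z} (`s (renT suc x) `= `s (bv zero) , λ t → cong (λ a → `s a `= `s t) (iw t x)) e eqR

-- The last axiom puts every number on the successor path from 0, so (Ind) along that path is
-- ordinary induction.
natInd : ∀ {F t} → Fam F → Γ ⊩ F `0 → (∀ a → F a ∷ Γ ⊩ F (`s a)) → Γ ⊩ F t
natInd fam z step = indE fam z zero≤ λ a b → eqE fam h1 (mono (λ { (here refl) → here refl ; (there i) → there (there i) }) (step a))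

rtcRefl : ∀ {β s} → Γ ⊩ RTC β s s
rtcRefl = base refl []

rtcStep : ∀ {β s r t} → Γ ⊩ RTC β s r → Γ ⊩ inst2 β r t → Γ ⊩ RTC β s t
rtcStep {r = r} d e = base (trans r) (d ∷ e ∷ [])

-- Relations under binders, and the derived form of (Case)

substT-lift : ∀ (σ : Fin n → Term m) t → substT (liftS σ) (renT suc t) ≡ renT suc (substT σ t)
substT-lift σ t = ≡.trans (substT≡gT (liftS σ) (renT suc t)) (≡.trans (gT-lift t) (cong (renT suc) (sym (substT≡gT σ t))))

iw² : ∀ x s → substT (liftS (σ1 x)) (renT suc (renT suc s)) ≡ renT suc s
iw² x s = ≡.trans (substT-lift (σ1 x) (renT suc s)) (cong (renT suc) (iw x s))

at2 : Formula 2 → Term n → Term n → Formula n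
at2 φ a b = substF (a ◂ b ◂ λ ()) φ

-- The body of an `RTC` in scope n lives in scope n + 2; `at2` moves a relation without parameters
-- there. For n = 0 this is `RTC φ`, but only propositionally.
rtc : Formula 2 → Term n → Term n → Formula n
rtc φ a b = RTC (at2 φ (bv zero) (bv (suc zero))) a b

fsubT-ren : ∀ θ (t : Term n) → fsubT θ (renT suc t) ≡ renT suc (fsubT θ t)
fsubT-ren θ (bv i) = refl
fsubT-ren θ (fv x) = sym (wk0-ren suc (θ x))
fsubT-ren θ `0 = refl
fsubT-ren θ (`s t) = cong `s (fsubT-ren θ t)
fsubT-ren θ (t `+ u) = cong₂ _`+_ (fsubT-ren θ t) (fsubT-ren θ u)

at2-inst : ∀ β a b → inst2 β a b ≡ at2 β a b
at2-inst β a b = substF-≗ β λ { zero → refl ; (suc zero) → refl }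

substF-at2 : ∀ (σ : Fin n → Term m) β a b → substF σ (at2 β a b) ≡ at2 β (substT σ a) (substT σ b)
substF-at2 σ β a b = ≡.trans (substF-substF σ _ β) (substF-≗ β λ { zero → refl ; (suc zero) → refl })

fsubF-at2 : ∀ θ β (a b : Term n) → fsubF θ (at2 β a b) ≡ at2 (fsubF θ β) (fsubT θ a) (fsubT θ b)
fsubF-at2 θ β a b = ≡.trans (fsubF-substF θ _ β) (substF-≗ (fsubF θ β) λ { zero → refl ; (suc zero) → refl })

substF-rtc : ∀ (σ : Fin n → Term m) β a b → substF σ (rtc β a b) ≡ rtc β (substT σ a) (substT σ b)
substF-rtc σ β a b = cong (λ γ → RTC γ _ _) (substF-at2 _ β _ _)

fsubF-rtc : ∀ θ β (a b : Term n) → fsubF θ (rtc β a b) ≡ rtc (fsubF θ β) (fsubT θ a) (fsubT θ b)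
fsubF-rtc θ β a b = cong (λ γ → RTC γ _ _) (fsubF-at2 θ β _ _)

at2Eq : ∀ {σ : Fin n → Term m} β a b {a' b'} → substT σ a ≡ a' → substT σ b ≡ b' → substF σ (at2 β a b) ≡ at2 β a' b'
at2Eq β a b refl refl = substF-at2 _ β a b

rtcEq : ∀ {σ : Fin n → Term m} β a b {a' b'} → substT σ a ≡ a' → substT σ b ≡ b' → substF σ (rtc β a b) ≡ rtc β a' b'
rtcEq β a b refl refl = substF-rtc _ β a b

at2-id : ∀ β → at2 β (bv zero) (bv (suc zero)) ≡ β
at2-id β = ≡.trans (substF≡gF _ β) (≡.trans (gF-≗ β (λ { zero → refl ; (suc zero) → refl }) (λ _ → refl)) (gF-id β))

rtc-id : ∀ β (a b : Term 0) → rtc β a b ≡ RTC β a b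
rtc-id β a b = cong (λ γ → RTC γ a b) (at2-id β)

inst2-at2 : ∀ β (a b : Term 0) → inst2 (at2 β (bv zero) (bv (suc zero))) a b ≡ at2 β a b
inst2-at2 β a b = ≡.trans (cong (λ γ → inst2 γ a b) (at2-id β)) (at2-inst β a b)

rStep : ∀ {β s r t} → Γ ⊩ rtc β s r → Γ ⊩ at2 β r t → Γ ⊩ rtc β s t
rStep {β = β} d e = rtcStep d (coe (sym (inst2-at2 β _ _)) e)

rInd : ∀ {F β s t} → Fam F → Γ ⊩ F s → Γ ⊩ rtc β s t →
       (∀ a b → F a ∷ at2 β a b ∷ Γ ⊩ F b) → Γ ⊩ F t
rInd {F = F} {β = β} fam d r step = indE {F = F} fam d r λ a b →
  mono (λ { (here refl) → here refl ; (there (here refl)) → there (here (sym (inst2-at2 β a b))) ; (there (there i)) → there (there i) }) (step a b)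

rTrans : ∀ {β s t u} → Γ ⊩ rtc β s t → Γ ⊩ rtc β t u → Γ ⊩ rtc β s u
rTrans {β = β} {s} d e = rInd {F = λ x → rtc β s x}
  (rtc β (renT suc s) (bv zero) , λ t → rtcEq β (renT suc s) (bv zero) (iw t s) refl) d e (λ a b → rStep h0 h1)

LastStep : Formula 2 → Term 0 → Term 0 → Formula 0
LastStep β s t = `∃ (rtc β (renT suc s) (bv zero) `∧ at2 β (bv zero) (renT suc t))

lastFam : ∀ β s t x → inst1 (rtc β (renT suc s) (bv zero) `∧ at2 β (bv zero) (renT suc t)) x ≡ (rtc β s x `∧ at2 β x t)
lastFam β s t x = cong₂ _`∧_ (rtcEq β (renT suc s) (bv zero) (iw x s) refl) (at2Eq β (bv zero) (renT suc t) refl (iw x t))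

-- (Case) is not a rule of this system. Induction along the path yields it, with the invariant that
-- the current point is `s` or is entered by a last step.
rCase : ∀ {β s t} → Γ ⊩ rtc β s t → s `= t ∷ Γ ⊩ C → (∀ z → rtc β s z ∷ at2 β z t ∷ Γ ⊩ C) → Γ ⊩ C
rCase {β = β} {s} {t} d e f = ∨E (rInd {F = λ x → (s `= x) `∨ LastStep β s x} (body , eq) (∨I₁ eqR) d step)
    e (exE (λ z → rtc β s z `∧ at2 β z t) (lastFam β s t) h0 λ z → ∧open (mono (λ { (here refl) → here refl
       ; (there (here refl)) → there (here refl) ; (there (there i)) → there (there (there i)) }) (f z)))
  where
  body = (renT suc s `= bv zero) `∨ `∃ (rtc β (renT suc (renT suc s)) (bv zero) `∧ at2 β (bv zero) (bv (suc zero)))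
  eq : ∀ x → inst1 body x ≡ ((s `= x) `∨ LastStep β s x)
  eq x = cong₂ (λ a b → (a `= x) `∨ `∃ b) (iw x s)
    (cong₂ _`∧_ (rtcEq β (renT suc (renT suc s)) (bv zero) (iw² x s) refl) (at2Eq β (bv zero) (bv (suc zero)) refl refl))
  step : ∀ a b → ((s `= a) `∨ LastStep β s a) ∷ at2 β a b ∷ _ ⊩ (s `= b) `∨ LastStep β s b
  -- In both cases of the invariant `a` is reachable from `s`, so `a` itself is the point before the
  -- last step to `b`.
  step a b = ∨I₂ (exI (λ z → rtc β s z `∧ at2 β z b) (lastFam β s b) a (∧I (∨E h0
    (eqE {F = λ x → rtc β s x} (rtc β (renT suc s) (bv zero) , λ t → rtcEq β (renT suc s) (bv zero) (iw t s) refl) h0 rtcRefl)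
    (exE (λ z → rtc β s z `∧ at2 β z a) (lastFam β s a) h0 λ z → ∧open (rStep h0 h1))) h1))

-- Arithmetic, and the ranks of RTC-formulas

sucβ dblβ : Formula (suc (suc n))
sucβ = `s (bv zero) `= bv (suc zero)
dblβ = bv (suc zero) `= `s (bv zero `+ bv zero)

leFamʳ : ∀ x → Fam (λ t → Le x t)
leFamʳ x = Le (renT suc x) (bv zero) , λ t → cong (λ a → Le a t) (iw t x)

leFamˡ : ∀ y → Fam (λ t → Le t y)
leFamˡ y = Le (bv zero) (renT suc y) , λ t → cong (Le t) (iw t y)

leRefl : Γ ⊩ Le x x
leRefl = rtcRefl

leS : Γ ⊩ Le x y → Γ ⊩ Le x (`s y)
leS d = rtcStep d eqR

leTrans : Γ ⊩ Le x y → Γ ⊩ Le y z → Γ ⊩ Le x z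
leTrans d e = rTrans {β = sucβ} d e

leEqʳ : Γ ⊩ y `= z → Γ ⊩ Le x y → Γ ⊩ Le x z
leEqʳ {x = x} e d = eqE (leFamʳ x) e d

leEqˡ : Γ ⊩ x `= y → Γ ⊩ Le x z → Γ ⊩ Le y z
leEqˡ {z = z} e d = eqE (leFamˡ z) e d

leEq : Γ ⊩ x `= y → Γ ⊩ Le x y
leEq e = leEqʳ e leRefl

leCase : Γ ⊩ Le x y → x `= y ∷ Γ ⊩ C → (∀ z → Le x z ∷ `s z `= y ∷ Γ ⊩ C) → Γ ⊩ C
leCase d e f = rCase {β = sucβ} d e f

sMono : Γ ⊩ Le x y → Γ ⊩ Le (`s x) (`s y)
sMono {x = x} d = indE {F = λ v → Le (`s x) (`s v)} {β = sucβ}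
  (Le (`s (renT suc x)) (`s (bv zero)) , λ t → cong (λ a → Le (`s a) (`s t)) (iw t x)) leRefl d
  (λ a b → leEqʳ (sCong h1) (leS h0))

sMono⁻ : Γ ⊩ Le (`s x) (`s y) → Γ ⊩ Le x y
sMono⁻ d = leCase d (leEq (s-inj h0)) λ z → leEqʳ (s-inj h1) (leTrans (leS leRefl) h0)

irrefl : Γ ⊩ Le (`s x) x → Γ ⊩ bot
irrefl {x = x} d = ¬E (natInd {F = λ v → `¬ Le (`s v) v} (`¬ Le (`s (bv zero)) (bv zero) , λ _ → refl)
  (¬I (leCase h0 (s≢0 h0) λ z → s≢0 h1)) λ a → ¬I (¬E h1 (sMono⁻ h0))) d

addMono : Γ ⊩ Le x y → Γ ⊩ Le (x `+ p) (y `+ p)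
addMono {x = x} {y} {p} d = natInd {F = λ p → Le (x `+ p) (y `+ p)}
  (Le (renT suc x `+ bv zero) (renT suc y `+ bv zero) , λ t → cong₂ (λ a b → Le (a `+ t) (b `+ t)) (iw t x) (iw t y))
  (leEqˡ (eqSym +0) (leEqʳ (eqSym +0) d)) λ a → leEqˡ (eqSym +s) (leEqʳ (eqSym +s) (sMono h0))

leAddʳ : Γ ⊩ Le p (x `+ p)
leAddʳ {p = p} {x} = natInd {F = λ p → Le p (x `+ p)}
  (Le (bv zero) (renT suc x `+ bv zero) , λ t → cong (λ a → Le t (a `+ t)) (iw t x))
  zero≤ λ a → leEqʳ (eqSym +s) (sMono h0)

leAddˡ : Γ ⊩ Le x (x `+ p)
leAddˡ {x = x} {p} = natInd {F = λ p → Le x (x `+ p)}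
  (Le (renT suc x) (renT suc x `+ bv zero) , λ t → cong (λ a → Le a (a `+ t)) (iw t x))
  (leEq (eqSym +0)) λ a → leEqʳ (eqSym +s) (leS h0)

addCancel : Γ ⊩ (x `+ p) `= (y `+ p) → Γ ⊩ x `= y
addCancel {x = x} {p} {y} d = →E (natInd {F = λ p → ((x `+ p) `= (y `+ p)) `→ (x `= y)}
  ((((renT suc x `+ bv zero) `= (renT suc y `+ bv zero)) `→ (renT suc x `= renT suc y))
    , λ t → cong₂ (λ a b → ((a `+ t) `= (b `+ t)) `→ (a `= b)) (iw t x) (iw t y))
  (→I (eqTrans (eqSym +0) (eqTrans h0 +0)))
  λ a → →I (→E h1 (s-inj (eqTrans (eqSym +s) (eqTrans h0 +s))))) d

-- The numbers 0, 1, 3, 7, …; consecutive ones differ by more than the smaller of them.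
Q : Term n → Formula n
Q p = RTC dblβ `0 p

dblLe : Γ ⊩ rtc dblβ x y → Γ ⊩ Le x y
dblLe {x = x} d = rInd {F = λ v → Le x v} {β = dblβ} (leFamʳ x) leRefl d
  λ a b → leTrans h0 (leEqʳ (eqSym h1) (leS leAddˡ))

-- Decomposes a path at its beginning, where `rCase` would do so at its end. The relation is a
-- function, so a step from `x` can only lead to `s (x + x)`.
dblFirst : Γ ⊩ rtc dblβ x y → Γ ⊩ (x `= y) `∨ rtc dblβ (`s (x `+ x)) y
dblFirst {x = x} d = rInd {F = λ v → (x `= v) `∨ rtc dblβ (`s (x `+ x)) v} {β = dblβ}
  ((renT suc x `= bv zero) `∨ rtc dblβ (`s (renT suc x `+ renT suc x)) (bv zero)
    , λ t → cong (λ a → (a `= t) `∨ rtc dblβ (`s (a `+ a)) t) (iw t x))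
  (∨I₁ eqR) d λ a b → ∨I₂ (∨E h0
    (eqE {F = λ v → rtc dblβ (`s (x `+ x)) v} (fam (`s (x `+ x))) (eqTrans (dbl h0) (eqSym h2)) rtcRefl)
    (rStep {β = dblβ} h0 h2))
  where
  fam : ∀ c → Fam (λ v → rtc dblβ c v)
  fam c = rtc dblβ (renT suc c) (bv zero) , λ t → cong (λ a → rtc dblβ a t) (iw t c)
  dbl : ∀ {Γ a} → Γ ⊩ x `= a → Γ ⊩ `s (x `+ x) `= `s (a `+ a)
  dbl {a = a} e = eqE {F = λ v → `s (x `+ x) `= `s (v `+ v)}
    (`s (renT suc x `+ renT suc x) `= `s (bv zero `+ bv zero) , λ t → cong (λ a → `s (a `+ a) `= `s (t `+ t)) (iw t x)) e eqR

-- Both points lie on the orbit of 0 under one function. When the second point moves on, it stays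
-- behind `p` by following the path to `p`, or else passes it.
qLinear : Γ ⊩ Q p → Γ ⊩ Q q → Γ ⊩ rtc dblβ p q `∨ rtc dblβ q p
qLinear {p = p} {q} d e = rInd {F = λ v → rtc dblβ p v `∨ rtc dblβ v p} {β = dblβ}
  (rtc dblβ (renT suc p) (bv zero) `∨ rtc dblβ (bv zero) (renT suc p)
    , λ t → cong (λ a → rtc dblβ a t `∨ rtc dblβ t a) (iw t p)) (∨I₂ d) e
  λ a b → ∨E h0 (∨I₁ (rStep {β = dblβ} h0 h2)) (∨E (dblFirst h0)
    (∨I₁ (rStep {β = dblβ} (eqE {F = λ v → rtc dblβ v a} (fam a) h0 rtcRefl) h3))
    (∨I₂ (eqE {F = λ v → rtc dblβ v p} (fam p) (eqSym h3) h0)))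
  where
  fam : ∀ c → Fam (λ v → rtc dblβ v c)
  fam c = rtc dblβ (bv zero) (renT suc c) , λ t → cong (λ a → rtc dblβ t a) (iw t c)

-- This gap between distinct elements makes decoding unique in `dcFun`.
qGap : Γ ⊩ Q p → Γ ⊩ Q q → p `= q ∷ Γ ⊩ C → Le (`s (p `+ p)) q ∷ Γ ⊩ C → Le (`s (q `+ q)) p ∷ Γ ⊩ C → Γ ⊩ C
qGap d e f g h = ∨E (qLinear d e)
  (∨E (dblFirst h0) (mono skip f) (cutI (dblLe h0) (mono skip₂ g)))
  (∨E (dblFirst h0) (cutI (eqSym h0) (mono skip₂ f)) (cutI (dblLe h0) (mono skip₂ h)))
  where
  skip : ∀ {A B Γ} → A ∷ Γ ⊆ A ∷ B ∷ Γ
  skip (here e) = here e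
  skip (there i) = there (there i)
  skip₂ : ∀ {A B C Γ} → A ∷ Γ ⊆ A ∷ B ∷ C ∷ Γ
  skip₂ (here e) = here e
  skip₂ (there i) = there (there (there i))

qUnb : ∀ x → (∀ p → Q p ∷ Le x p ∷ Γ ⊩ C) → Γ ⊩ C
qUnb x f = exE (λ p → Q p `∧ Le x p) (eq x) (natInd {F = λ x → `∃ (Q (bv zero) `∧ Le (renT suc x) (bv zero))} {t = x}
    (`∃ (Q (bv zero) `∧ Le (bv (suc zero)) (bv zero)) , λ _ → refl)
    (exI (λ p → Q p `∧ Le `0 p) (λ _ → refl) `0 (∧I rtcRefl leRefl))
    λ a → exE (λ p → Q p `∧ Le a p) (eq a) h0 λ p →
      exI (λ p → Q p `∧ Le (`s a) p) (eq (`s a)) (`s (p `+ p))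
        (∧I (rStep {β = dblβ} (∧E₁ h0) eqR) (sMono (leTrans (∧E₂ h0) leAddˡ))))
  λ p → ∧open (f p)
  where
  eq : ∀ x p → inst1 (Q (bv zero) `∧ Le (renT suc x) (bv zero)) p ≡ (Q p `∧ Le x p)
  eq x p = cong (λ a → Q p `∧ Le a p) (iw p x)

-- u encodes x: u = x + p with x ≤ p for an element p of Q. Every number has arbitrarily large codes.
Dc : Term n → Term n → Formula n
Dc u x = `∃ (Q (bv zero) `∧ (Le (renT suc x) (bv zero) `∧ (renT suc u `= (renT suc x `+ bv zero))))

DcEq : ∀ {σ : Fin n → Term m} u x {u' x'} → substT σ u ≡ u' → substT σ x ≡ x' → substF σ (Dc u x) ≡ Dc u' x'
DcEq {σ = σ} u x refl refl =
  cong₂ (λ a b → `∃ (Q (bv zero) `∧ (Le a (bv zero) `∧ (b `= (a `+ bv zero))))) (substT-lift σ x) (substT-lift σ u)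

fsubF-Dc : ∀ θ (u x : Term n) → fsubF θ (Dc u x) ≡ Dc (fsubT θ u) (fsubT θ x)
fsubF-Dc θ u x =
  cong₂ (λ a b → `∃ (Q (bv zero) `∧ (Le a (bv zero) `∧ (b `= (a `+ bv zero))))) (fsubT-ren θ x) (fsubT-ren θ u)

dcInst : ∀ u x p → inst1 (Q (bv zero) `∧ (Le (renT suc x) (bv zero) `∧ (renT suc u `= (renT suc x `+ bv zero)))) p
                 ≡ (Q p `∧ (Le x p `∧ (u `= (x `+ p))))
dcInst u x p = cong₂ (λ a b → Q p `∧ (Le a p `∧ (b `= (a `+ p)))) (iw p x) (iw p u)

dcI : ∀ p → Γ ⊩ Q p → Γ ⊩ Le x p → Γ ⊩ u `= (x `+ p) → Γ ⊩ Dc u x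
dcI {x = x} {u} p d e f = exI _ (dcInst u x) p (∧I d (∧I e f))

dcE : Γ ⊩ Dc u x → (∀ p → Q p ∷ Le x p ∷ u `= (x `+ p) ∷ Γ ⊩ C) → Γ ⊩ C
dcE {u = u} {x} d f = exE _ (dcInst u x) d λ p → ∧open (cutI (∧E₁ h1) (cutI (∧E₂ h2)
  (mono (λ { (here e) → there (there (here e)) ; (there (here e)) → there (here e) ; (there (there (here e))) → here e
           ; (there (there (there i))) → there (there (there (there i))) }) (f p))))

-- Let u = x + p = y + q. If p = q, cancel. If 2p + 1 ≤ q, then q ≤ y + q = x + p ≤ p + p because x
-- ≤ p, which is absurd; the third case is symmetric.
dcFun : Γ ⊩ Dc u x → Γ ⊩ Dc u y → Γ ⊩ x `= y
dcFun {x = x} {y = y} d e = dcE d λ p → dcE (w³ e) λ q → qGap h3 h0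
  (addCancel (eqTrans (eqSym (w³ h3)) (eqTrans h3 (eqE {F = λ v → (y `+ q) `= (y `+ v)}
    ((renT suc y `+ renT suc q) `= (renT suc y `+ bv zero) , λ t → cong₂ (λ a b → (a `+ b) `= (a `+ t)) (iw t y) (iw t q))
    (eqSym h0) eqR))))
  (botE (irrefl (leTrans h0 (leTrans leAddʳ (leEqˡ h3 (leEqˡ (eqSym (w³ h3)) (addMono (w² h3))))))))
  (botE (irrefl (leTrans h0 (leTrans leAddʳ (leEqˡ (w³ h3) (leEqˡ (eqSym h3) (addMono h2)))))))

dcUnb : ∀ x v → (∀ u → Dc u x ∷ Le v u ∷ Γ ⊩ C) → Γ ⊩ C
-- Taking `p` above x + v ensures both x ≤ p, as decoding requires, and v ≤ x + p.
dcUnb x v f = qUnb (x `+ v) λ p → cutI (leTrans (leTrans leAddʳ h1) leAddʳ) (cutI (dcI p h1 (leTrans leAddˡ h2) eqR)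
  (mono (λ { (here e) → here e ; (there (here e)) → there (here e) ; (there (there i)) → there (there (there (there i))) }) (f (x `+ p))))

-- Runs of β on codes, with strictly increasing codes: the last code of a run ranks its end point.
Steps : Formula 2 → Formula 2
Steps β = Le (`s (bv zero)) (bv (suc zero)) `∧
  `∃ (`∃ (Dc (bv (suc (suc zero))) (bv (suc zero)) `∧ (Dc (bv (suc (suc (suc zero)))) (bv zero) `∧ at2 β (bv (suc zero)) (bv zero))))

module _ (β : Formula 2) (v u : Term 0) where
  private
    v' = renT suc v
    u' = renT suc u
    body₂ = Dc (renT suc v') (bv (suc zero)) `∧ (Dc (renT suc u') (bv zero) `∧ at2 β (bv (suc zero)) (bv zero))
    body₁ : Term 0 → Formula 1
    body₁ x = Dc v' (renT suc x) `∧ (Dc u' (bv zero) `∧ at2 β (renT suc x) (bv zero))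

  private
    eq₀ : at2 (Steps β) v u ≡ (Le (`s v) u `∧ `∃ (`∃ body₂))
    eq₀ = cong (λ a → Le (`s v) u `∧ `∃ (`∃ a)) (cong₃ (λ a b c → a `∧ (b `∧ c))
      (DcEq {σ = σ} (bv (suc (suc zero))) (bv (suc zero)) refl refl) (DcEq {σ = σ} (bv (suc (suc (suc zero)))) (bv zero) refl refl)
      (at2Eq β (bv (suc zero)) (bv zero) refl refl))
      where
      σ : Fin 4 → Term 2
      σ = liftS (liftS (v ◂ u ◂ λ ()))

    eq₁ : ∀ x → inst1 (`∃ body₂) x ≡ `∃ (body₁ x)
    eq₁ x = cong `∃ (cong₃ (λ a b c → a `∧ (b `∧ c)) (DcEq (renT suc v') (bv (suc zero)) (iw² x v) refl)
      (DcEq (renT suc u') (bv zero) (iw² x u) refl) (at2Eq β (bv (suc zero)) (bv zero) refl refl))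

    eq₂ : ∀ x y → inst1 (body₁ x) y ≡ (Dc v x `∧ (Dc u y `∧ at2 β x y))
    eq₂ x y = cong₃ (λ a b c → a `∧ (b `∧ c)) (DcEq v' (renT suc x) (iw y v) (iw y x))
      (DcEq u' (bv zero) (iw y u) refl) (at2Eq β (renT suc x) (bv zero) (iw y x) refl)

  stepsI : ∀ x y → Γ ⊩ Le (`s v) u → Γ ⊩ Dc v x → Γ ⊩ Dc u y → Γ ⊩ at2 β x y → Γ ⊩ at2 (Steps β) v u
  stepsI x y a b c d = coe (sym eq₀) (∧I a (exI _ eq₁ x (exI _ (eq₂ x) y (∧I b (∧I c d)))))

  stepsLe : Γ ⊩ at2 (Steps β) v u → Γ ⊩ Le (`s v) u
  stepsLe d = ∧E₁ (coe eq₀ d)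

  stepsE : Γ ⊩ at2 (Steps β) v u → (∀ x y → Dc v x ∷ Dc u y ∷ at2 β x y ∷ Γ ⊩ C) → Γ ⊩ C
  stepsE d f = exE _ eq₁ (∧E₂ (coe eq₀ d)) λ x → exE _ (eq₂ x) h0 λ y →
    ∧open (cutI (∧E₁ h1) (cutI (∧E₂ h2) (mono (λ { (here e) → there (there (here e)) ; (there (here e)) → there (here e)
      ; (there (there (here e))) → here e ; (there (there (there i))) → there (there (there (there (there i)))) }) (f x y))))

-- `u` is a rank of `RTC β s t`: the last code of a run that begins at some code of `s`.
M : Formula 2 → Term n → Term n → Term n → Formula n
M β s t u = Dc u t `∧ `∃ (Dc (bv zero) (renT suc s) `∧ rtc (Steps β) (bv zero) (renT suc u))

MEq : ∀ {σ : Fin n → Term m} β s t u {s' t' u'} → substT σ s ≡ s' → substT σ t ≡ t' → substT σ u ≡ u' →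
      substF σ (M β s t u) ≡ M β s' t' u'
MEq {σ = σ} β s t u refl refl refl = cong₃ (λ a b c → a `∧ `∃ (b `∧ c)) (DcEq u t refl refl)
  (DcEq (bv zero) (renT suc s) refl (substT-lift σ s)) (rtcEq (Steps β) (bv zero) (renT suc u) refl (substT-lift σ u))

fsubF-M : ∀ θ β (s t u : Term n) → fsubF θ (M β s t u) ≡ M (fsubF θ β) (fsubT θ s) (fsubT θ t) (fsubT θ u)
fsubF-M θ β s t u = cong₃ (λ a b c → a `∧ `∃ (b `∧ c)) (fsubF-Dc θ u t)
  (≡.trans (fsubF-Dc θ (bv zero) (renT suc s)) (cong (Dc (bv zero)) (fsubT-ren θ s)))
  (≡.trans (fsubF-rtc θ (Steps β) (bv zero) (renT suc u)) (cong₂ (λ a b → rtc a (bv zero) b) steps (fsubT-ren θ u)))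
  where
  steps : fsubF θ (Steps β) ≡ Steps (fsubF θ β)
  steps = cong (λ a → Le (`s (bv zero)) (bv (suc zero)) `∧
    `∃ (`∃ (Dc (bv (suc (suc zero))) (bv (suc zero)) `∧ (Dc (bv (suc (suc (suc zero)))) (bv zero) `∧ a))))
    (fsubF-at2 θ β (bv (suc zero)) (bv zero))

module _ (β : Formula 2) (s : Term 0) where
  private
    inner : ∀ u v → inst1 (Dc (bv zero) (renT suc s) `∧ rtc (Steps β) (bv zero) (renT suc u)) v ≡ (Dc v s `∧ rtc (Steps β) v u)
    inner u v = cong₂ _`∧_ (DcEq (bv zero) (renT suc s) refl (iw v s)) (rtcEq (Steps β) (bv zero) (renT suc u) refl (iw v u))

  rankI : ∀ v → Γ ⊩ Dc u t → Γ ⊩ Dc v s → Γ ⊩ rtc (Steps β) v u → Γ ⊩ M β s t u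
  rankI {u = u} v a b c = ∧I a (exI _ (inner u) v (∧I b c))

  rankE : Γ ⊩ M β s t u → (∀ v → Dc v s ∷ rtc (Steps β) v u ∷ Dc u t ∷ Γ ⊩ C) → Γ ⊩ C
  rankE {u = u} d f = cutI (∧E₁ d) (exE _ (inner u) (w (∧E₂ d)) λ v → ∧open (f v))

  private
    exBody : ∀ t u → inst1 (M β (renT suc s) (renT suc t) (bv zero)) u ≡ M β s t u
    exBody t u = MEq β (renT suc s) (renT suc t) (bv zero) (iw u s) (iw u t) refl

  RankEx : Term 0 → Formula 0
  RankEx t = `∃ (M β (renT suc s) (renT suc t) (bv zero))

  rankEx : Γ ⊩ rtc β s t → Γ ⊩ RankEx t
  rankEx d = rInd {F = RankEx} {β = β}
    (`∃ (M β (renT suc (renT suc s)) (bv (suc zero)) (bv zero)) , λ t →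
      cong `∃ (MEq β (renT suc (renT suc s)) (bv (suc zero)) (bv zero) (iw² t s) refl refl))
    (dcUnb s `0 λ u → exI _ (exBody s) u (rankI u h0 h0 rtcRefl)) d
    -- The code `u'` of the new point is taken above the code `u` reached so far, which keeps the
    -- run strictly increasing.
    λ a b → exE _ (exBody a) h0 λ u → rankE h0 λ v → dcUnb b (`s u) λ u' →
      exI _ (exBody b) u' (rankI v h0 h2 (rStep {β = Steps β} h3 (stepsI β u u' a b h1 h4 h0 h7)))

  -- The counterpart of (Case) for ranks. A run without steps gives `s = t` by unique decoding;
  -- otherwise the code before the last one is a smaller rank, of the point it decodes to.
  rankDown : Γ ⊩ M β s t u → s `= t ∷ Γ ⊩ C →
             (∀ z v → M β s z v ∷ Le (`s v) u ∷ at2 β z t ∷ Γ ⊩ C) → Γ ⊩ C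
  rankDown {t = t} {u = u} d f g = rankE d λ v → rCase {β = Steps β} h1
    (cutI (dcFun (eqE {F = λ v → Dc v s} (Dc (bv zero) (renT suc s) , λ v → DcEq (bv zero) (renT suc s) refl (iw v s)) h0 h1) h3)
      (mono (λ { (here e) → here e ; (there i) → there (there (there (there (there i)))) }) f))
    λ u' → stepsE β u' u h1 λ x y →
      cutI (eqE {F = λ y → at2 β x y} (at2 β (renT suc x) (bv zero) , λ v → at2Eq β (renT suc x) (bv zero) (iw v x) refl)
             (dcFun h1 (w³ (w h3))) h2)
      (cutI (stepsLe β u' u (w (w³ h1))) (cutI (rankI v h2 (w³ (w³ h1)) (w² h3))
        (mono (λ { (here e) → here e ; (there (here e)) → there (here e) ; (there (there (here e))) → there (there (here e))
                 ; (there (there (there i))) → there (there (there (there (there (there (there (there (there (there (there i)))))))))) }) (g x u'))))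

  -- A predecessor is found through its rank, and this makes its `RTC`-formula true again. Decoding
  -- is a relation, so the invariant speaks of every point decoded from the current code.
  rankTrue : Γ ⊩ M β s t u → Γ ⊩ rtc β s t
  rankTrue {t = t} {u = u} d = rankE d λ v → →E (coe (inst u t) (∀E (rInd {F = F} {β = Steps β}
      (`∀ (Dc (bv (suc zero)) (bv zero) `→ rtc β (renT suc (renT suc s)) (bv zero)) , λ x →
        cong `∀ (cong₂ _`→_ (DcEq {σ = liftS (σ1 x)} (bv (suc zero)) (bv zero) refl refl) (rtcEq β (renT suc (renT suc s)) (bv zero) (iw² x s) refl)))
      (∀I λ x → coe (sym (inst v x)) (→I (eqE {F = λ x → rtc β s x} rfam (dcFun h1 h0) rtcRefl)))
      h1 λ a b → ∀I λ x → coe (sym (inst b x)) (→I (stepsE β a b h2 λ y y' →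
        rStep (→E (coe (inst a y) (∀E (w³ h1) y)) h0) (eqE {F = λ x → at2 β y x}
          (at2 β (renT suc y) (bv zero) , λ v → at2Eq β (renT suc y) (bv zero) (iw v y) refl) (dcFun h1 h3) h2))))
      t)) h2
    where
    F : Term 0 → Formula 0
    F v = `∀ (Dc (renT suc v) (bv zero) `→ rtc β (renT suc s) (bv zero))
    rfam : Fam (λ x → rtc β s x)
    rfam = rtc β (renT suc s) (bv zero) , λ t → rtcEq β (renT suc s) (bv zero) (iw t s) refl
    inst : ∀ v x → inst1 (Dc (renT suc v) (bv zero) `→ rtc β (renT suc s) (bv zero)) x ≡ (Dc v x `→ rtc β s x)
    inst v x = cong₂ _`→_ (DcEq (renT suc v) (bv zero) (iw x v) refl) (rtcEq β (renT suc s) (bv zero) (iw x s) refl)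

  -- The least number principle. If no rank is least, induction on v shows that all ranks are at
  -- least v; for v = u + 1 with a rank u this is absurd.
  rankLeast : Γ ⊩ rtc β s t → (∀ u → M β s t u ∷ `∀ (M β (renT suc s) (renT suc t) (bv zero) `→ Le (renT suc u) (bv zero)) ∷ Γ ⊩ bot) → Γ ⊩ bot
  rankLeast {t = t} d f = exE _ (exBody t) (rankEx d) λ u → irrefl (→E (coe (inst (`s u) u) (∀E
      (natInd {F = F} {t = `s u} (`∀ (M β (renT suc (renT suc s)) (renT suc (renT suc t)) (bv zero) `→ Le (bv (suc zero)) (bv zero)) , λ x →
          cong (λ a → `∀ (a `→ Le (renT suc x) (bv zero))) (MEq β (renT suc (renT suc s)) (renT suc (renT suc t)) (bv zero) (iw² x s) (iw² x t) refl))
        (∀I λ x → coe (sym (inst `0 x)) (→I zero≤))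
        λ a → ∀I λ x → coe (sym (inst (`s a) x)) (→I (leCase (→E (coe (inst a x) (∀E h1 x)) h0)
          (botE (cutI (eqE {F = λ x → M β s t x} mfam (eqSym h0) h1)
            (mono (λ { (here e) → here e ; (there (here e)) → there (there (there (here e)))
                     ; (there (there i)) → there (there (there (there (there i)))) }) (f a))))
          λ z → leEqʳ h1 (sMono h0)))) u)) h0)
    where
    F : Term 0 → Formula 0
    F v = `∀ (M β (renT suc s) (renT suc t) (bv zero) `→ Le (renT suc v) (bv zero))
    mfam : Fam (λ x → M β s t x)
    mfam = M β (renT suc s) (renT suc t) (bv zero) , exBody t
    inst : ∀ v x → inst1 (M β (renT suc s) (renT suc t) (bv zero) `→ Le (renT suc v) (bv zero)) x ≡ (M β s t x `→ Le v x)
    inst v x = cong₂ _`→_ (exBody t x) (cong (λ a → Le a x) (iw x v))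

-- Comparison of ranks, and the theorem of Podelski and Rybalchenko

-- u is a rank of X. Only the case of RTC-formulas matters; every number is a rank of any other formula.
Rk : Formula 0 → Term n → Formula n
Rk (RTC β s t) u = M β (wk0 s) (wk0 t) u
Rk _           u = u `= u

RkEq : ∀ {σ : Fin n → Term m} X u {u'} → substT σ u ≡ u' → substF σ (Rk X u) ≡ Rk X u'
RkEq {σ = σ} (RTC β s t) u e = MEq β (wk0 s) (wk0 t) u (substT-wk0 σ s) (substT-wk0 σ t) e
RkEq (_ `= _) u refl = refl
RkEq (`¬ _)   u refl = refl
RkEq (_ `∧ _) u refl = refl
RkEq (_ `∨ _) u refl = refl
RkEq (_ `→ _) u refl = refl
RkEq (`∀ _)   u refl = refl
RkEq (`∃ _)   u refl = refl

fsubT-wk0 : ∀ θ (t : Term 0) → fsubT {n} θ (wk0 t) ≡ wk0 (fsubT θ t)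
fsubT-wk0 θ (fv x)   = sym (≡.trans (wk0-ren (λ ()) (θ x)) refl)
fsubT-wk0 θ `0       = refl
fsubT-wk0 θ (`s t)   = cong `s (fsubT-wk0 θ t)
fsubT-wk0 θ (t `+ u) = cong₂ _`+_ (fsubT-wk0 θ t) (fsubT-wk0 θ u)

fsubF-Rk : ∀ θ X (u : Term n) → fsubF θ (Rk X u) ≡ Rk (fsubF θ X) (fsubT θ u)
fsubF-Rk θ (RTC β s t) u = ≡.trans (fsubF-M θ β (wk0 s) (wk0 t) u)
  (cong₂ (λ a b → M (fsubF θ β) a b (fsubT θ u)) (fsubT-wk0 θ s) (fsubT-wk0 θ t))
fsubF-Rk θ (_ `= _) u = refl
fsubF-Rk θ (`¬ _)   u = refl
fsubF-Rk θ (_ `∧ _) u = refl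
fsubF-Rk θ (_ `∨ _) u = refl
fsubF-Rk θ (_ `→ _) u = refl
fsubF-Rk θ (`∀ _)   u = refl
fsubF-Rk θ (`∃ _)   u = refl

Lt : Bool → Term n → Term n → Formula n
Lt false a c = Le a c
Lt true  a c = Le (`s a) c

LtEq : ∀ {σ : Fin n → Term m} b a c {a' c'} → substT σ a ≡ a' → substT σ c ≡ c' → substF σ (Lt b a c) ≡ Lt b a' c'
LtEq false a c refl refl = refl
LtEq true  a c refl refl = refl

fsubF-Lt : ∀ θ b (a c : Term n) → fsubF θ (Lt b a c) ≡ Lt b (fsubT θ a) (fsubT θ c)
fsubF-Lt θ false a c = refl
fsubF-Lt θ true  a c = refl

Ranked : Formula 0 → Formula 0
Ranked X = `∃ (Rk X (bv zero))

Below : Bool → Formula 0 → Term n → Formula n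
Below b Y u = `∃ (Rk Y (bv zero) `∧ Lt b (bv zero) (renT suc u))

BelowEq : ∀ {σ : Fin n → Term m} b Y u {u'} → substT σ u ≡ u' → substF σ (Below b Y u) ≡ Below b Y u'
BelowEq {σ = σ} b Y u refl = cong₂ (λ a c → `∃ (a `∧ c)) (RkEq Y (bv zero) refl) (LtEq b (bv zero) (renT suc u) refl (substT-lift σ u))

-- The minimal rank of Y is at most (for true: less than) the minimal rank of X.
Dom : Bool → Formula 0 → Formula 0 → Formula 0
Dom b X Y = Ranked X `∧ `∀ (Rk X (bv zero) `→ Below b Y (bv zero))

fsubF-Dom : ∀ θ b X Y → fsubF θ (Dom b X Y) ≡ Dom b (fsubF θ X) (fsubF θ Y)
fsubF-Dom θ b X Y = cong₃ (λ a c d → `∃ a `∧ `∀ (a `→ `∃ (c `∧ d)))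
  (fsubF-Rk θ X (bv zero)) (fsubF-Rk θ Y (bv zero)) (fsubF-Lt θ b (bv zero) (bv (suc zero)))

rkInst : ∀ X u → inst1 (Rk X (bv zero)) u ≡ Rk X u
rkInst X u = RkEq X (bv zero) refl

belowInst : ∀ b Y u v → inst1 (Rk Y (bv zero) `∧ Lt b (bv zero) (renT suc u)) v ≡ (Rk Y v `∧ Lt b v u)
belowInst b Y u v = cong₂ _`∧_ (rkInst Y v) (LtEq b (bv zero) (renT suc u) refl (iw v u))

domInst : ∀ b X Y u → inst1 (Rk X (bv zero) `→ Below b Y (bv zero)) u ≡ (Rk X u `→ Below b Y u)
domInst b X Y u = cong₂ _`→_ (rkInst X u) (BelowEq b Y (bv zero) refl)

rankedE : Γ ⊩ Ranked X → (∀ u → Rk X u ∷ Γ ⊩ C) → Γ ⊩ C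
rankedE {X = X} d f = exE _ (rkInst X) d f

belowI : ∀ b v → Γ ⊩ Rk Y v → Γ ⊩ Lt b v u → Γ ⊩ Below b Y u
belowI {Y = Y} {u} b v d e = exI _ (belowInst b Y u) v (∧I d e)

belowE : Γ ⊩ Below b Y u → (∀ v → Rk Y v ∷ Lt b v u ∷ Γ ⊩ C) → Γ ⊩ C
belowE {b = b} {Y} {u} d f = exE _ (belowInst b Y u) d λ v → ∧open (f v)

domI : ∀ b → Γ ⊩ Ranked X → (∀ u → Rk X u ∷ Γ ⊩ Below b Y u) → Γ ⊩ Dom b X Y
domI {X = X} {Y} b d f = ∧I d (∀I λ u → coe (sym (domInst b X Y u)) (→I (f u)))

domE : Γ ⊩ Dom b X Y → Γ ⊩ Rk X u → Γ ⊩ Below b Y u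
domE {b = b} {X} {Y} {u} d e = →E (coe (domInst b X Y u) (∀E (∧E₂ d) u)) e

domRefl : Γ ⊩ Ranked X → Γ ⊩ Dom false X X
domRefl d = domI false d λ u → belowI false u h0 leRefl

ltTrans : ∀ b b' → Γ ⊩ Lt b v u → Γ ⊩ Lt b' x v → Γ ⊩ Lt (b ∨ b') x u
ltTrans false false d e = leTrans e d
ltTrans false true  d e = leTrans e d
ltTrans true  false d e = leTrans (sMono e) d
ltTrans true  true  d e = leTrans e (leTrans (leS leRefl) d)

-- A given rank is handed on from formula to formula, so no least rank is ever named; one strict
-- comparison makes the composite strict.
domTrans : ∀ b b' → Γ ⊩ Dom b X Y → Γ ⊩ Dom b' Y Z → Γ ⊩ Dom (b ∨ b') X Z
domTrans {X = X} {Y} {Z} b b' d e = domI (b ∨ b') (∧E₁ d) λ u → belowE {b = b} {Y = Y} (domE {b = b} {Y = Y} (w d) h0) λ v →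
  belowE {b = b'} {Y = Z} (domE {b = b'} {Y = Z} (w³ e) h0) λ x → belowI (b ∨ b') x h0 (ltTrans b b' h3 h1)

ranked : ∀ X → Γ ⊩ X → Γ ⊩ Ranked X
ranked (RTC β s t) d = coe (cong₂ (λ a b → `∃ (M β a b (bv zero))) (suc-wk s) (suc-wk t)) (rankEx β s (coe (sym (rtc-id β s t)) d))
  where
  suc-wk : ∀ (t : Term 0) → renT suc t ≡ wk0 t
  suc-wk t = ≡.trans (cong (renT suc) (sym (wk0-id t))) (wk0-ren suc t)
ranked (_ `= _) d = ∃I `0 eqR
ranked (`¬ _)   d = ∃I `0 eqR
ranked (_ `∧ _) d = ∃I `0 eqR
ranked (_ `∨ _) d = ∃I `0 eqR
ranked (_ `→ _) d = ∃I `0 eqR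
ranked (`∀ _)   d = ∃I `0 eqR
ranked (`∃ _)   d = ∃I `0 eqR

-- Tuples, blocks of quantifiers, finite disjunctions and conjunctions

infixr 5 _⊕_
_⊕_ : ∀ {A : Set} {n m} → (Fin n → A) → (Fin m → A) → Fin (n ℕ.+ m) → A
_⊕_ {n = zero}  v b = b
_⊕_ {n = suc n} v b = v zero ◂ ((v ∘ suc) ⊕ b)

⊕-↑ˡ : ∀ {A : Set} (v : Fin n → A) (b : Fin m → A) i → (v ⊕ b) (i ↑ˡ m) ≡ v i
⊕-↑ˡ v b zero    = refl
⊕-↑ˡ v b (suc i) = ⊕-↑ˡ (v ∘ suc) b i

⊕-map : ∀ {A B : Set} (f : A → B) (v : Fin n → A) (b : Fin m → A) i → f ((v ⊕ b) i) ≡ ((f ∘ v) ⊕ (f ∘ b)) i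
⊕-map {n = zero}  f v b i       = refl
⊕-map {n = suc n} f v b zero    = refl
⊕-map {n = suc n} f v b (suc i) = ⊕-map f (v ∘ suc) b i

⊕-cong : ∀ {A : Set} {v v' : Fin n → A} {b b' : Fin m → A} → (∀ i → v i ≡ v' i) → (∀ i → b i ≡ b' i) → ∀ i → (v ⊕ b) i ≡ (v' ⊕ b') i
⊕-cong {n = zero}  p q i       = q i
⊕-cong {n = suc n} p q zero    = p zero
⊕-cong {n = suc n} p q (suc i) = ⊕-cong (p ∘ suc) q i

-- The innermost quantifier binds component 0 of the tuple; the last m indices stay free.
∃ⁿ : ∀ n {m} → Formula (n ℕ.+ m) → Formula m
∃ⁿ zero    X = X
∃ⁿ (suc n) X = ∃ⁿ n (`∃ X)

State : ℕ → Set
State n = Fin n → Term 0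

vecI : ∀ n {m} (X : Formula (n ℕ.+ m)) (c : State m) (v : State n) → Γ ⊩ substF (v ⊕ c) X → Γ ⊩ substF c (∃ⁿ n X)
vecI zero    X c v d = d
vecI (suc n) X c v d = vecI n (`∃ X) c (v ∘ suc) (∃I (v zero) (coe (sym (inst1-lift ((v ∘ suc) ⊕ c) X (v zero))) d))

vecE : ∀ n {m} (X : Formula (n ℕ.+ m)) (c : State m) → Γ ⊩ substF c (∃ⁿ n X) → (∀ v → substF (v ⊕ c) X ∷ Γ ⊩ C) → Γ ⊩ C
vecE zero    X c d f = cutI d (f λ ())
vecE (suc n) X c d f = vecE n (`∃ X) c d λ v → ∃E h0 λ u →
  mono (λ { (here e) → here (≡.trans e (sym (inst1-lift (v ⊕ c) X u))) ; (there i) → there (there i) }) (f (u ◂ v))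

orL andL : List (Formula n) → Formula n
orL []        = bot
orL (φ ∷ φs)  = φ `∨ orL φs
andL []       = `0 `= `0
andL (φ ∷ φs) = φ `∧ andL φs

orI : ∀ {φ : Formula n} {φs} (σ : Fin n → Term 0) → φ ∈ φs → Γ ⊩ substF σ φ → Γ ⊩ substF σ (orL φs)
orI σ (here refl) d = ∨I₁ d
orI σ (there i)   d = ∨I₂ (orI σ i d)

orE : ∀ (φs : List (Formula n)) (σ : Fin n → Term 0) → Γ ⊩ substF σ (orL φs) → (∀ φ → φ ∈ φs → substF σ φ ∷ Γ ⊩ C) → Γ ⊩ C
orE []       σ d f = botE d
orE (φ ∷ φs) σ d f = ∨E d (f φ (here refl)) (orE φs σ h0 λ ψ i →
  mono (λ { (here e) → here e ; (there i) → there (there i) }) (f ψ (there i)))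

andI : ∀ (φs : List (Formula 0)) θ → (∀ φ → φ ∈ φs → Γ ⊩ fsubF θ φ) → Γ ⊩ fsubF θ (andL φs)
andI []       θ f = eqR
andI (φ ∷ φs) θ f = ∧I (f φ (here refl)) (andI φs θ λ ψ i → f ψ (there i))

andE : ∀ {φ} {φs : List (Formula 0)} θ → φ ∈ φs → Γ ⊩ fsubF θ (andL φs) → Γ ⊩ fsubF θ φ
andE θ (here refl) d = ∧E₁ d
andE θ (there i)   d = andE θ i (∧E₂ d)

-- Well-founded relations between tuples

module _ {D : ℕ} where

  -- The successor `v` occupies the low indices, where `∃ⁿ` can bind it.
  At₂ : Formula (D ℕ.+ D) → State D → State D → Formula 0
  At₂ R b v = substF (v ⊕ b) R

  Succ : Formula D → Formula (D ℕ.+ D) → Formula D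
  Succ P R = ∃ⁿ D (substF (λ i → bv (i ↑ˡ D)) P `∧ R)

  private
    lift-at : ∀ P (v b : State D) → substF (v ⊕ b) (substF (λ i → bv (i ↑ˡ D)) P) ≡ substF v P
    lift-at P v b = ≡.trans (substF-substF (v ⊕ b) _ P) (substF-≗ P (⊕-↑ˡ v b))

  succI : ∀ P R (b v : State D) → Γ ⊩ substF v P → Γ ⊩ At₂ R b v → Γ ⊩ substF b (Succ P R)
  succI P R b v d e = vecI D _ b v (∧I (coe (sym (lift-at P v b)) d) e)

  succE : ∀ P R (b : State D) → Γ ⊩ substF b (Succ P R) → (∀ v → substF v P ∷ At₂ R b v ∷ Γ ⊩ C) → Γ ⊩ C
  succE P R b d f = vecE D _ b d λ v → ∧open (coeL (sym (lift-at P v b)) (f v))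

  NoMin : List (Formula 0) → Formula D → Formula (D ℕ.+ D) → Set
  NoMin Γ P R = ∀ b → substF b P ∷ Γ ⊩ substF b (Succ P R)

  -- Well-foundedness as a schema: no formula defines a nonempty set without R-minimal elements.
  Wf : Formula (D ℕ.+ D) → Set
  Wf R = ∀ {Γ} P → NoMin Γ P R → ∀ b → substF b P ∷ Γ ⊩ bot

  -- The `T`-successors of `b`, with the terms of `b` as parameters, since the schema `Wf` is
  -- instantiated by formulas in a single tuple.
  Above : State D → Formula (D ℕ.+ D) → Formula D
  Above b T = substF (bv ⊕ (wk0 ∘ b)) T

  above-at : ∀ b v T → substF v (Above b T) ≡ At₂ T b v
  above-at b v T = ≡.trans (substF-substF v _ T) (substF-≗ T λ i →
    ≡.trans (⊕-map (substT v) bv (wk0 ∘ b) i) (⊕-cong (λ _ → refl) (λ i → ≡.trans (substT-wk0 v (b i)) (wk0-id (b i))) i))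

  -- Podelski–Rybalchenko: a transitive relation covered by finitely many well-founded relations is well-founded.
  -- If P has no T-minimal element, then each element of P has a T-successor that is R-minimal in P;
  -- so the R-minimal elements again have no T-minimal element, and R does not occur among them.
  wfUnion : (T : Formula (D ℕ.+ D)) → (∀ {Γ} a b c → Γ ⊩ At₂ T a b → Γ ⊩ At₂ T b c → Γ ⊩ At₂ T a c) →
            (Rs : List (Formula (D ℕ.+ D))) → All Wf Rs → (∀ {R Γ} → R ∈ Rs → ∀ a b → Γ ⊩ At₂ R a b → Γ ⊩ At₂ T a b) →
            ∀ {Γ} P → NoMin Γ P T →
            (∀ a b → substF a P ∷ substF b P ∷ At₂ T a b ∷ Γ ⊩ At₂ (orL Rs) a b) → ∀ b → substF b P ∷ Γ ⊩ bot
  -- With no relation left the covering disjunction is `bot`, while `nm` supplies a pair to be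
  -- covered.
  wfUnion T tr [] _ _ P nm cov b = succE P T b (nm b) λ v →
    mono (λ { (here e) → there (there (here e)) ; (there (here e)) → here e ; (there (there (here e))) → there (here e)
            ; (there (there (there i))) → there (there (there i)) }) (cov b v)
  wfUnion T tr (R ∷ Rs) (wfR ∷ wfs) sub {Γ} P nm cov b = succE Amin T b (reach b) λ v →
    mono (λ { (here e) → here e ; (there i) → there (there (there i)) }) (rec v)
    where
    Amin = P `∧ (`¬ Succ P R)

    reach : ∀ b → substF b P ∷ Γ ⊩ substF b (Succ Amin T)
    reach b = raa (succE P T b (w (nm b)) λ v → cutI (∧I h0 (coe (sym (above-at b v T)) h1))
        (mono (λ { (here e) → here e ; (there i) → there (there (there i)) }) (wfR Pb nmb v)))
      where
      Pb = P `∧ Above b T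
      nmb : NoMin (`¬ substF b (Succ Amin T) ∷ substF b P ∷ Γ) Pb R
      -- An `R`-successor of `v` in `P` is still above `b`, because `R` is contained in the
      -- transitive `T`. Without one, `v` is an `R`-minimal `T`-successor of `b`, contrary to the
      -- assumption.
      nmb v = em {A = substF v (Succ P R)}
        (succE P R v h0 λ v' → succI Pb R v v' (∧I h0 (coe (sym (above-at b v' T))
          (tr b v v' (coe (above-at b v T) (∧E₂ h3)) (sub (here refl) v v' h1)))) h1)
        (¬E h2 (succI Amin T b v (∧I (∧E₁ h1) h0) (coe (above-at b v T) (∧E₂ h1))))

    rec : ∀ v → substF v Amin ∷ Γ ⊩ bot
    rec = wfUnion T tr Rs wfs (λ i → sub (there i)) Amin
      (λ b → cutI (∧E₁ h0) (mono (λ { (here e) → here e ; (there i) → there (there i) }) (reach b)))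
      λ a c → ∨E (cutI (∧E₁ h1) (cutI (∧E₁ h1) (mono (λ { (here e) → here e ; (there (here e)) → there (here e)
                  ; (there (there i)) → there (there (there (there i))) }) (cov a c))))
                 (botE (¬E (∧E₂ h1) (succI P R a c (∧E₁ h2) h0))) h0

-- States and the relations between them

num : ℕ → Term 0
num zero    = `0
num (suc i) = `s (num i)

num≢ : ∀ i j → i ≢ j → Γ ⊩ num i `= num j → Γ ⊩ bot
num≢ zero    zero    ne d = ⊥-elim (ne refl)
num≢ zero    (suc j) ne d = s≢0 (eqSym d)
num≢ (suc i) zero    ne d = s≢0 d
num≢ (suc i) (suc j) ne d = num≢ i j (ne ∘ cong suc) (s-inj d)

fsubT-num : ∀ θ i → fsubT θ (num i) ≡ num i
fsubT-num θ zero    = refl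
fsubT-num θ (suc i) = cong `s (fsubT-num θ i)

pick : (Fin n → Term m) → ℕ → Term m
pick {zero}  f x       = `0
pick {suc n} f zero    = f zero
pick {suc n} f (suc x) = pick (f ∘ suc) x

substT-pick : ∀ (σ : Fin m → Term k) (f : Fin n → Term m) x → substT σ (pick f x) ≡ pick (substT σ ∘ f) x
substT-pick {n = zero}  σ f x       = refl
substT-pick {n = suc n} σ f zero    = refl
substT-pick {n = suc n} σ f (suc x) = substT-pick σ (f ∘ suc) x

pick-⊕ˡ : ∀ (v : Fin n → Term k) (b : Fin m → Term k) {x} → x < n → pick (v ⊕ b) x ≡ pick v x
pick-⊕ˡ {n = suc n} v b {zero}  l       = refl
pick-⊕ˡ {n = suc n} v b {suc x} (s≤s l) = pick-⊕ˡ (v ∘ suc) b l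

pick-⊕ʳ : ∀ (v : Fin n → Term k) (b : Fin m → Term k) x → pick (v ⊕ b) (n ℕ.+ x) ≡ pick b x
pick-⊕ʳ {n = zero}  v b x = refl
pick-⊕ʳ {n = suc n} v b x = pick-⊕ʳ (v ∘ suc) b x

-- The free name x < n becomes the bound variable with index x; all other names become 0.
bind : Formula 0 → Formula n
bind = gF (λ ()) (pick bv)

bind-at : ∀ (σ : State n) X → substF σ (bind X) ≡ fsubF (pick σ) X
bind-at σ X = ≡.trans (substF-gF σ X) (≡.trans (gF-≗ X (λ ()) (λ x → ≡.trans (substT-pick σ bv x) (sym (wk0-id _)))) (sym (fsubF≡gF _ X)))

Entry : Set
Entry = Formula 0 × Formula 0 × Bool

-- A trace through repeated traversals of one loop: each traversal contributes an entry of its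
-- colour `M`.
data Chain (M : List Entry) : Bool → Formula 0 → Formula 0 → Set where
  one  : ∀ {τ τ' s} → (τ , τ' , s) ∈ M → Chain M s τ τ'
  more : ∀ {τ τ' τ'' s s'} → (τ , τ' , s) ∈ M → Chain M s' τ' τ'' → Chain M (s ∨ s') τ τ''

-- A state consists of a node number (component 0) and values for the free names below D. In relations between
-- states, the components of the new state come first.
module States (D : ℕ) where

  private
    D' = suc D

    At : Formula (D' ℕ.+ D') → State D' → State D' → Formula 0
    At = At₂ {D'}

  val : State D' → Formula 0 → Formula 0
  val b = fsubF (λ x → pick b (suc x))

  -- Names move up by one to leave 0 for the node number; `old` moreover skips the block of the new
  -- state.
  new old : Formula 0 → Formula 0
  new = fsubF (λ x → fv (suc x))
  old = fsubF (λ x → fv (D' ℕ.+ suc x))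

  val-new : ∀ v τ → fsubF (pick v) (new τ) ≡ val v τ
  val-new v τ = ≡.trans (fsubF-fsubF (pick v) _ τ) (fsubF-cong τ λ x _ → wk0-id (pick v (suc x)))

  -- The bound matters: a name from `D` on would run over into the block of the old state.
  val-new₂ : ∀ v (b : State D') τ → supF τ ≤ D → fsubF (pick (v ⊕ b)) (new τ) ≡ val v τ
  val-new₂ v b τ l = ≡.trans (fsubF-fsubF (pick (v ⊕ b)) _ τ) (fsubF-cong τ λ x o →
    ≡.trans (wk0-id _) (pick-⊕ˡ v b (s≤s (ℕₚ.≤-trans (occF-sup x τ o) l))))

  val-old : ∀ (v b : State D') τ → fsubF (pick (v ⊕ b)) (old τ) ≡ val b τ
  val-old v b τ = ≡.trans (fsubF-fsubF (pick (v ⊕ b)) _ τ) (fsubF-cong τ λ x _ → ≡.trans (wk0-id _) (pick-⊕ʳ {n = D'} v b (suc x)))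

  domT : Entry → Formula 0
  domT (τ , τ' , s) = Dom s (old τ) (new τ')

  relT : ℕ → ℕ → List Entry → List (Formula 0)
  relT i j M = (fv (D' ℕ.+ 0) `= num i) ∷ (fv 0 `= num j) ∷ map domT M

  Rel : ℕ → ℕ → List Entry → Formula (D' ℕ.+ D')
  Rel i j M = bind (andL (relT i j M))

  Small : List Entry → Set
  Small M = ∀ {τ τ' s} → (τ , τ' , s) ∈ M → supF τ' ≤ D

  private
    srcEq : ∀ (v b : State D') i → fsubF (pick (v ⊕ b)) (fv (D' ℕ.+ 0) `= num i) ≡ (b zero `= num i)
    srcEq v b i = cong₂ _`=_ (≡.trans (wk0-id _) (pick-⊕ʳ {n = D'} v b 0)) (fsubT-num _ i)

    tgtEq : ∀ (v b : State D') j → fsubF (pick (v ⊕ b)) (fv 0 `= num j) ≡ (v zero `= num j)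
    tgtEq v b j = cong₂ _`=_ (wk0-id (v zero)) (fsubT-num _ j)

    domEq : ∀ (v b : State D') τ τ' s → supF τ' ≤ D → fsubF (pick (v ⊕ b)) (domT (τ , τ' , s)) ≡ Dom s (val b τ) (val v τ')
    domEq v b τ τ' s l = ≡.trans (fsubF-Dom _ s (old τ) (new τ')) (cong₂ (Dom s) (val-old v b τ) (val-new₂ v b τ' l))

  module _ (i j : ℕ) (M : List Entry) (small : Small M) where

    relI : ∀ b v → Γ ⊩ b zero `= num i → Γ ⊩ v zero `= num j →
           (∀ {τ τ' s} → (τ , τ' , s) ∈ M → Γ ⊩ Dom s (val b τ) (val v τ')) → Γ ⊩ At (Rel i j M) b v
    relI {Γ} b v d e f = coe (sym (bind-at (v ⊕ b) (andL (relT i j M)))) (andI (relT i j M) (pick {n = D' ℕ.+ D'} (v ⊕ b)) go)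
      where
      go : ∀ φ → φ ∈ relT i j M → Γ ⊩ fsubF (pick (v ⊕ b)) φ
      go _ (here refl)         = coe (sym (srcEq v b i)) d
      go _ (there (here refl)) = coe (sym (tgtEq v b j)) e
      go φ (there (there k)) with ∈-map⁻ domT k
      ... | (τ , τ' , s) , k' , refl = coe (sym (domEq v b τ τ' s (small k'))) (f k')

    private
      open-rel : ∀ b v → Γ ⊩ At (Rel i j M) b v → Γ ⊩ fsubF (pick (v ⊕ b)) (andL (relT i j M))
      open-rel b v = coe (bind-at (v ⊕ b) (andL (relT i j M)))

    relSrc : ∀ b v → Γ ⊩ At (Rel i j M) b v → Γ ⊩ b zero `= num i
    relSrc b v d = coe (srcEq v b i) (andE {φs = relT i j M} (pick {n = D' ℕ.+ D'} (v ⊕ b)) (here refl) (open-rel b v d))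

    relTgt : ∀ b v → Γ ⊩ At (Rel i j M) b v → Γ ⊩ v zero `= num j
    relTgt b v d = coe (tgtEq v b j) (andE {φs = relT i j M} (pick {n = D' ℕ.+ D'} (v ⊕ b)) (there (here refl)) (open-rel b v d))

    relDom : ∀ {τ τ' s} b v → (τ , τ' , s) ∈ M → Γ ⊩ At (Rel i j M) b v → Γ ⊩ Dom s (val b τ) (val v τ')
    relDom {τ = τ} {τ'} {s} b v k d = coe (domEq v b τ τ' s (small k))
      (andE {φs = relT i j M} (pick {n = D' ℕ.+ D'} (v ⊕ b)) (there (there (∈-map⁺ domT k))) (open-rel b v d))

    -- No two steps follow each other: the first ends at node j, the second would have to begin at
    -- node i.
    wfCross : i ≢ j → Wf (Rel i j M)
    wfCross ne P nm b = succE {D = D'} P (Rel i j M) b (nm b) λ v → cutI h0 (succE {D = D'} P (Rel i j M) v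
      (mono (λ { (here e) → here e ; (there k) → there (there (there (there k))) }) (nm v)) λ v' →
      num≢ i j ne (eqTrans (eqSym (relSrc v v' h1)) (relTgt b v h4)))

    private
      -- One step of the relation is taken for each entry of the chain, and the comparisons along
      -- the way compose.
      follow : ∀ {P s τ τ'} → Chain M s τ τ' → NoMin Γ P (Rel i j M) → Γ ⊆ Γ' → ∀ b → Γ' ⊩ substF b P →
               (∀ v → substF v P ∷ Dom s (val b τ) (val v τ') ∷ Γ' ⊩ C) → Γ' ⊩ C
      follow {P = P} (one k) nm sub b d f = succE {D = D'} P (Rel i j M) b
        (cutI d (mono (λ { (here e) → here e ; (there l) → there (sub l) }) (nm b))) λ v →
        cutI (relDom b v k h1) (mono (λ { (here e) → there (here e) ; (there (here e)) → here e ; (there (there l)) → there (there (there l)) }) (f v))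
      follow {P = P} {τ = τ} (more {τ' = τ'} {τ'' = τ''} {s = s} {s' = s'} k c) nm sub b d f = succE {D = D'} P (Rel i j M) b
        (cutI d (mono (λ { (here e) → here e ; (there l) → there (sub l) }) (nm b))) λ v →
        follow c nm (there ∘ there ∘ sub) v h0 λ v' →
        cutI (domTrans {X = val b τ} {Y = val v τ'} {Z = val v' τ''} s s' (relDom b v k h3) h1)
          (mono (λ { (here e) → there (here e) ; (there (here e)) → here e ; (there (there l)) → there (there (there (there (there l)))) }) (f v'))

    -- Following the chain leads back to `τ` with a smaller rank. `F a` says that `τ` has a rank
    -- below `a` at some state in `P`; induction on `a` refutes it.
    wfLoop : ∀ {τ} → supF τ ≤ D → Chain M true τ τ → Wf (Rel i j M)
    wfLoop {τ} lτ c {Γ} P nm b = follow c nm there b h0 λ v →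
        -- `Dom` includes the existence of a rank `u`, and `u` witnesses `F (s u)`.
        rankedE {X = val b τ} (∧E₁ h1) λ u → ¬E {A = F (`s u)}
          (natInd {F = λ u → `¬ F u} {t = `s u} fam
             (¬I (fE `0 h0 λ v u → leCase h1 (s≢0 h0) λ z → s≢0 h1))
             (λ a → ¬I (fE (`s a) h0 λ v u → step a v u (λ l → there (there (there (there l)))))))
          (fI (`s u) b u h3 h0 leRefl)
      where
      -- The bound `a` takes the place of the whole old state, of which only component 0 is read; in
      -- this way `Succ` and `bind` express `F`.
      K : Formula 0
      K = `∃ (Rk (new τ) (bv zero) `∧ Le (`s (bv zero)) (fv (D' ℕ.+ 0)))
      F : Term 0 → Formula 0
      F u = substF (λ _ → u) (Succ P (bind K))
      fam : Fam (λ u → `¬ F u)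
      fam = `¬ substF (λ _ → bv zero) (Succ P (bind K)) , λ u →
        cong `¬_ (≡.trans (substF-substF (σ1 u) (λ _ → bv zero) (Succ P (bind K))) (substF-≗ {n = D'} (Succ P (bind K)) λ _ → refl))
      KAt : State D' → Term 0 → Formula 0
      KAt v a = `∃ (Rk (val v τ) (bv zero) `∧ Le (`s (bv zero)) (wk0 a))
      kEq : ∀ v a → At (bind K) (λ _ → a) v ≡ KAt v a
      kEq v a = ≡.trans (bind-at (v ⊕ (λ _ → a)) K) (cong₂ (λ X x → `∃ (X `∧ Le (`s (bv zero)) (wk0 x)))
        (≡.trans (fsubF-Rk _ (new τ) (bv zero)) (cong (λ X → Rk X (bv zero)) (val-new₂ v _ τ lτ)))
        (pick-⊕ʳ {n = D'} v (λ _ → a) 0))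
      kInst : ∀ v a u → inst1 (Rk (val v τ) (bv zero) `∧ Le (`s (bv zero)) (wk0 a)) u ≡ (Rk (val v τ) u `∧ Le (`s u) a)
      kInst v a u = cong₂ (λ X x → X `∧ Le (`s u) x) (rkInst (val v τ) u) (≡.trans (substT-wk0 (σ1 u) a) (wk0-id a))
      fI : ∀ {Γ} a v u → Γ ⊩ substF v P → Γ ⊩ Rk (val v τ) u → Γ ⊩ Le (`s u) a → Γ ⊩ F a
      fI a v u d e f = succI {D = D'} P (bind K) (λ _ → a) v d (coe (sym (kEq v a)) (exI _ (kInst v a) u (∧I e f)))
      fE : ∀ {Γ C} a → Γ ⊩ F a → (∀ v u → Rk (val v τ) u ∷ Le (`s u) a ∷ substF v P ∷ Γ ⊩ C) → Γ ⊩ C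
      fE a d f = succE {D = D'} P (bind K) (λ _ → a) d λ v → exE _ (kInst v a) (coe (kEq v a) h1) λ u → ∧open (mono
        (λ { (here e) → here e ; (there (here e)) → there (here e) ; (there (there (here e))) → there (there (here e))
           ; (there (there (there l))) → there (there (there (there l))) }) (f v u))
      step : ∀ {Γ₁} a v u → Γ ⊆ Γ₁ → Rk (val v τ) u ∷ Le (`s u) (`s a) ∷ substF v P ∷ F (`s a) ∷ (`¬ F a) ∷ Γ₁ ⊩ bot
      step a v u sub = follow c nm (λ l → there (there (there (there (there (sub l)))))) v h2 λ v' →
        belowE {b = true} {Y = val v' τ} (domE {b = true} {X = val v τ} {Y = val v' τ} h1 h2) λ u' →
        ¬E (w h7) (fI a v' u' h2 h0 (leTrans h1 (sMono⁻ h5)))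

-- Local soundness

record Bad (S : Seq) (Γ : List (Formula 0)) (θ : ℕ → Term 0) : Set where
  constructor bad
  field
    trueL  : ∀ {γ} → γ ∈ ante S → Γ ⊩ fsubF θ γ
    falseR : ∀ {δ} → δ ∈ Seq.succ S → Γ ⊩ `¬ fsubF θ δ
open Bad

-- A plain step leaves the instantiated formula literally unchanged, a progress step lowers its
-- rank. For `τ` in the antecedent, eigenvariable conditions keep a changed assignment from
-- affecting `τ`.
Link : ∀ {S ps} → CycRule S ps → Fin (length ps) → List (Formula 0) → (ℕ → Term 0) → (ℕ → Term 0) → Set
Link {S} r j Γ θ θ' = ∀ {τ τ'} → τ ∈ ante S →
  (Plain r j τ τ' → fsubF θ τ ≡ fsubF θ' τ') × (Prog r j τ τ' → Γ ⊩ Dom true (fsubF θ τ) (fsubF θ' τ'))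

fsubF-upd-fam : ∀ θ φ x → Fam (λ u → fsubF (θ [ x ↦ u ]) φ)
fsubF-upd-fam θ φ x = gF (λ ()) f φ , λ u → ≡.trans (substF-gF (σ1 u) φ)
    (≡.trans (gF-≗ φ (λ ()) (λ y → ≡.trans (go u y) (sym (wk0-id ((θ [ x ↦ u ]) y))))) (sym (fsubF≡gF _ φ)))
  where
  f : ℕ → Term 1
  f y = if y ≡ᵇ x then bv zero else wk0 (θ y)
  go : ∀ u y → substT (σ1 u) (f y) ≡ (θ [ x ↦ u ]) y
  go u y with y ≡ᵇ x
  ... | true  = refl
  ... | false = ≡.trans (substT-wk0 (σ1 u) (θ y)) (wk0-id (θ y))

inst1-upd : ∀ θ a φ t → FreshF a φ → fsubF (θ [ a ↦ t ]) (inst1 φ (fv a)) ≡ inst1 (fsubF θ φ) t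
inst1-upd θ a φ t fr = ≡.trans (fsubF-inst1 _ φ (fv a)) (cong₂ inst1 (upd-fresh θ a t fr) (≡.trans (wk0-id _) (upd-self θ a t)))

freshRTC : ∀ z (φ : Formula 2) (s t : Term 0) → FreshF z φ → FreshT z s → FreshT z t → FreshF z (RTC φ s t)
freshRTC z φ s t p q r rewrite p | q | r = refl

same : ∀ {S ps} (r : BaseRule S ps) j → Link {S} {ps} (inj₁ r) j Γ θ θ
same r j _ = (λ { refl → refl }) , λ ()

-- Which premise fails may be decided only inside the calculus, by `em` or `∨E`, and its assignment
-- may contain an eigenvariable. Hence the continuation, in a growing context.
descend : ∀ {S ps} (r : CycRule S ps) → Bad S Γ θ →
          (∀ j {Γ'} θ' → Γ ⊆ Γ' → Bad (lookup ps j) Γ' θ' → Link r j Γ' θ θ' → Γ' ⊩ bot) → Γ ⊩ bot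
descend (inj₁ ax) (bad l r) k = ¬E (r (here refl)) (l (here refl))
descend {θ = θ} (inj₁ ρ@(wk p q)) (bad l r) k = k zero θ id (bad (l ∘ p) (r ∘ q)) (same ρ zero)
descend {θ = θ} (inj₁ ρ@¬L) (bad l r) k =
  k zero θ id (bad (l ∘ there) λ { (here refl) → l (here refl) ; (there i) → r i }) (same ρ zero)
descend {θ = θ} (inj₁ ρ@¬R) (bad l r) k =
  k zero θ id (bad (λ { (here refl) → raa (¬E (w (r (here refl))) h0) ; (there i) → l i }) (r ∘ there)) (same ρ zero)
descend {θ = θ} (inj₁ ρ@∧L) (bad l r) k =
  k zero θ id (bad (λ { (here refl) → ∧E₁ (l (here refl)) ; (there (here refl)) → ∧E₂ (l (here refl)) ; (there (there i)) → l (there i) }) r) (same ρ zero)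
descend {θ = θ} (inj₁ ρ@(∧R {φ = φ})) (bad l r) k = em {A = fsubF θ φ}
  (k (suc zero) θ there (bad (w ∘ l) λ { (here refl) → ¬I (¬E (w² (r (here refl))) (∧I h1 h0)) ; (there i) → w (r (there i)) }) (same ρ (suc zero)))
  (k zero θ there (bad (w ∘ l) λ { (here refl) → h0 ; (there i) → w (r (there i)) }) (same ρ zero))
descend {θ = θ} (inj₁ ρ@∨L) (bad l r) k = ∨E (l (here refl))
  (k zero θ there (bad (λ { (here refl) → h0 ; (there i) → w (l (there i)) }) (w ∘ r)) (same ρ zero))
  (k (suc zero) θ there (bad (λ { (here refl) → h0 ; (there i) → w (l (there i)) }) (w ∘ r)) (same ρ (suc zero)))
descend {θ = θ} (inj₁ ρ@∨R) (bad l r) k = k zero θ id (bad l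
  λ { (here refl) → ¬I (¬E (w (r (here refl))) (∨I₁ h0)) ; (there (here refl)) → ¬I (¬E (w (r (here refl))) (∨I₂ h0)) ; (there (there i)) → r (there i) }) (same ρ zero)
descend {θ = θ} (inj₁ ρ@(→L {φ = φ})) (bad l r) k = em {A = fsubF θ φ}
  (k (suc zero) θ there (bad (λ { (here refl) → →E (w (l (here refl))) h0 ; (there i) → w (l (there i)) }) (w ∘ r)) (same ρ (suc zero)))
  (k zero θ there (bad (w ∘ l ∘ there) λ { (here refl) → h0 ; (there i) → w (r i) }) (same ρ zero))
descend {θ = θ} (inj₁ ρ@→R) (bad l r) k = k zero θ id (bad
  (λ { (here refl) → raa (¬E (w (r (here refl))) (→I (¬E h1 h0))) ; (there i) → l i })
  λ { (here refl) → ¬I (¬E (w (r (here refl))) (→I h1)) ; (there i) → r (there i) }) (same ρ zero)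
descend {θ = θ} (inj₁ ρ@(∀L {φ = φ} t)) (bad l r) k = k zero θ id (bad
  (λ { (here refl) → coe (sym (fsubF-inst1 θ φ t)) (∀E (l (here refl)) (fsubT θ t)) ; (there i) → l (there i) }) r) (same ρ zero)
descend {θ = θ} (inj₁ (∀R {Γ₀} {Δ₀} {φ} a fΓ fΔ fφ)) (bad l r) k = ¬E (r (here refl)) (∀I λ t → raa
  (k zero (θ [ a ↦ t ]) there (bad
    (λ {γ} i → coe (sym (upd-fresh θ a t {γ} (All.lookup fΓ i))) (w (l i)))
    λ { (here refl) → coe (cong `¬_ (sym (inst1-upd θ a φ t fφ))) h0
      ; {δ} (there i) → coe (cong `¬_ (sym (upd-fresh θ a t {δ} (All.lookup fΔ i)))) (w (r (there i))) })
    λ {τ} i → (λ { refl → sym (upd-fresh θ a t {τ} (All.lookup fΓ i)) }) , λ ()))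
descend {θ = θ} (inj₁ (∃L {Γ₀} {Δ₀} {φ} a fΓ fΔ fφ)) (bad l r) k = ∃E (l (here refl)) λ t →
  k zero (θ [ a ↦ t ]) there (bad
    (λ { (here refl) → coe (sym (inst1-upd θ a φ t fφ)) h0
       ; {γ} (there i) → coe (sym (upd-fresh θ a t {γ} (All.lookup fΓ i))) (w (l (there i))) })
    (λ {δ} i → coe (cong `¬_ (sym (upd-fresh θ a t {δ} (All.lookup fΔ i)))) (w (r i))))
    λ { {τ} (here refl) → (λ { refl → sym (upd-fresh θ a t {`∃ φ} fφ) }) , λ ()
      ; {τ} (there i) → (λ { refl → sym (upd-fresh θ a t {τ} (All.lookup fΓ i)) }) , λ () }
descend {θ = θ} (inj₁ ρ@(∃R {φ = φ} t)) (bad l r) k = k zero θ id (bad l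
  λ { (here refl) → ¬I (¬E (w (r (here refl))) (∃I (fsubT θ t) (coe (fsubF-inst1 θ φ t) h0))) ; (there i) → r (there i) }) (same ρ zero)
descend {θ = θ} (inj₁ ρ@(=L₁ φ x s t)) (bad l r) k = k zero θ id (bad (l ∘ there)
  λ { (here refl) → ¬I (¬E (w (r (here refl))) (coe (sym (fsubF-single θ φ t x))
        (eqE {F = λ u → fsubF (θ [ x ↦ u ]) φ} (fsubF-upd-fam θ φ x) (w (l (here refl))) (coe (fsubF-single θ φ s x) h0))))
    ; (there i) → r (there i) }) (same ρ zero)
descend {θ = θ} (inj₁ ρ@(=L₂ φ x s t)) (bad l r) k = k zero θ id (bad (l ∘ there)
  λ { (here refl) → ¬I (¬E (w (r (here refl))) (coe (sym (fsubF-single θ φ s x))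
        (eqE {F = λ u → fsubF (θ [ x ↦ u ]) φ} (fsubF-upd-fam θ φ x) (eqSym (w (l (here refl)))) (coe (fsubF-single θ φ t x) h0))))
    ; (there i) → r (there i) }) (same ρ zero)
descend (inj₁ (=R t)) (bad l r) k = ¬E (r (here refl)) eqR
descend {θ = θ} (inj₁ ρ@(cut φ)) (bad l r) k = em {A = fsubF θ φ}
  (k (suc zero) θ there (bad (λ { (here refl) → h0 ; (there i) → w (l i) }) (w ∘ r)) (same ρ (suc zero)))
  (k zero θ there (bad (w ∘ l) λ { (here refl) → h0 ; (there i) → w (r i) }) (same ρ zero))
descend (inj₁ refl) (bad l r) k = ¬E (r (here refl)) rtcRefl
descend {θ = θ} (inj₁ ρ@(trans {φ = φ} {s} {t} p)) (bad l r) k = em {A = RTC (fsubF θ φ) (fsubT θ s) (fsubT θ p)}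
  (k (suc zero) θ there (bad (w ∘ l) λ { (here refl) → ¬I (¬E (w² (r (here refl))) (rtcStep h1 (coe (fsubF-inst2 θ φ p t) h0)))
    ; (there i) → w (r (there i)) }) (same ρ (suc zero)))
  (k zero θ there (bad (w ∘ l) λ { (here refl) → h0 ; (there i) → w (r (there i)) }) (same ρ zero))
descend (inj₁ A₁) (bad l r) k = s≢0 (l (here refl))
descend (inj₁ A₂) (bad l r) k = ¬E (r (here refl)) (s-inj (l (here refl)))
descend (inj₁ A₃) (bad l r) k = ¬E (r (here refl)) +0
descend (inj₁ A₄) (bad l r) k = ¬E (r (here refl)) +s
descend (inj₁ A₅) (bad l r) k = ¬E (r (here refl)) zero≤
descend {θ = θ} (inj₂ (inj₁ (subst θ₀))) (bad l r) k = k zero (fsubT θ ∘ θ₀) id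
  (bad (λ {γ} i → coe (fsubF-fsubF θ θ₀ γ) (l (∈-map⁺ _ i))) (λ {δ} i → coe (cong `¬_ (fsubF-fsubF θ θ₀ δ)) (r (∈-map⁺ _ i))))
  (λ {τ} {τ'} _ → (λ { refl → fsubF-fsubF θ θ₀ τ' }) , λ ())
descend {Γ} {θ} (inj₂ (inj₂ (case {Γ₀} {Δ₀} φ s t z fΓ fΔ fφ fs ft))) (bad l r) k = em {A = s' `= t'}
  (k zero θ there (bad (λ { (here refl) → h0 ; (there i) → w (l (there i)) }) (w ∘ r))
    (λ _ → (λ { refl → refl }) , λ { (() , _) }))
  -- The rank `u` must be least: `Dom` compares with an arbitrary rank `u'` of the principal
  -- formula, and v + 1 ≤ u ≤ u'.
  (rankLeast β s' (w holds) λ u → rankDown β s' h0 (¬E h3 h0) λ z' v →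
    k (suc zero) (θ [ z ↦ z' ]) (there ∘ there ∘ there ∘ there ∘ there ∘ there) (bad
      (λ { (here refl) → coe (sym (rtcEq' z')) (coe (rtc-id β s' z') (rankTrue β s' h0))
         ; (there (here refl)) → coe (sym (instEq z')) h2
         ; {γ} (there (there i)) → coe (sym (upd-fresh θ z z' {γ} (All.lookup fΓ i))) (w³ (w³ (l (there i)))) })
      (λ {δ} i → coe (cong `¬_ (sym (upd-fresh θ z z' {δ} (All.lookup fΔ i)))) (w³ (w³ (r i)))))
      λ i → (λ { refl → sym (updL z' i) }) ,
        λ { (_ , refl , refl) → coe (cong (Dom true (RTC β s' t')) (sym (rtcEq' z')))
              (domI true (ranked (RTC β s' t') (w³ (w³ (l (here refl))))) λ u' → belowI true v
                (coe (sym (rkEq z' v)) h1)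
                (leTrans h2 (→E (coe (minInst u u') (∀E h5 u')) (coe (rkEq t' u') h0)))) })
  where
  β = fsubF θ φ
  s' = fsubT θ s
  t' = fsubT θ t
  holds : Γ ⊩ rtc β s' t'
  holds = coe (sym (rtc-id β s' t')) (l (here refl))
  rtcEq' : ∀ z' → fsubF (θ [ z ↦ z' ]) (RTC φ s (fv z)) ≡ RTC β s' z'
  rtcEq' z' = cong₃ RTC (upd-fresh θ z z' {φ} fφ) (upd-freshT θ z z' {s} fs) (≡.trans (wk0-id _) (upd-self θ z z'))
  instEq : ∀ z' → fsubF (θ [ z ↦ z' ]) (inst2 φ (fv z) t) ≡ at2 β z' t'
  instEq z' = ≡.trans (fsubF-inst2 _ φ (fv z) t) (≡.trans (cong₃ inst2 (upd-fresh θ z z' {φ} fφ)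
    (≡.trans (wk0-id _) (upd-self θ z z')) (upd-freshT θ z z' {t} ft)) (at2-inst β z' t'))
  updL : ∀ z' {τ} → τ ∈ RTC φ s t ∷ Γ₀ → fsubF (θ [ z ↦ z' ]) τ ≡ fsubF θ τ
  updL z' (here refl) = upd-fresh θ z z' {RTC φ s t} (freshRTC z φ s t fφ fs ft)
  updL z' {τ} (there i) = upd-fresh θ z z' {τ} (All.lookup fΓ i)
  rkEq : ∀ x v → Rk (RTC β s' x) v ≡ M β s' x v
  rkEq x v = cong₂ (λ a b → M β a b v) (wk0-id s') (wk0-id x)
  minInst : ∀ u u' → inst1 (M β (renT suc s') (renT suc t') (bv zero) `→ Le (renT suc u) (bv zero)) u' ≡ (M β s' t' u' `→ Le u u')
  minInst u u' = cong₂ _`→_ (MEq β (renT suc s') (renT suc t') (bv zero) (iw u' s') (iw u' t') refl) (cong (λ a → Le a u') (iw u' u))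

-- Finite closures

-- Comparing tags beforehand leaves only the diagonal cases to `eqT` and `eqF`.
tagT : ∀ {n} → Term n → ℕ
tagT (bv _)   = 0
tagT (fv _)   = 1
tagT `0       = 2
tagT (`s _)   = 3
tagT (_ `+ _) = 4

tagF : ∀ {n} → Formula n → ℕ
tagF (_ `= _) = 0
tagF (`¬ _)   = 1
tagF (_ `∧ _) = 2
tagF (_ `∨ _) = 3
tagF (_ `→ _) = 4
tagF (`∀ _)   = 5
tagF (`∃ _)   = 6
tagF (RTC _ _ _) = 7

mutual
  infix 4 _≟T_ _≟F_

  _≟T_ : ∀ {n} → DecidableEquality (Term n)
  t ≟T u with tagT t ℕ.≟ tagT u
  ... | yes e = eqT t u e
  ... | no ne = no (ne ∘ cong tagT)

  eqT : ∀ {n} (t u : Term n) → tagT t ≡ tagT u → Dec (t ≡ u)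
  eqT (bv i)   (bv j)   _ = map′ (cong bv) (λ { refl → refl }) (i Finₚ.≟ j)
  eqT (fv x)   (fv y)   _ = map′ (cong fv) (λ { refl → refl }) (x ℕ.≟ y)
  eqT `0       `0       _ = yes refl
  eqT (`s t)   (`s u)   _ = map′ (cong `s) (λ { refl → refl }) (t ≟T u)
  eqT (t `+ t') (u `+ u') _ = map′ (λ { (refl , refl) → refl }) (λ { refl → refl , refl }) ((t ≟T u) ×-dec (t' ≟T u'))

  _≟F_ : ∀ {n} → DecidableEquality (Formula n)
  φ ≟F ψ with tagF φ ℕ.≟ tagF ψ
  ... | yes e = eqF φ ψ e
  ... | no ne = no (ne ∘ cong tagF)

  eqF : ∀ {n} (φ ψ : Formula n) → tagF φ ≡ tagF ψ → Dec (φ ≡ ψ)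
  eqF (t `= t') (u `= u') _ = map′ (λ { (refl , refl) → refl }) (λ { refl → refl , refl }) ((t ≟T u) ×-dec (t' ≟T u'))
  eqF (`¬ φ)    (`¬ ψ)    _ = map′ (cong `¬_) (λ { refl → refl }) (φ ≟F ψ)
  eqF (φ `∧ φ') (ψ `∧ ψ') _ = map′ (λ { (refl , refl) → refl }) (λ { refl → refl , refl }) ((φ ≟F ψ) ×-dec (φ' ≟F ψ'))
  eqF (φ `∨ φ') (ψ `∨ ψ') _ = map′ (λ { (refl , refl) → refl }) (λ { refl → refl , refl }) ((φ ≟F ψ) ×-dec (φ' ≟F ψ'))
  eqF (φ `→ φ') (ψ `→ ψ') _ = map′ (λ { (refl , refl) → refl }) (λ { refl → refl , refl }) ((φ ≟F ψ) ×-dec (φ' ≟F ψ'))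
  eqF (`∀ φ)    (`∀ ψ)    _ = map′ (cong `∀) (λ { refl → refl }) (φ ≟F ψ)
  eqF (`∃ φ)    (`∃ ψ)    _ = map′ (cong `∃) (λ { refl → refl }) (φ ≟F ψ)
  eqF (RTC φ t t') (RTC ψ u u') _ = map′ (λ { (refl , refl , refl) → refl }) (λ { refl → refl , refl , refl })
    ((φ ≟F ψ) ×-dec ((t ≟T u) ×-dec (t' ≟T u')))

module _ {A : Set} where

  subsets : List A → List (List A)
  subsets []       = [] ∷ []
  subsets (x ∷ xs) = subsets xs ++ map (x ∷_) (subsets xs)

  -- Every colour is a filter of the one list `entries`; this makes the colours finite in number and
  -- comparable as lists.
  filter∈subsets : ∀ {P : A → Set} (P? : Decidable P) xs → filter P? xs ∈ subsets xs
  filter∈subsets P? [] = here refl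
  filter∈subsets P? (x ∷ xs) with P? x
  ... | yes _ = ∈-++⁺ʳ (subsets xs) (∈-map⁺ (x ∷_) (filter∈subsets P? xs))
  ... | no  _ = ∈-++⁺ˡ (filter∈subsets P? xs)

  module _ (_≟_ : DecidableEquality A) (gen : List A → List A) (P : A → Set)
           (gen-P : ∀ S → (∀ {a} → a ∈ S → P a) → ∀ {a} → a ∈ gen S → P a)
           (U : List A) (gen-U : ∀ S {a} → a ∈ gen S → a ∈ U) where

    private
      Closed : List A → Set
      Closed S = ∀ {a} → a ∈ gen S → a ∈ S

      next : ∀ (R S : List A) → (∀ {a} → a ∈ S → P a) → (∀ {a} → a ∈ U → a ∈ S ⊎ a ∈ R) →
             Closed S ⊎ Σ A λ a → P a × a ∈ R
      next R S p c with All.all? (λ a → Any.any? (a ≟_) S) (gen S)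
      ... | yes done = inj₁ (All.lookup done)
      ... | no new with find (Allₚ.¬All⇒Any¬ (λ a → Any.any? (a ≟_) S) (gen S) new)
      ... | a , g , a∉S with c (gen-U S g)
      ... | inj₁ a∈S = ⊥-elim (a∉S a∈S)
      ... | inj₂ a∈R = inj₂ (a , gen-P S p g , a∈R)

      ≢? : ∀ a → Decidable (_≢ a)
      ≢? a x with x ≟ a
      ... | yes e = no λ ne → ne e
      ... | no ne = yes ne

      -- `R` contains all candidates not yet in `S`. Each round moves one of them to `S` and removes
      -- it from `R`, so the length of `R` bounds the number of rounds.
      saturate : ∀ n (R S : List A) → length R ≤ n → (∀ {a} → a ∈ S → P a) → (∀ {a} → a ∈ U → a ∈ S ⊎ a ∈ R) →
                 Σ (List A) λ S → (∀ {a} → a ∈ S → P a) × Closed S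
      saturate zero [] S l p c with next [] S p c
      ... | inj₁ done = S , p , done
      saturate (suc n) R S l p c with next R S p c
      ... | inj₁ done = S , p , done
      ... | inj₂ (a , pa , a∈R) = saturate n (filter (≢? a) R) (a ∷ S)
        (ℕₚ.≤-pred (ℕₚ.<-≤-trans (Listₚ.filter-notAll (≢? a) R (Any.map (λ { refl ne → ne refl }) a∈R)) l))
        (λ { (here refl) → pa ; (there i) → p i }) (λ {x} u → split x (c u))
        where
        split : ∀ x → x ∈ S ⊎ x ∈ R → x ∈ a ∷ S ⊎ x ∈ filter (≢? a) R
        split x (inj₁ i) = inj₁ (there i)
        split x (inj₂ i) with x ≟ a
        ... | yes refl = inj₁ (here refl)
        ... | no ne = inj₂ (∈-filter⁺ (≢? a) i ne)

    closure : Σ (List A) λ S → (∀ {a} → a ∈ S → P a) × (∀ {a} → a ∈ gen S → a ∈ S)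
    closure = saturate (length U) U [] ℕₚ.≤-refl (λ ()) inj₂

-- Colours of finite paths

chain-++ : ∀ {M s s' a b c} → Chain M s a b → Chain M s' b c → Chain M (s ∨ s') a c
chain-++ (one i) d = more i d
chain-++ {M} {c = c} (more {s = s} {s' = t} i d) e =
  ≡.subst (λ s → Chain M s _ c) (sym (Boolₚ.∨-assoc s t _)) (more i (chain-++ d e))

Joins : Entry → Entry → Entry → Set
Joins (a , b , s) (c , d , s') (e , f , s'') = a ≡ e × b ≡ c × d ≡ f × s'' ≡ s ∨ s'

joins? : ∀ x y z → Dec (Joins x y z)
joins? (a , b , s) (c , d , s') (e , f , s'') = (a ≟F e) ×-dec ((b ≟F c) ×-dec ((d ≟F f) ×-dec (s'' Boolₚ.≟ s ∨ s')))

Composite : List Entry → List Entry → Entry → Set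
Composite M M' z = Any (λ x → Any (λ y → Joins x y z) M') M

composite? : ∀ M M' → Decidable (Composite M M')
composite? M M' z = Any.any? (λ x → Any.any? (λ y → joins? x y z) M') M

module Colours (G : PreProof) where
  open PreProof G public

  Edge : Set
  Edge = Σ (Fin size) λ i → Fin (length (prems i))

  src dst : Edge → Fin size
  src = proj₁
  dst (i , d) = child i d

  StepAt : Bool → Edge → Formula 0 → Formula 0 → Set
  StepAt true  (i , d) = Prog (rule i) d
  StepAt false (i , d) = Plain (rule i) d

  prog? : ∀ {S ps} (r : CycRule S ps) j τ τ' → Dec (Prog r j τ τ')
  prog? (inj₁ _) j τ τ' = no λ ()
  prog? (inj₂ (inj₁ _)) j τ τ' = no λ ()
  prog? (inj₂ (inj₂ (case φ s t z _ _ _ _ _))) j τ τ' =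
    (toℕ j ℕ.≟ 1) ×-dec ((τ ≟F RTC φ s t) ×-dec (τ' ≟F RTC φ s (fv z)))

  plain? : ∀ {S ps} (r : CycRule S ps) j τ τ' → Dec (Plain r j τ τ')
  plain? (inj₁ _) j τ τ' = τ ≟F τ'
  plain? (inj₂ (inj₁ (subst θ))) j τ τ' = τ ≟F fsubF θ τ'
  plain? (inj₂ (inj₂ _)) j τ τ' = τ ≟F τ'

  EdgeEntry : Edge → Entry → Set
  EdgeEntry e (τ , τ' , s) = τ ∈ ante (seq (src e)) × StepAt s e τ τ'

  edgeEntry? : ∀ e → Decidable (EdgeEntry e)
  edgeEntry? (i , d) (τ , τ' , true)  = Any.any? (τ ≟F_) _ ×-dec prog? (rule i) d τ τ'
  edgeEntry? (i , d) (τ , τ' , false) = Any.any? (τ ≟F_) _ ×-dec plain? (rule i) d τ τ'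

  pool : List (Formula 0)
  pool = concatMap (ante ∘ seq) (allFin size)

  pool⁺ : ∀ i {τ} → τ ∈ ante (seq i) → τ ∈ pool
  pool⁺ i m = ∈-concatMap⁺ (ante ∘ seq) (lose (∈-allFin i) m)

  entries : List Entry
  entries = cartesianProduct pool (cartesianProduct pool (true ∷ false ∷ []))

  entries⁺ : ∀ {τ τ'} s → τ ∈ pool → τ' ∈ pool → (τ , τ' , s) ∈ entries
  entries⁺ s i j = ∈-cartesianProduct⁺ i (∈-cartesianProduct⁺ j (bool s))
    where
    bool : ∀ s → s ∈ true ∷ false ∷ []
    bool true  = here refl
    bool false = there (here refl)

  entries⁻ : ∀ {τ τ' s} → (τ , τ' , s) ∈ entries → τ ∈ pool × τ' ∈ pool
  entries⁻ i = proj₁ (∈-cartesianProduct⁻ pool _ i) , proj₁ (∈-cartesianProduct⁻ pool _ (proj₂ (∈-cartesianProduct⁻ pool _ i)))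

  edgeColour : Edge → List Entry
  edgeColour e = filter (edgeEntry? e) entries

  _∙_ : List Entry → List Entry → List Entry
  M ∙ M' = filter (composite? M M') entries

  -- Routes are trees of compositions, mirroring how a colour arises by `∙`, so that associativity
  -- of `∙` is never called for.
  data Route : Fin size → Fin size → Set where
    edge : ∀ i d → Route i (child i d)
    comp : ∀ {i j k} → Route i j → Route j k → Route i k

  colour : ∀ {i j} → Route i j → List Entry
  colour (edge i d)   = edgeColour (i , d)
  colour (comp t₁ t₂) = colour t₁ ∙ colour t₂

  colour⊆entries : ∀ {i j} (t : Route i j) {x} → x ∈ colour t → x ∈ entries
  colour⊆entries (edge i d)   m = proj₁ (∈-filter⁻ (edgeEntry? (i , d)) {xs = entries} m)
  colour⊆entries (comp t₁ t₂) m = proj₁ (∈-filter⁻ (composite? (colour t₁) (colour t₂)) {xs = entries} m)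

  data Reach : Fin size → Set where
    here : Reach root
    via  : ∀ {i} → Route root i → Reach i

  extend : ∀ {i j} → Reach i → Route i j → Reach j
  extend here    t = via t
  extend (via p) t = via (comp p t)

  Colour : Set
  Colour = Fin size × Fin size × List Entry

  _≟C_ : DecidableEquality Colour
  _≟C_ = Productₚ.≡-dec Finₚ._≟_ (Productₚ.≡-dec Finₚ._≟_ (Listₚ.≡-dec
    (Productₚ.≡-dec _≟F_ (Productₚ.≡-dec _≟F_ Boolₚ._≟_))))

  edgesFrom : Fin size → List Colour
  edgesFrom i = map (λ d → i , child i d , edgeColour (i , d)) (allFin (length (prems i)))

  compose : Colour → Colour → List Colour
  compose (i , j , M) (j' , k , M') with j Finₚ.≟ j'
  ... | yes _ = (i , k , M ∙ M') ∷ []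
  ... | no  _ = []

  composites : List Colour → List Colour
  composites S = concatMap (λ x → concatMap (compose x) S) S

  -- Edges enter only at the root and at targets of colours already found: the trace condition
  -- concerns only paths from the root.
  gen : List Colour → List Colour
  gen S = edgesFrom root ++ (concatMap (λ x → edgesFrom (proj₁ (proj₂ x))) S ++ composites S)

  Realized : Colour → Set
  Realized (i , j , M) = Reach i × Σ (Route i j) λ t → colour t ≡ M

  private
    allColours : List Colour
    allColours = cartesianProduct (allFin size) (cartesianProduct (allFin size) (subsets entries))

    data GenCase (S : List Colour) : Colour → Set where
      edgeC : ∀ i d → i ≡ root ⊎ (Σ (Fin size) λ h → Σ (List Entry) λ M → (h , i , M) ∈ S) → GenCase S (i , child i d , edgeColour (i , d))
      compC : ∀ {i j k M M'} → (i , j , M) ∈ S → (j , k , M') ∈ S → GenCase S (i , k , M ∙ M')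

    edges⁻ : ∀ {S} i → i ≡ root ⊎ (Σ (Fin size) λ h → Σ (List Entry) λ M → (h , i , M) ∈ S) → ∀ {x} → x ∈ edgesFrom i → GenCase S x
    edges⁻ i r m with ∈-map⁻ _ m
    ... | d , _ , refl = edgeC i d r

    compose⁻ : ∀ {S} x y → x ∈ S → y ∈ S → ∀ {z} → z ∈ compose x y → GenCase S z
    compose⁻ (i , j , M) (j' , k , M') xi yi m with j Finₚ.≟ j'
    compose⁻ (i , j , M) (j , k , M') xi yi (here refl) | yes refl = compC xi yi

    gen⁻ : ∀ S {x} → x ∈ gen S → GenCase S x
    gen⁻ S m with ∈-++⁻ (edgesFrom root) m
    ... | inj₁ m₁ = edges⁻ root (inj₁ refl) m₁
    ... | inj₂ m₁ with ∈-++⁻ (concatMap (λ x → edgesFrom (proj₁ (proj₂ x))) S) m₁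
    ... | inj₁ m₂ with find (∈-concatMap⁻ (λ x → edgesFrom (proj₁ (proj₂ x))) {xs = S} m₂)
    ... | (h , i , M) , hS , m₃ = edges⁻ i (inj₂ (h , M , hS)) m₃
    gen⁻ S m | inj₂ m₁ | inj₂ m₂ with find (∈-concatMap⁻ (λ x → concatMap (compose x) S) {xs = S} m₂)
    ... | x , xS , m₃ with find (∈-concatMap⁻ (compose x) {xs = S} m₃)
    ... | y , yS , m₄ = compose⁻ x y xS yS m₄

    gen-real : ∀ S → (∀ {x} → x ∈ S → Realized x) → ∀ {x} → x ∈ gen S → Realized x
    gen-real S p m with gen⁻ S m
    ... | edgeC i d (inj₁ refl) = here , edge i d , refl
    ... | edgeC i d (inj₂ (h , M , hS)) = extend (proj₁ (p hS)) (proj₁ (proj₂ (p hS))) , edge i d , refl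
    ... | compC xS yS with p xS | p yS
    ... | r , t , refl | _ , t' , refl = r , comp t t' , refl

    gen-all : ∀ S {x} → x ∈ gen S → x ∈ allColours
    gen-all S m with gen⁻ S m
    ... | edgeC i d _ = ∈-cartesianProduct⁺ (∈-allFin i) (∈-cartesianProduct⁺ (∈-allFin (child i d)) (filter∈subsets _ entries))
    ... | compC {i} {j} {k} _ _ = ∈-cartesianProduct⁺ (∈-allFin i) (∈-cartesianProduct⁺ (∈-allFin k) (filter∈subsets _ entries))

    closed : Σ (List Colour) λ S → (∀ {x} → x ∈ S → Realized x) × (∀ {x} → x ∈ gen S → x ∈ S)
    closed = closure _≟C_ gen Realized gen-real allColours gen-all

  abstract
    colours : List Colour
    colours = proj₁ closed

    realized : ∀ {x} → x ∈ colours → Realized x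
    realized = proj₁ (proj₂ closed)

    private
      gen⊆ : ∀ {x} → x ∈ gen colours → x ∈ colours
      gen⊆ = proj₂ (proj₂ closed)

    colours-root : ∀ d → (root , child root d , edgeColour (root , d)) ∈ colours
    colours-root d = gen⊆ (∈-++⁺ˡ (∈-map⁺ _ (∈-allFin d)))

    colours-edge : ∀ {h i M} → (h , i , M) ∈ colours → ∀ d → (i , child i d , edgeColour (i , d)) ∈ colours
    colours-edge m d = gen⊆ (∈-++⁺ʳ (edgesFrom root) (∈-++⁺ˡ (∈-concatMap⁺ (λ x → edgesFrom (proj₁ (proj₂ x))) (lose m (∈-map⁺ _ (∈-allFin d))))))

    colours-comp : ∀ {i j k M M'} → (i , j , M) ∈ colours → (j , k , M') ∈ colours → (i , k , M ∙ M') ∈ colours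
    colours-comp {i} {j} {k} {M} {M'} m m' = gen⊆ (∈-++⁺ʳ (edgesFrom root) (∈-++⁺ʳ (concatMap (λ x → edgesFrom (proj₁ (proj₂ x))) colours)
      (∈-concatMap⁺ (λ x → concatMap (compose x) colours) (lose m (∈-concatMap⁺ (compose (i , j , M)) (lose m' comp∈))))))
      where
      comp∈ : (i , k , M ∙ M') ∈ compose (i , j , M) (j , k , M')
      comp∈ with j Finₚ.≟ j
      ... | yes _ = here refl
      ... | no ne = ⊥-elim (ne refl)

-- The trace condition on lassos

module Lasso (G : PreProof) (global : PreProof.GlobalTrace G) where
  open Colours G

  len : ∀ {i j} → Route i j → ℕ
  len (edge _ _)   = 1
  len (comp t₁ t₂) = len t₁ ℕ.+ len t₂

  len>0 : ∀ {i j} (t : Route i j) → 1 ≤ len t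
  len>0 (edge _ _)   = s≤s z≤n
  len>0 (comp t₁ t₂) = ℕₚ.≤-trans (len>0 t₁) (ℕₚ.m≤m+n _ _)

  first : ∀ {i j} → Route i j → Edge
  first (edge i d)   = i , d
  first (comp t₁ t₂) = first t₁

  first-src : ∀ {i j} (t : Route i j) → src (first t) ≡ i
  first-src (edge i d)   = refl
  first-src (comp t₁ t₂) = first-src t₁

  -- `r` is what comes after the route. Splitting off the first edge makes every word visibly
  -- nonempty, so that `go` can start over forever.
  rest : ∀ {i j} → Route i j → List Edge → List Edge
  rest (edge i d)   r = r
  rest (comp t₁ t₂) r = rest t₁ (first t₂ ∷ rest t₂ r)

  word : ∀ {i j} → Route i j → List Edge → List Edge
  word t r = first t ∷ rest t r

  data Walk : Fin size → List Edge → Fin size → Set where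
    nil  : ∀ {c} → Walk c [] c
    cons : ∀ {c i d l} → Walk (child i d) l c → Walk i ((i , d) ∷ l) c

  wordWalk : ∀ {i j c} (t : Route i j) {r} → Walk j r c → Walk i (word t r) c
  wordWalk (edge i d)   u = cons u
  wordWalk (comp t₁ t₂) u = wordWalk t₁ (wordWalk t₂ u)

  module Loop {c : Fin size} (reach : Reach c) (t : Route c c) where

    -- The edges of the infinite path that follows l and then t forever.
    go : List Edge → ℕ → Edge
    go []      zero    = first t
    go []      (suc n) = go (rest t []) n
    go (e ∷ l) zero    = e
    go (e ∷ l) (suc n) = go l n

    unroll : ∀ k → go [] k ≡ go (word t []) k
    unroll zero    = refl
    unroll (suc k) = refl

    go-src : ∀ {i l} → Walk i l c → src (go l 0) ≡ i
    go-src nil      = first-src t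
    go-src (cons _) = refl

    go-next : ∀ {i l} → Walk i l c → ∀ n → src (go l (suc n)) ≡ dst (go l n)
    -- At the end of the list a whole copy of `t` is unrolled; `lemma` consumes an edge, so the
    -- recursion is on `n`.
    go-next nil n = ≡.trans (cong src (unroll (suc n))) (≡.trans (lemma (wordWalk t nil) n) (cong dst (sym (unroll n))))
      where
      lemma : ∀ {i e l} → Walk i (e ∷ l) c → ∀ n → src (go (e ∷ l) (suc n)) ≡ dst (go (e ∷ l) n)
      lemma (cons u) zero    = go-src u
      lemma (cons u) (suc n) = go-next u n
    go-next (cons u) zero    = go-src u
    go-next (cons u) (suc n) = go-next u n

    startOf : Reach c → List Edge
    startOf here    = []
    startOf (via p) = word p []

    startWalkOf : ∀ r → Walk root (startOf r) c
    startWalkOf here    = nil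
    startWalkOf (via p) = wordWalk p nil

    startWalk : Walk root (startOf reach) c
    startWalk = startWalkOf reach

    nd : ℕ → Edge
    nd = go (startOf reach)

    path : Path
    path = record { node = src ∘ nd ; dir = proj₂ ∘ nd ; start = go-src startWalk ; next = go-next startWalk }

    Looping : (ℕ → Edge) → ℕ → Set
    Looping f q = ∀ k → f (q ℕ.+ k) ≡ go [] k

    Follows : (ℕ → Edge) → ∀ {i j} → Route i j → ℕ → Set
    Follows f (edge i d)   q = f q ≡ (i , d)
    Follows f (comp t₁ t₂) q = Follows f t₁ q × Follows f t₂ (q ℕ.+ len t₁)

    follows : ∀ f {i j} (t : Route i j) {r} q → (∀ k → f (q ℕ.+ k) ≡ go (word t r) k) →
              Follows f t q × (∀ k → f (q ℕ.+ len t ℕ.+ k) ≡ go r k)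
    follows f (edge i d) q e = ≡.trans (cong f (sym (ℕₚ.+-identityʳ q))) (e 0) ,
      λ k → ≡.trans (cong f (ℕₚ.+-assoc q 1 k)) (e (suc k))
    follows f (comp t₁ t₂) q e with follows f t₁ q e
    ... | f₁ , e₁ with follows f t₂ (q ℕ.+ len t₁) e₁
    ... | f₂ , e₂ = (f₁ , f₂) , λ k → ≡.trans (cong (λ x → f (x ℕ.+ k)) (sym (ℕₚ.+-assoc q (len t₁) (len t₂)))) (e₂ k)

    looping : ∀ f q → Looping f q → Follows f t q × Looping f (q ℕ.+ len t)
    looping f q lp = follows f t q (λ k → ≡.trans (lp k) (unroll k))

    private
      enter : ∀ r → Σ ℕ (Looping (go (startOf r)))
      enter here    = 0 , λ _ → refl
      enter (via p) = len p , proj₂ (follows (go (word p [])) p 0 (λ _ → refl))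

      -- The trace begins at an unknown position, beyond which a start of the loop is needed.
      late : ∀ m → Σ ℕ λ q → m ≤ q × Looping nd q
      late zero = proj₁ (enter reach) , z≤n , proj₂ (enter reach)
      late (suc m) with late m
      ... | q , m≤q , lp = q ℕ.+ len t , ≡.subst (_≤ q ℕ.+ len t) (ℕₚ.+-comm m 1) (ℕₚ.+-mono-≤ m≤q (len>0 t)) , proj₂ (looping nd q lp)

      m₀ : ℕ
      m₀ = proj₁ (global path)

      τ : ℕ → Formula 0
      τ = proj₁ (proj₂ (global path))

      f : ℕ → Edge
      f n = nd (m₀ ℕ.+ n)

      τ-mem : ∀ n → τ n ∈ ante (seq (src (f n)))
      τ-mem = proj₁ (proj₂ (proj₂ (proj₂ (global path))))

      ProgAt PlainAt : ℕ → Set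
      ProgAt n = StepAt true (f n) (τ n) (τ (suc n))
      PlainAt n = StepAt false (f n) (τ n) (τ (suc n))

      τ-step : ∀ n → ProgAt n ⊎ PlainAt n
      τ-step = proj₁ (proj₂ (proj₂ (proj₂ (proj₂ (global path)))))

      τ-prog : ∀ n → Σ ℕ λ k → n ≤ k × ProgAt k
      τ-prog = proj₂ (proj₂ (proj₂ (proj₂ (proj₂ (global path)))))

      τ-pool : ∀ n → τ n ∈ pool
      τ-pool n = pool⁺ _ (τ-mem n)

      -- Progress is tested for, whichever disjunct the trace offers for this step; so the flag is
      -- true whenever the trace progresses.
      edge-entry : ∀ {e a b} → (StepAt true e a b ⊎ StepAt false e a b) → a ∈ ante (seq (src e)) → a ∈ pool → b ∈ pool →
                   Σ Bool λ s → (a , b , s) ∈ edgeColour e × (StepAt true e a b → s ≡ true)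
      edge-entry {e@(i , d)} {a} {b} st ma pa pb with prog? (rule i) d a b
      ... | yes p = true , ∈-filter⁺ (edgeEntry? e) (entries⁺ true pa pb) (ma , p) , λ _ → refl
      ... | no np with st
      ... | inj₁ p = ⊥-elim (np p)
      ... | inj₂ p = false , ∈-filter⁺ (edgeEntry? e) (entries⁺ false pa pb) (ma , p) , λ p' → ⊥-elim (np p')

      entry : ∀ {i j} (t : Route i j) q → Follows f t q → Σ Bool λ s → (τ q , τ (q ℕ.+ len t) , s) ∈ colour t ×
              (∀ k → q ≤ k → k < q ℕ.+ len t → ProgAt k → s ≡ true)
      entry (edge i d) q e with edge-entry {f q} (τ-step q) (τ-mem q) (τ-pool q) (τ-pool (suc q))
      ... | s , mem , pr = s , ≡.subst₂ (λ x y → (τ q , τ x , s) ∈ edgeColour y) (sym (ℕₚ.+-comm q 1)) e mem ,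
        λ k q≤k k<q p → pr (≡.subst ProgAt (ℕₚ.≤-antisym (ℕₚ.≤-pred (≡.subst (k <_) (ℕₚ.+-comm q 1) k<q)) q≤k) p)
      entry (comp t₁ t₂) q (f₁ , f₂) with entry t₁ q f₁ | entry t₂ (q ℕ.+ len t₁) f₂
      ... | s , m₁ , p₁ | s' , m₂ , p₂ = s ∨ s' , ≡.subst (λ x → (τ q , τ x , s ∨ s') ∈ colour (comp t₁ t₂)) assoc
          (∈-filter⁺ (composite? (colour t₁) (colour t₂)) (entries⁺ (s ∨ s') (τ-pool _) (τ-pool _))
            (lose m₁ (lose m₂ (refl , refl , refl , refl)))) , strict
        where
        assoc = ℕₚ.+-assoc q (len t₁) (len t₂)
        strict : ∀ k → q ≤ k → k < q ℕ.+ len (comp t₁ t₂) → ProgAt k → s ∨ s' ≡ true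
        strict k q≤k k< p with k ℕ.<? q ℕ.+ len t₁
        ... | yes k<₁ = ∨-trueˡ (p₁ k q≤k k<₁ p)
        ... | no k≮₁  = ∨-trueʳ {s} (p₂ k (ℕₚ.≮⇒≥ k≮₁) (≡.subst (k <_) (sym assoc) k<) p)

      -- A traversal has length at least 1, so n + 1 of them lead beyond position q + n.
      chainFrom : ∀ n q → Looping f q → Σ ℕ λ q' → q ℕ.+ n < q' × Looping f q' × Σ Bool λ s → Chain (colour t) s (τ q) (τ q') ×
                  (∀ k → q ≤ k → k < q' → ProgAt k → s ≡ true)
      chainFrom zero q lp with looping f q lp
      ... | fo , lp' with entry t q fo
      ... | s , mem , p = q ℕ.+ len t , ≡.subst (_≤ q ℕ.+ len t) (ℕₚ.+-suc q 0) (ℕₚ.+-monoʳ-≤ q (len>0 t)) , lp' , s , one mem , p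
      chainFrom (suc n) q lp with looping f q lp
      ... | fo , lp' with entry t q fo | chainFrom n (q ℕ.+ len t) lp'
      ... | s , mem , p | q' , l , lp'' , s' , ch , p' = q' ,
          ℕₚ.≤-<-trans (≡.subst (_≤ q ℕ.+ len t ℕ.+ n) (≡.trans (ℕₚ.+-assoc q 1 n) refl) (ℕₚ.+-monoˡ-≤ n (ℕₚ.+-monoʳ-≤ q (len>0 t)))) l ,
          lp'' , s ∨ s' , more mem ch , strict
        where
        strict : ∀ k → q ≤ k → k < q' → ProgAt k → s ∨ s' ≡ true
        strict k q≤k k< pr with k ℕ.<? q ℕ.+ len t
        ... | yes k<₁ = ∨-trueˡ (p k q≤k k<₁ pr)
        ... | no k≮₁  = ∨-trueʳ {s} (p' k (ℕₚ.≮⇒≥ k≮₁) k< pr)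

      strictFrom : ∀ q → Looping f q → Σ ℕ λ q' → Looping f q' × Chain (colour t) true (τ q) (τ q')
      strictFrom q lp with τ-prog q
      -- The count `k` is generous: the chain ends beyond q + k, hence beyond the progress point
      -- `k`.
      ... | k , q≤k , p with chainFrom k q lp
      ... | q' , l , lp' , s , ch , st with st k q≤k (ℕₚ.≤-<-trans (ℕₚ.m≤n+m k q) l) p
      ... | refl = q' , lp' , ch

      points : ℕ → Σ ℕ (Looping f)
      points zero with late m₀
      ... | q , m≤q , lp = q ℕ.∸ m₀ , λ k → ≡.trans (cong nd (≡.trans (sym (ℕₚ.+-assoc m₀ (q ℕ.∸ m₀) k)) (cong (ℕ._+ k) (ℕₚ.m+[n∸m]≡n m≤q)))) (lp k)
      points (suc n) = proj₁ (strictFrom _ (proj₂ (points n))) , proj₁ (proj₂ (strictFrom _ (proj₂ (points n))))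

      σ : ℕ → Formula 0
      σ n = τ (proj₁ (points n))

      σ-chain : ∀ i d → Chain (colour t) true (σ i) (σ (suc d ℕ.+ i))
      σ-chain i zero    = proj₂ (proj₂ (strictFrom _ (proj₂ (points i))))
      σ-chain i (suc d) = chain-++ (σ-chain i d) (proj₂ (proj₂ (strictFrom _ (proj₂ (points (suc d ℕ.+ i))))))

      σ-pool : ∀ n → σ n ∈ pool
      σ-pool n = τ-pool _

    -- The formulas at the chosen points all lie in the finite `pool`, so two points share one; the
    -- progressing chain between these is cyclic.
    loopChain : Σ (Formula 0) λ σ → σ ∈ pool × Chain (colour t) true σ σ
    loopChain with Finₚ.pigeonhole (ℕₚ.n<1+n (length pool)) (λ n → Any.index (σ-pool (toℕ n)))
    ... | i , j , i<j , same = σ (toℕ i) , σ-pool (toℕ i) , ≡.subst (Chain (colour t) true (σ (toℕ i))) (sym eq)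
          (≡.subst (λ x → Chain (colour t) true (σ (toℕ i)) (σ x)) sum (σ-chain (toℕ i) (toℕ j ℕ.∸ suc (toℕ i))))
      where
      sum : suc (toℕ j ℕ.∸ suc (toℕ i)) ℕ.+ toℕ i ≡ toℕ j
      sum = ≡.trans (sym (ℕₚ.+-suc (toℕ j ℕ.∸ suc (toℕ i)) (toℕ i))) (ℕₚ.m∸n+n≡m i<j)
      eq : σ (toℕ i) ≡ σ (toℕ j)
      eq = ≡.trans (Anyₚ.lookup-index (σ-pool (toℕ i))) (≡.trans (cong (lookup pool) same) (sym (Anyₚ.lookup-index (σ-pool (toℕ j)))))

-- From cyclic proofs to induction

-- Reduces a sequent to the refutation of its antecedent together with the negated succedent. `Δ*`
-- stays fixed while `Δ` is used up.
moveRight : ∀ {Γ Δ*} Δ → Δ ⊆ Δ* → RTCG+A⊢ (map `¬_ Δ ++ Γ ⇒ Δ*) → RTCG+A⊢ (Γ ⇒ Δ*)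
moveRight []      sub d = d
moveRight (δ ∷ Δ) sub d = moveRight Δ (sub ∘ there) (base (cut (`¬ δ))
  (base ¬R (weaken (λ { (here refl) → here refl }) (λ { (here refl) → sub (here refl) }) (base ax []) ∷ []) ∷ d ∷ []))

module FromCyclic (G : PreProof) (global : PreProof.GlobalTrace G) where
  open Colours G
  open Lasso G global

  nodeFormulas : Fin size → List (Formula 0)
  nodeFormulas i = ante (seq i) ++ Seq.succ (seq i)

  D : ℕ
  D = supL (concatMap nodeFormulas (allFin size))

  node-sup : ∀ i {φ} → φ ∈ nodeFormulas i → supF φ ≤ D
  node-sup i m = sup-mem (∈-concatMap⁺ nodeFormulas (lose (∈-allFin i) m))

  pool-sup : ∀ {τ} → τ ∈ pool → supF τ ≤ D
  pool-sup m with find (∈-concatMap⁻ (ante ∘ seq) {xs = allFin size} m)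
  ... | i , _ , k = node-sup i (∈-++⁺ˡ k)

  open States D

  D' : ℕ
  D' = suc D

  relOf : Colour → Formula (D' ℕ.+ D')
  relOf (i , j , M) = Rel (toℕ i) (toℕ j) M

  Rs : List (Formula (D' ℕ.+ D'))
  Rs = map relOf colours

  T* : Formula (D' ℕ.+ D')
  T* = orL Rs

  small : ∀ {i j M} → (i , j , M) ∈ colours → Small M
  small m k with realized m
  ... | _ , t , refl = pool-sup (proj₂ (entries⁻ (colour⊆entries t k)))

  -- A colour between distinct nodes cannot be iterated; for one at a single node the trace
  -- condition supplies the chain.
  wfColour : ∀ {i j M} → (i , j , M) ∈ colours → Wf (relOf (i , j , M))
  wfColour {i} {j} {M} m with i Finₚ.≟ j
  ... | no ne = wfCross (toℕ i) (toℕ j) M (small m) (ne ∘ Finₚ.toℕ-injective)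
  ... | yes refl with realized m
  ... | r , t , refl with Loop.loopChain r t
  ... | σ , p , c = wfLoop (toℕ i) (toℕ i) _ (small m) (pool-sup p) c

  -- If the colours do not meet, the middle state would carry two node numbers; if they do, their
  -- composite is again in the list.
  rel-trans : ∀ {Γ} x y → x ∈ colours → y ∈ colours → ∀ a b c →
              Γ ⊩ At₂ (relOf x) a b → Γ ⊩ At₂ (relOf y) b c → Γ ⊩ At₂ T* a c
  rel-trans (i , j , M) (j' , k , M') xm ym a b c d e with j Finₚ.≟ j'
  ... | no ne = botE (num≢ (toℕ j) (toℕ j') (ne ∘ Finₚ.toℕ-injective) (eqTrans (eqSym (relTgt (toℕ i) (toℕ j) M (small xm) a b d)) (relSrc (toℕ j') (toℕ k) M' (small ym) b c e)))
  ... | yes refl = orI (c ⊕ a) (∈-map⁺ relOf (colours-comp xm ym))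
      (relI (toℕ i) (toℕ k) (M ∙ M') (small (colours-comp xm ym)) a c (relSrc (toℕ i) (toℕ j) M (small xm) a b d) (relTgt (toℕ j) (toℕ k) M' (small ym) b c e) λ {τ} {τ'} {s} → go {τ} {τ'} {s})
    where
    go : ∀ {τ τ' s} → (τ , τ' , s) ∈ M ∙ M' → _ ⊩ Dom s (val a τ) (val c τ')
    go {τ} {τ'} m with find (proj₂ (∈-filter⁻ (composite? M M') {xs = entries} m))
    ... | (_ , σ , s₁) , m₁ , n with find n
    ... | (_ , _ , s₂) , m₂ , refl , refl , refl , refl =
      domTrans {X = val a τ} {Y = val b σ} {Z = val c τ'} s₁ s₂ (relDom (toℕ i) (toℕ j) M (small xm) a b m₁ d) (relDom (toℕ j) (toℕ k) M' (small ym) b c m₂ e)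

  T-trans : ∀ {Γ} a b c → Γ ⊩ At₂ T* a b → Γ ⊩ At₂ T* b c → Γ ⊩ At₂ T* a c
  T-trans {Γ} a b c d e = orE Rs (b ⊕ a) d λ R r → orE Rs (c ⊕ b) (w e) λ R' r' → step R r R' r'
    where
    step : ∀ R → R ∈ Rs → ∀ R' → R' ∈ Rs → At₂ R' b c ∷ At₂ R a b ∷ Γ ⊩ At₂ T* a c
    step R r R' r' with ∈-map⁻ relOf r | ∈-map⁻ relOf r'
    ... | x , xm , refl | y , ym , refl = rel-trans x y xm ym a b c h1 h0

  wfs : All Wf Rs
  wfs = All.tabulate go
    where
    go : ∀ {R} → R ∈ Rs → Wf R
    go r with ∈-map⁻ relOf r
    ... | (i , j , M) , m , refl = wfColour m

  assign : State D' → ℕ → Term 0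
  assign b x = pick b (suc x)

  nodeL : Fin size → List (Formula 0)
  nodeL i = (fv 0 `= num (toℕ i)) ∷ map new (ante (seq i)) ++ map (`¬_ ∘ new) (Seq.succ (seq i))

  atNode : Fin size → Formula D'
  atNode i = bind (andL (nodeL i))

  module _ {Γ : List (Formula 0)} (i : Fin size) (b : State D') where
    private
      numEq : fsubF (pick b) (fv 0 `= num (toℕ i)) ≡ (b zero `= num (toℕ i))
      numEq = cong₂ _`=_ (wk0-id (b zero)) (fsubT-num _ (toℕ i))

    atNodeI : Γ ⊩ b zero `= num (toℕ i) → Bad (seq i) Γ (assign b) → Γ ⊩ substF b (atNode i)
    atNodeI d (bad l r) = coe (sym (bind-at b (andL (nodeL i)))) (andI (nodeL i) (pick b) go)
      where
      go : ∀ φ → φ ∈ nodeL i → Γ ⊩ fsubF (pick b) φ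
      go _ (here refl) = coe (sym numEq) d
      go φ (there k) with ∈-++⁻ (map new (ante (seq i))) k
      ... | inj₁ k' with ∈-map⁻ new k'
      ... | γ , m , refl = coe (sym (val-new b γ)) (l m)
      go φ (there k) | inj₂ k' with ∈-map⁻ (`¬_ ∘ new) k'
      ... | δ , m , refl = coe (cong `¬_ (sym (val-new b δ))) (r m)

    atNodeE : Γ ⊩ substF b (atNode i) → Γ ⊩ b zero `= num (toℕ i) × Bad (seq i) Γ (assign b)
    atNodeE d = coe numEq (get (here refl)) , bad
        (λ {γ} m → coe (val-new b γ) (get (there (∈-++⁺ˡ (∈-map⁺ new m)))))
        (λ {δ} m → coe (cong `¬_ (val-new b δ)) (get (there (∈-++⁺ʳ (map new (ante (seq i))) (∈-map⁺ (`¬_ ∘ new) m)))))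
      where
      get : ∀ {φ} → φ ∈ nodeL i → Γ ⊩ fsubF (pick b) φ
      get m = andE (pick b) m (coe (bind-at b (andL (nodeL i))) d)

  active : List (Fin size)
  active = root ∷ map (proj₁ ∘ proj₂) colours

  edge∈ : ∀ {i} → i ∈ active → ∀ d → (i , child i d , edgeColour (i , d)) ∈ colours
  edge∈ (here refl) d = colours-root d
  edge∈ (there k) d with ∈-map⁻ (proj₁ ∘ proj₂) k
  ... | x , m , refl = colours-edge m d

  -- The falsified states. A falsified root sequent provides an element, and local soundness shows
  -- that none is `T*`-minimal.
  P : Formula D'
  P = orL (map atNode active)

  state : Fin size → (ℕ → Term 0) → State D'
  state i θ = num (toℕ i) ◂ (θ ∘ toℕ)

  pick-toℕ : ∀ {n} (θ : ℕ → Term 0) {x} → x < n → pick {n} (θ ∘ toℕ) x ≡ θ x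
  pick-toℕ θ {zero}  (s≤s l) = refl
  pick-toℕ θ {suc x} (s≤s l) = pick-toℕ (θ ∘ suc) l

  assign-state : ∀ i θ (φ : Formula 0) → supF φ ≤ D → fsubF (assign (state i θ)) φ ≡ fsubF θ φ
  assign-state i θ φ l = fsubF-cong φ λ x o → pick-toℕ θ (ℕₚ.≤-trans (occF-sup x φ o) l)

  bad-state : ∀ i {Γ θ} → Bad (seq i) Γ θ → Bad (seq i) Γ (assign (state i θ))
  bad-state i {θ = θ} (bad l r) = bad (λ {γ} m → coe (sym (assign-state i θ γ (node-sup i (∈-++⁺ˡ m)))) (l m))
    (λ {δ} m → coe (cong `¬_ (sym (assign-state i θ δ (node-sup i (∈-++⁺ʳ (ante (seq i)) m))))) (r m))

  noMin : ∀ {Γ} → NoMin Γ P T*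
  noMin {Γ} b = orE (map atNode active) b h0 go
    where
    go : ∀ φ → φ ∈ map atNode active → substF b φ ∷ substF b P ∷ Γ ⊩ substF b (Succ P T*)
    go φ k with ∈-map⁻ atNode k
    -- `descend` refutes and does not exhibit a premise, so the successor is obtained by
    -- contradiction.
    ... | i , act , refl = raa (descend (rule i) (proj₂ (atNodeE i b h1)) λ j {Γ'} θ' sub bd link →
        ¬E (mono sub h0) (succI P T* b (next j θ')
          (orI (next j θ') (∈-map⁺ atNode (child-active j))
            (atNodeI (child i j) (next j θ') eqR (bad-state (child i j) (≡.subst (λ S → Bad S Γ' θ') (sym (childOK i j)) bd))))
          (orI (next j θ' ⊕ b) (∈-map⁺ relOf (edge∈ act j)) (relI (toℕ i) (toℕ (child i j)) (edgeColour (i , j)) (small (edge∈ act j)) b (next j θ')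
            (proj₁ (atNodeE i b (mono sub h1))) eqR (λ {τ} {τ'} {s} → linked j sub link τ τ' s)))))
      where
      next : Fin (length (prems i)) → (ℕ → Term 0) → State D'
      next j θ' = state (child i j) θ'
      child-active : ∀ j → child i j ∈ active
      child-active j = there (∈-map⁺ (proj₁ ∘ proj₂) (edge∈ act j))
      linked : ∀ j {Γ' θ'} → (`¬ substF b (Succ P T*)) ∷ substF b (atNode i) ∷ substF b P ∷ Γ ⊆ Γ' → Link (rule i) j Γ' (assign b) θ' →
               ∀ τ τ' s → (τ , τ' , s) ∈ edgeColour (i , j) → Γ' ⊩ Dom s (val b τ) (val (next j θ') τ')
      linked j {Γ'} {θ'} sub link τ τ' s m with ∈-filter⁻ (edgeEntry? (i , j)) {xs = entries} m
      linked j {Γ'} {θ'} sub link τ τ' s m | me , ma , st =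
        ≡.subst (λ X → Γ' ⊩ Dom s (val b τ) X) (sym (assign-state (child i j) θ' τ' (pool-sup (proj₂ (entries⁻ me))))) (by-step s st)
        where
        by-step : ∀ s → StepAt s (i , j) τ τ' → Γ' ⊩ Dom s (val b τ) (fsubF θ' τ')
        by-step true  st = proj₂ (link ma) st
        by-step false st = ≡.subst (λ X → Γ' ⊩ Dom false (val b τ) X) (proj₁ (link ma) st)
          (domRefl {X = val b τ} (ranked (val b τ) (Bad.trueL (proj₂ (atNodeE i b (mono sub h1))) ma)))

  -- `T*` is the disjunction of the relations, so it is trivially covered; the content lies in its
  -- transitivity.
  refute : ∀ {Γ} b → substF b P ∷ Γ ⊩ bot
  refute = wfUnion T* T-trans Rs wfs (λ r a b → orI (b ⊕ a) r) P noMin (λ _ _ → h2)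

  provable : RTCG+A⊢ seq root
  provable = moveRight Δ₀ id (weaken id (λ ()) (noRHS (cutI rootBad (refute b₀))))
    where
    Γ₀ = ante (seq root)
    Δ₀ = Seq.succ (seq root)
    b₀ : State D'
    b₀ = state root fv
    bad₀ : Bad (seq root) (map `¬_ Δ₀ ++ Γ₀) fv
    bad₀ = bad (λ {γ} m → coe (sym (fsubF-id γ)) (hyp (∈-++⁺ʳ (map `¬_ Δ₀) m)))
               (λ {δ} m → coe (cong `¬_ (sym (fsubF-id δ))) (hyp (∈-++⁺ˡ (∈-map⁺ `¬_ m))))
    rootBad : map `¬_ Δ₀ ++ Γ₀ ⊩ substF b₀ P
    rootBad = orI {φ = atNode root} {map atNode active} b₀ (here refl) (atNodeI root b₀ eqR (bad-state root bad₀))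

-- From induction to cyclic proofs

-- The outer variable is the point already reached, the inner one its `φ`-successor.
stepBody : Formula 1 → Formula 2 → Formula 2
stepBody ψ φ = substF (λ _ → bv (suc zero)) ψ `→ (at2 φ (bv (suc zero)) (bv zero) `→ substF (λ _ → bv zero) ψ)

stepBody₁ : Formula 1 → Formula 2 → Term 0 → Formula 1
stepBody₁ ψ φ a = substF (liftS (σ1 a)) (stepBody ψ φ)

Hereditary : Formula 1 → Formula 2 → Formula 0
Hereditary ψ φ = `∀ (`∀ (stepBody ψ φ))

stepInst : ∀ ψ φ a b → inst1 (stepBody₁ ψ φ a) b ≡ (inst1 ψ a `→ (inst2 φ a b `→ inst1 ψ b))
stepInst ψ φ a b = ≡.trans (inst1-lift (σ1 a) (stepBody ψ φ) b) (cong₃ (λ x y z → x `→ (y `→ z))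
  (≡.trans (substF-substF (b ◂ σ1 a) _ ψ) (substF-≗ ψ λ { zero → refl }))
  (≡.trans (substF-at2 (b ◂ σ1 a) φ (bv (suc zero)) (bv zero)) (sym (at2-inst φ a b)))
  (≡.trans (substF-substF (b ◂ σ1 a) _ ψ) (substF-≗ ψ λ { zero → refl })))

module IndLoop (ψ : Formula 1) (φ : Formula 2) (s : Term 0) where

  Γ₀ : List (Formula 0)
  Γ₀ = inst1 ψ s ∷ Hereditary ψ φ ∷ []

  -- Substituting for `x₀` must change the end point only, so `x₀` lies beyond all names of the
  -- parameters; `z₀` also avoids `x₀` and `ψ(x₀)`, as (Case) demands.
  x₀ z₀ : ℕ
  x₀ = supF ψ ⊔ (supF φ ⊔ (supT s ⊔ supL Γ₀))
  z₀ = suc x₀ ⊔ supF (inst1 ψ (fv x₀))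

  Δ₀ : List (Formula 0)
  Δ₀ = inst1 ψ (fv x₀) ∷ []

  -- The cycle: (Case) leads from `root` to `left` and `right`; a cut on `ψ(z₀)` splits `right` into
  -- `cutL` and `cutR`; `cutL` is weakened to the instance of `root` at `z₀`, and (Subst) returns to
  -- `root`. `left` and `cutR` have finite proofs.
  root left right cutL : Seq
  root  = RTC φ s (fv x₀) ∷ Γ₀ ⇒ Δ₀
  left  = (s `= fv x₀) ∷ Γ₀ ⇒ Δ₀
  right = RTC φ s (fv z₀) ∷ inst2 φ (fv z₀) (fv x₀) ∷ Γ₀ ⇒ Δ₀
  cutL  = RTC φ s (fv z₀) ∷ inst2 φ (fv z₀) (fv x₀) ∷ Γ₀ ⇒ inst1 ψ (fv z₀) ∷ Δ₀

  cutR : Seq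
  cutR = inst1 ψ (fv z₀) ∷ RTC φ s (fv z₀) ∷ inst2 φ (fv z₀) (fv x₀) ∷ Γ₀ ⇒ Δ₀

  inst : Term 0 → Seq
  inst t = map (fsubF (single x₀ t)) (RTC φ s (fv x₀) ∷ Γ₀) ⇒ map (fsubF (single x₀ t)) Δ₀

  x<z : x₀ < z₀
  x<z = ℕₚ.m≤m⊔n (suc x₀) (supF (inst1 ψ (fv x₀)))
  x≤z : x₀ ≤ z₀
  x≤z = ℕₚ.<⇒≤ x<z
  ψ≤ : supF ψ ≤ x₀
  ψ≤ = ℕₚ.m≤m⊔n (supF ψ) _
  φ≤ : supF φ ≤ x₀
  φ≤ = ≤⊔ʳ (supF ψ) (ℕₚ.m≤m⊔n (supF φ) _)
  s≤ : supT s ≤ x₀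
  s≤ = ≤⊔ʳ (supF ψ) (≤⊔ʳ (supF φ) (ℕₚ.m≤m⊔n (supT s) (supL Γ₀)))
  Γ≤ : supL Γ₀ ≤ x₀
  Γ≤ = ≤⊔ʳ (supF ψ) (≤⊔ʳ (supF φ) (ℕₚ.m≤n⊔m (supT s) (supL Γ₀)))

  caseRule : CaseRule root (left ∷ right ∷ [])
  caseRule = case φ s (fv x₀) z₀ (freshL z₀ Γ₀ (ℕₚ.≤-trans Γ≤ x≤z)) (freshF z₀ (inst1 ψ (fv x₀)) (ℕₚ.m≤n⊔m (suc x₀) (supF (inst1 ψ (fv x₀)))) ∷ [])
    (freshF z₀ φ (ℕₚ.≤-trans φ≤ x≤z)) (freshT z₀ s (ℕₚ.≤-trans s≤ x≤z)) (freshT {n = 0} z₀ (fv x₀) x<z)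

  singleF : ∀ {n} t (χ : Formula n) → supF χ ≤ x₀ → fsubF (single x₀ t) χ ≡ χ
  singleF t χ l = ≡.trans (upd-fresh fv x₀ t {χ} (freshF x₀ χ l)) (fsubF-id χ)

  singleVar : ∀ t → fsubT (single x₀ t) (fv x₀) ≡ t
  singleVar t = ≡.trans (wk0-id _) (single-self x₀ t)

  instRTC : ∀ t → fsubF (single x₀ t) (RTC φ s (fv x₀)) ≡ RTC φ s t
  instRTC t = cong₃ RTC (singleF t φ φ≤) (≡.trans (upd-freshT fv x₀ t {s} (freshT x₀ s s≤)) (fsubT-id s)) (singleVar t)

  instψ : ∀ t → fsubF (single x₀ t) (inst1 ψ (fv x₀)) ≡ inst1 ψ t
  instψ t = ≡.trans (fsubF-inst1 _ ψ (fv x₀)) (cong₂ inst1 (singleF t ψ ψ≤) (singleVar t))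

  -- Serves twice: at `z₀` to close the cycle, and at an arbitrary end point to apply the finished
  -- loop.
  wkInst : ∀ t {Γ' Δ'} → RTC φ s t ∷ Γ₀ ⊆ Γ' → inst1 ψ t ∈ Δ' → BaseRule (Γ' ⇒ Δ') (inst t ∷ [])
  wkInst t {Γ'} {Δ'} sub m = wk left⊆ (λ { (here refl) → ≡.subst (_∈ Δ') (sym (instψ t)) m })
    where
    left⊆ : map (fsubF (single x₀ t)) (RTC φ s (fv x₀) ∷ Γ₀) ⊆ Γ'
    left⊆ (here refl) = ≡.subst (_∈ Γ') (sym (instRTC t)) (sub (here refl))
    left⊆ (there (here refl)) = ≡.subst (_∈ Γ') (sym (singleF t (inst1 ψ s) (ℕₚ.≤-trans (sup-mem {Γ = Γ₀} (here refl)) Γ≤))) (sub (there (here refl)))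
    left⊆ (there (there (here refl))) = ≡.subst (_∈ Γ') (sym (singleF t (Hereditary ψ φ) (ℕₚ.≤-trans (sup-mem {Γ = Γ₀} (there (here refl))) Γ≤))) (sub (there (there (here refl))))

-- Finite trees of LK-rules; in trees of kind true the leaves may also be closed by a loop proving an instance of induction.
data Tree : Bool → Seq → Set where
  infer : ∀ {b S ps} → BaseRule S ps ⊎ SubstRule S ps → All (Tree b) ps → Tree b S
  loop : ∀ ψ φ s → Tree false (IndLoop.left ψ φ s) → Tree false (IndLoop.cutR ψ φ s) → Tree true (IndLoop.root ψ φ s)

node₁ : ∀ {b S ps} → BaseRule S ps → All (Tree b) ps → Tree b S
node₁ r = infer (inj₁ r)

axT : ∀ {b Γ Δ φ} → φ ∈ Γ → φ ∈ Δ → Tree b (Γ ⇒ Δ)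
axT i j = node₁ (wk (λ { (here refl) → i }) (λ { (here refl) → j })) (node₁ ax [] ∷ [])

castT : ∀ {b S S'} → S ≡ S' → Tree b S → Tree b S'
castT refl t = t

module _ (ψ : Formula 1) (φ : Formula 2) (s : Term 0) where
  open IndLoop ψ φ s

  leftTree : Tree false left
  leftTree = castT (cong (λ χ → (s `= fv x₀) ∷ Γ₀ ⇒ χ ∷ []) (inst1-single ψ (fv x₀) c fr))
      (node₁ (=L₁ (inst1 ψ (fv c)) c s (fv x₀)) (axT (here (inst1-single ψ s c fr)) (here refl) ∷ []))
    where
    c = supF ψ
    fr = freshF c ψ ℕₚ.≤-refl

  cutRTree : Tree false cutR
  cutRTree = node₁ (wk {Γ = Hereditary ψ φ ∷ inst1 ψ (fv z₀) ∷ inst2 φ (fv z₀) (fv x₀) ∷ []}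
      (λ { (here refl) → there (there (there (there (here refl)))) ; (there (here refl)) → here refl
         ; (there (there (here refl))) → there (there (here refl)) }) id)
    (node₁ (∀L (fv z₀)) (node₁ (∀L (fv x₀)) (castT (cong (λ χ → χ ∷ inst1 ψ (fv z₀) ∷ inst2 φ (fv z₀) (fv x₀) ∷ [] ⇒ Δ₀) (sym (stepInst ψ φ (fv z₀) (fv x₀))))
      (node₁ →L (axT (here refl) (here refl) ∷ node₁ →L (axT (there (here refl)) (here refl) ∷ axT (here refl) (here refl) ∷ []) ∷ [])) ∷ []) ∷ []) ∷ [])

  loopTree : Tree true root
  loopTree = loop ψ φ s leftTree cutRTree

indTree : ∀ {Γ Δ} ψ φ s t a b → a ≢ b → FreshL a Γ → FreshL a Δ → FreshF a ψ → FreshF a φ →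
          FreshL b Γ → FreshL b Δ → FreshF b ψ → FreshF b φ →
          Tree true (inst1 ψ (fv a) ∷ inst2 φ (fv a) (fv b) ∷ Γ ⇒ inst1 ψ (fv b) ∷ Δ) →
          Tree true (inst1 ψ s ∷ RTC φ s t ∷ Γ ⇒ inst1 ψ t ∷ Δ)
indTree {Γ} {Δ} ψ φ s t a b a≢b aΓ aΔ aψ aφ bΓ bΔ bψ bφ prem = node₁ (cut (Hereditary ψ φ))
    (node₁ (wk (there ∘ there) (λ { (here refl) → here refl ; (there i) → there (there i) })) (closedTree ∷ []) ∷
     node₁ (L.wkInst t (λ { (here refl) → there (there (here refl)) ; (there (here refl)) → there (here refl)
       ; (there (there (here refl))) → here refl }) (here refl)) (infer (inj₂ (subst (single L.x₀ t))) (loopTree ψ φ s ∷ []) ∷ []) ∷ [])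
  where
  module L = IndLoop ψ φ s
  -- Renaming a and b to names beyond a bound makes their freshness in Hereditary ψ φ immediate.
  a₁ b₁ : ℕ
  a₁ = supL Γ ⊔ (supL Δ ⊔ supF (`∀ (stepBody ψ φ)))
  b₁ = suc a₁ ⊔ supF (stepBody₁ ψ φ (fv a₁))
  a₁≤b₁ : a₁ ≤ b₁
  a₁≤b₁ = ℕₚ.<⇒≤ (ℕₚ.m≤m⊔n (suc a₁) (supF (stepBody₁ ψ φ (fv a₁))))
  ρ : ℕ → Term 0
  ρ = (fv [ a ↦ fv a₁ ]) [ b ↦ fv b₁ ]
  ρF : ∀ {n} (χ : Formula n) → FreshF a χ → FreshF b χ → fsubF ρ χ ≡ χ
  ρF χ p q = ≡.trans (upd-fresh (fv [ a ↦ fv a₁ ]) b (fv b₁) {χ} q) (≡.trans (upd-fresh fv a (fv a₁) {χ} p) (fsubF-id χ))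
  ρa : fsubT ρ (fv a) ≡ fv a₁
  ρa = ≡.trans (wk0-id _) (lemma (a ≡ᵇ b) refl)
    where
    lemma : ∀ c → (a ≡ᵇ b) ≡ c → ρ a ≡ fv a₁
    lemma true  e = ⊥-elim (a≢b (≡ᵇ-sound a b e))
    lemma false e rewrite e = upd-self fv a (fv a₁)
  ρb : fsubT ρ (fv b) ≡ fv b₁
  ρb = ≡.trans (wk0-id _) (upd-self (fv [ a ↦ fv a₁ ]) b (fv b₁))
  ρL : ∀ {Γ χ} → FreshL a Γ → FreshL b Γ → χ ∈ map (fsubF ρ) Γ → χ ∈ Γ
  ρL {Γ} p q m with ∈-map⁻ (fsubF ρ) m
  ... | χ , k , refl = ≡.subst (_∈ Γ) (sym (ρF χ (All.lookup p k) (All.lookup q k))) k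
  ψa : fsubF ρ (inst1 ψ (fv a)) ≡ inst1 ψ (fv a₁)
  ψa = ≡.trans (fsubF-inst1 ρ ψ (fv a)) (cong₂ inst1 (ρF ψ aψ bψ) ρa)
  ψb : fsubF ρ (inst1 ψ (fv b)) ≡ inst1 ψ (fv b₁)
  ψb = ≡.trans (fsubF-inst1 ρ ψ (fv b)) (cong₂ inst1 (ρF ψ aψ bψ) ρb)
  φab : fsubF ρ (inst2 φ (fv a) (fv b)) ≡ inst2 φ (fv a₁) (fv b₁)
  φab = ≡.trans (fsubF-inst2 ρ φ (fv a) (fv b)) (cong₃ inst2 (ρF φ aφ bφ) ρa ρb)
  renamed : Tree true (inst2 φ (fv a₁) (fv b₁) ∷ inst1 ψ (fv a₁) ∷ Γ ⇒ inst1 ψ (fv b₁) ∷ Δ)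
  renamed = node₁ (wk (λ { (here e) → there (here (≡.trans e ψa)) ; (there (here e)) → here (≡.trans e φab)
                         ; (there (there i)) → there (there (ρL aΓ bΓ i)) })
                      (λ { (here e) → here (≡.trans e ψb) ; (there i) → there (ρL aΔ bΔ i) }))
    (infer (inj₂ (subst ρ)) (prem ∷ []) ∷ [])
  closedTree : Tree true (Γ ⇒ Hereditary ψ φ ∷ Δ)
  closedTree = node₁ (∀R a₁ (freshL a₁ Γ Γ≤) (freshL a₁ Δ Δ≤) (freshF a₁ (`∀ (stepBody ψ φ)) (≤⊔ʳ (supL Γ) (ℕₚ.m≤n⊔m (supL Δ) (supF (`∀ (stepBody ψ φ)))))))
    (node₁ (∀R b₁ (freshL b₁ Γ (ℕₚ.≤-trans Γ≤ a₁≤b₁)) (freshL b₁ Δ (ℕₚ.≤-trans Δ≤ a₁≤b₁)) (freshF b₁ (stepBody₁ ψ φ (fv a₁)) (ℕₚ.m≤n⊔m (suc a₁) (supF (stepBody₁ ψ φ (fv a₁))))))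
      (castT (cong (λ χ → Γ ⇒ χ ∷ Δ) (sym (stepInst ψ φ (fv a₁) (fv b₁)))) (node₁ →R (node₁ →R (renamed ∷ []) ∷ [])) ∷ []) ∷ [])
    where
    Γ≤ : supL Γ ≤ a₁
    Γ≤ = ℕₚ.m≤m⊔n (supL Γ) _
    Δ≤ : supL Δ ≤ a₁
    Δ≤ = ≤⊔ʳ (supL Γ) (ℕₚ.m≤m⊔n (supL Δ) _)

mutual
  toTree : ∀ {S} → RTCG+A⊢ S → Tree true S
  toTree (by (inj₁ r) ds)        = infer (inj₁ r) (toTrees ds)
  toTree (by (inj₂ (inj₁ r)) ds) = infer (inj₂ r) (toTrees ds)
  toTree (by (inj₂ (inj₂ (ind ψ φ s t a b ne p₁ p₂ p₃ p₄ q₁ q₂ q₃ q₄))) (d ∷ [])) =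
    indTree ψ φ s t a b ne p₁ p₂ p₃ p₄ q₁ q₂ q₃ q₄ (toTree d)

  toTrees : ∀ {ps} → All RTCG+A⊢_ ps → All (Tree true) ps
  toTrees []       = []
  toTrees (d ∷ ds) = toTree d ∷ toTrees ds

-- The finite graph of a tree with loops, and the traces in it

child-of : ∀ {P : Seq → Set} {ps} → All P ps → (j : Fin (length ps)) → P (lookup ps j)
child-of (t ∷ ts) zero    = t
child-of (t ∷ ts) (suc j) = child-of ts j

-- The nodes of the cyclic proof: subtrees, and the three inner nodes (cut), (wk), (Subst) of a loop.
data Obj : Set where
  tree : ∀ {b S} → Tree b S → Obj
  cutN wkN substN : ∀ ψ φ s → Tree false (IndLoop.left ψ φ s) → Tree false (IndLoop.cutR ψ φ s) → Obj

seqO : Obj → Seq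
seqO (tree {S = S} _)  = S
seqO (cutN ψ φ s _ _)  = IndLoop.right ψ φ s
seqO (wkN ψ φ s _ _)   = IndLoop.cutL ψ φ s
seqO (substN ψ φ s _ _) = IndLoop.inst ψ φ s (fv (IndLoop.z₀ ψ φ s))

premsO : Obj → List Seq
premsO (tree (infer {ps = ps} _ _)) = ps
premsO (tree (loop ψ φ s _ _)) = IndLoop.left ψ φ s ∷ IndLoop.right ψ φ s ∷ []
premsO (cutN ψ φ s _ _)   = IndLoop.cutL ψ φ s ∷ IndLoop.cutR ψ φ s ∷ []
premsO (wkN ψ φ s _ _)    = IndLoop.inst ψ φ s (fv (IndLoop.z₀ ψ φ s)) ∷ []
premsO (substN ψ φ s _ _) = IndLoop.root ψ φ s ∷ []

ruleO : ∀ o → CycRule (seqO o) (premsO o)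
ruleO (tree (infer (inj₁ r) _)) = inj₁ r
ruleO (tree (infer (inj₂ r) _)) = inj₂ (inj₁ r)
ruleO (tree (loop ψ φ s _ _))  = inj₂ (inj₂ (IndLoop.caseRule ψ φ s))
ruleO (cutN ψ φ s _ _) = inj₁ (cut (inst1 ψ (fv (IndLoop.z₀ ψ φ s))))
ruleO (wkN ψ φ s _ _)  = inj₁ (IndLoop.wkInst ψ φ s (fv (IndLoop.z₀ ψ φ s)) (λ { (here e) → here e ; (there i) → there (there i) }) (here refl))
ruleO (substN ψ φ s _ _) = inj₂ (inj₁ (subst (single (IndLoop.x₀ ψ φ s) (fv (IndLoop.z₀ ψ φ s)))))

childO : ∀ o → Fin (length (premsO o)) → Obj
childO (tree (infer _ ts)) j = tree (child-of ts j)
childO (tree (loop ψ φ s t u)) zero       = tree t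
childO (tree (loop ψ φ s t u)) (suc zero) = cutN ψ φ s t u
childO (cutN ψ φ s t u) zero       = wkN ψ φ s t u
childO (cutN ψ φ s t u) (suc zero) = tree u
childO (wkN ψ φ s t u) zero    = substN ψ φ s t u
childO (substN ψ φ s t u) zero = tree (loop ψ φ s t u)

childO-seq : ∀ o j → seqO (childO o j) ≡ lookup (premsO o) j
childO-seq (tree (infer _ _)) j = refl
childO-seq (tree (loop ψ φ s t u)) zero       = refl
childO-seq (tree (loop ψ φ s t u)) (suc zero) = refl
childO-seq (cutN ψ φ s t u) zero       = refl
childO-seq (cutN ψ φ s t u) (suc zero) = refl
childO-seq (wkN ψ φ s t u) zero    = refl
childO-seq (substN ψ φ s t u) zero = refl

mutual
  below : ∀ {b S} → Tree b S → List Obj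
  below (infer _ ts)        = belows ts
  below (loop ψ φ s t u) = cutN ψ φ s t u ∷ wkN ψ φ s t u ∷ substN ψ φ s t u ∷ (subtrees t ++ subtrees u)

  subtrees : ∀ {b S} → Tree b S → List Obj
  subtrees t = tree t ∷ below t

  belows : ∀ {b ps} → All (Tree b) ps → List Obj
  belows []       = []
  belows (t ∷ ts) = subtrees t ++ belows ts

child∈belows : ∀ {b ps} (ts : All (Tree b) ps) j → tree (child-of ts j) ∈ belows ts
child∈belows (t ∷ ts) zero    = here refl
child∈belows (t ∷ ts) (suc j) = there (∈-++⁺ʳ (below t) (child∈belows ts j))

mutual
  subtrees-closed : ∀ {b S} (t : Tree b S) {o} → o ∈ subtrees t → ∀ j → childO o j ∈ subtrees t
  subtrees-closed (infer r ts) (here refl) j = there (child∈belows ts j)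
  subtrees-closed (infer r ts) (there i) j = there (belows-closed ts i j)
  subtrees-closed (loop ψ φ s t u) (here refl) zero = there (there (there (there (here refl))))
  subtrees-closed (loop ψ φ s t u) (here refl) (suc zero) = there (here refl)
  subtrees-closed (loop ψ φ s t u) (there (here refl)) zero = there (there (here refl))
  subtrees-closed (loop ψ φ s t u) (there (here refl)) (suc zero) = there (there (there (there (∈-++⁺ʳ (subtrees t) (here refl)))))
  subtrees-closed (loop ψ φ s t u) (there (there (here refl))) zero = there (there (there (here refl)))
  subtrees-closed (loop ψ φ s t u) (there (there (there (here refl)))) zero = here refl
  subtrees-closed (loop ψ φ s t u) (there (there (there (there i)))) j with ∈-++⁻ (subtrees t) i
  ... | inj₁ i₁ = there (there (there (there (∈-++⁺ˡ (subtrees-closed t i₁ j)))))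
  ... | inj₂ i₂ = there (there (there (there (∈-++⁺ʳ (subtrees t) (subtrees-closed u i₂ j)))))

  belows-closed : ∀ {b ps} (ts : All (Tree b) ps) {o} → o ∈ belows ts → ∀ j → childO o j ∈ belows ts
  belows-closed (t ∷ ts) i j with ∈-++⁻ (subtrees t) i
  ... | inj₁ i₁ = ∈-++⁺ˡ (subtrees-closed t i₁ j)
  ... | inj₂ i₂ = ∈-++⁺ʳ (subtrees t) (belows-closed ts i₂ j)

module ToCyclic {S : Seq} (t₀ : Tree true S) where

  objs : List Obj
  objs = subtrees t₀

  obj : Fin (length objs) → Obj
  obj = lookup objs

  -- The membership proof itself locates the child in the list, so objects need not be compared.
  kid : ∀ i → (j : Fin (length (premsO (obj i)))) → childO (obj i) j ∈ objs
  kid i j = subtrees-closed t₀ (∈-lookup i) j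

  graph : PreProof
  graph = record
    { size = length objs ; seq = seqO ∘ obj ; prems = premsO ∘ obj ; rule = ruleO ∘ obj
    ; child = λ i j → Any.index (kid i j)
    ; childOK = λ i j → ≡.trans (cong seqO (sym (Anyₚ.lookup-index (kid i j)))) (childO-seq (obj i) j)
    ; root = zero }

  module _ (π : PreProof.Path graph) where
    open PreProof.Path π

    at : ℕ → Obj
    at n = obj (node n)

    -- `at n` equals the expected object only propositionally. The direction and the trace relation
    -- are restated for that object, where case analysis on the direction computes.
    record Step (n : ℕ) (o : Obj) : Set where
      constructor mkStep
      field
        to    : Fin (length (premsO o))
        at⁺   : at (suc n) ≡ childO o to
        prog⁺ : ∀ {τ τ'} → Prog (ruleO o) to τ τ' → Prog (ruleO (at n)) (dir n) τ τ'
        step⁺ : ∀ {τ τ'} → TStep (ruleO o) to τ τ' → TStep (ruleO (at n)) (dir n) τ τ'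

    step : ∀ n {o} → at n ≡ o → Step n o
    step n refl = mkStep (dir n) (≡.trans (cong obj (next n)) (sym (Anyₚ.lookup-index (kid (node n) (dir n))))) id id

    mutual
      -- A path in a loop-free tree would descend forever through a finite tree.
      ends : ∀ {S} (t : Tree false S) n → at n ≡ tree t → ⊥
      ends (infer r ts) n e with step n e
      ... | mkStep j e' _ _ = endsAll ts j (suc n) e'

      endsAll : ∀ {ps} (ts : All (Tree false) ps) j n → at n ≡ tree (child-of ts j) → ⊥
      endsAll (t ∷ ts) zero    n e = ends t n e
      endsAll (t ∷ ts) (suc j) n e = endsAll ts j n e

    module _ (ψ : Formula 1) (φ : Formula 2) (s : Term 0) (t : Tree false (IndLoop.left ψ φ s)) (u : Tree false (IndLoop.cutR ψ φ s)) where
      private module L = IndLoop ψ φ s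

      pos : ℕ → Obj
      pos 0 = tree (loop ψ φ s t u)
      pos 1 = cutN ψ φ s t u
      pos 2 = wkN ψ φ s t u
      pos 3 = substN ψ φ s t u
      pos (suc (suc (suc (suc q)))) = pos q

      τ : ℕ → Formula 0
      τ 0 = RTC φ s (fv L.x₀)
      τ 1 = RTC φ s (fv L.z₀)
      τ 2 = RTC φ s (fv L.z₀)
      τ 3 = RTC φ s (fv L.z₀)
      τ (suc (suc (suc (suc q)))) = τ q

      τ-rtc : ∀ q → IsRTC (τ q)
      τ-rtc 0 = isRTC _ _ _
      τ-rtc 1 = isRTC _ _ _
      τ-rtc 2 = isRTC _ _ _
      τ-rtc 3 = isRTC _ _ _
      τ-rtc (suc (suc (suc (suc q)))) = τ-rtc q

      τ-mem : ∀ q → τ q ∈ ante (seqO (pos q))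
      τ-mem 0 = here refl
      τ-mem 1 = here refl
      τ-mem 2 = here refl
      τ-mem 3 = here (sym (L.instRTC (fv L.z₀)))
      τ-mem (suc (suc (suc (suc q)))) = τ-mem q

      -- Both exits from the cycle lead into loop-free trees, excluded by `ends`; the path is forced
      -- around.
      advance : ∀ q n → at n ≡ pos q → at (suc n) ≡ pos (suc q) × TStep (ruleO (at n)) (dir n) (τ q) (τ (suc q))
      advance 0 n e with step n e
      ... | mkStep zero e' _ _ = ⊥-elim (ends t (suc n) e')
      ... | mkStep (suc zero) e' _ st = e' , st (inj₁ (refl , refl , refl))
      advance 1 n e with step n e
      ... | mkStep zero e' _ st = e' , st (inj₂ refl)
      ... | mkStep (suc zero) e' _ _ = ⊥-elim (ends u (suc n) e')
      advance 2 n e with step n e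
      ... | mkStep zero e' _ st = e' , st (inj₂ refl)
      advance 3 n e with step n e
      -- Across (Subst) the trace formula with end point `z₀` is an instance of the one with end
      -- point `x₀`, which closes its period.
      ... | mkStep zero e' _ st = e' , st (inj₂ (sym (L.instRTC (fv L.z₀))))
      advance (suc (suc (suc (suc q)))) n e = advance q n e

      -- The multiples of 4, the length of the cycle: the times at which (Case) is passed.
      quad : ℕ → ℕ
      quad zero    = 0
      quad (suc r) = suc (suc (suc (suc (quad r))))

      ≤quad : ∀ r → r ≤ quad r
      ≤quad zero    = z≤n
      ≤quad (suc r) = s≤s (ℕₚ.≤-trans (≤quad r) (ℕₚ.m≤n+m (quad r) 3))

      progress : ∀ r n → at n ≡ pos (quad r) → Prog (ruleO (at n)) (dir n) (τ (quad r)) (τ (suc (quad r)))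
      progress zero n e with step n e
      ... | mkStep zero e' _ _ = ⊥-elim (ends t (suc n) e')
      ... | mkStep (suc zero) e' pr _ = pr (refl , refl , refl)
      progress (suc r) n e = progress r n e

      loopTrace : ∀ n → at n ≡ tree (loop ψ φ s t u) → PreProof.InfProgTrace graph π
      loopTrace n e = n , τ , τ-rtc , (λ q → ≡.subst (λ o → τ q ∈ ante (seqO o)) (sym (ats q)) (τ-mem q)) ,
          (λ q → proj₂ (advance q (n ℕ.+ q) (ats q))) , λ r → quad r , ≤quad r , progress r (n ℕ.+ quad r) (ats (quad r))
        where
        ats : ∀ q → at (n ℕ.+ q) ≡ pos q
        ats zero    = ≡.trans (cong at (ℕₚ.+-identityʳ n)) e
        ats (suc q) = ≡.trans (cong at (ℕₚ.+-suc n q)) (proj₁ (advance q (n ℕ.+ q) (ats q)))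

    mutual
      -- The recursion on the tree follows the path until it meets a loop.
      trace : ∀ {S} (t : Tree true S) n → at n ≡ tree t → PreProof.InfProgTrace graph π
      trace (infer r ts) n e with step n e
      ... | mkStep j e' _ _ = traceAll ts j (suc n) e'
      trace (loop ψ φ s t u) n e = loopTrace ψ φ s t u n e

      traceAll : ∀ {ps} (ts : All (Tree true) ps) j n → at n ≡ tree (child-of ts j) → PreProof.InfProgTrace graph π
      traceAll (t ∷ ts) zero    n e = trace t n e
      traceAll (t ∷ ts) (suc j) n e = traceAll ts j n e

  cyclic : CRTCω+A⊢ S
  cyclic = record { graph = graph ; rootSeq = refl ; sound = λ π → trace π t₀ 0 (cong obj (PreProof.Path.start π)) }

theorem9 : ∀ (S : Seq) → ((RTCG+A⊢ S) → (CRTCω+A⊢ S)) × ((CRTCω+A⊢ S) → (RTCG+A⊢ S))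
theorem9 S = (λ d → ToCyclic.cyclic (toTree d)) ,
  λ c → ≡.subst RTCG+A⊢_ (CRTCω+A⊢_.rootSeq c) (FromCyclic.provable (CRTCω+A⊢_.graph c) (CRTCω+A⊢_.sound c))
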